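{- Let $\Phi$ be a finite crystallographic root system that is simply laced, and let $I\subseteq\Phi^+$ be an order ideal in the root poset. Then the following assertions are equivalent: (a) $I$ is supersolvable; (b) $I$ is chain peelable; (c) $I$ is not a star ideal.
   Context: Root systems are reduced. Let $\Phi$ be a finite crystallographic root system with positive roots $\Phi^+$ and simple roots $\Delta\subseteq\Phi^+$. Every $\gamma\in\Phi^+$ is uniquely $\gamma=\sum_{\alpha\in\Delta}\gamma_\alpha\alpha$ with nonnegative integers $\gamma_\alpha$. The root poset is the partial order on $\Phi^+$ given by $\gamma\le\gamma'$ iff $\gamma_\alpha\le\gamma'_\alpha$ for all $\alpha\in\Delta$. An order ideal is a subset $I\subseteq\Phi^+$ such that $\gamma_1\in I$ and $\gamma_2<\gamma_1$ imply $\gamma_2\in I$. $\Phi$ is simply laced if its Dynkin diagram has no multiple bonds. An ideal $I\subseteq\Phi^+$ is a star ideal if there are distinct simple roots $\alpha_1,\alpha_2,\alpha_3,\alpha_4\in\Delta$ such that $\alpha_1+\alpha_2+\alpha_3$, $\alpha_1+\alpha_2+\alpha_4$ and $\alpha_2+\alpha_3+\alpha_4$ all are roots that belong to $I$. For a finite set $\mathcal{A}$ of pairwise non-parallel vectors in a Euclidean space (such as $\mathcal{A}=I$), the closure of $S\subseteq\mathcal{A}$ is $\mathrm{cl}(S)=\mathcal{A}\cap\mathrm{span}\,S$; a flat is a closed subset; the rank of a subset is the dimension of its span; a $k$-flat is a flat of rank $k$. $\mathcal{A}$ is supersolvable if, with $n$ the rank of $\mathcal{A}$, there is a partition $\mathcal{A}=\Pi_1\uplus\cdots\uplus\Pi_n$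 such that for all $i\in\{1,\dots,n\}$, setting $\mathcal{A}_i=\Pi_1\uplus\cdots\uplus\Pi_i$: (1) $\mathcal{A}_i$ has rank $i$; (2) no $2$-flat of $\mathcal{A}_i$ is a subset of $\Pi_i$. A chain in a poset is a totally ordered subset; an order filter is the complement of an order ideal. Chain peelings of a finite poset $P$ are defined recursively. If $P$ is a chain, then $P$ is a chain peeling of itself (with one block; the empty poset is chain peelable). Otherwise, a chain peeling of $P$ is a partition $P=P_1\uplus\cdots\uplus P_n$, $n\ge2$, such that $P_n$ is an order filter of $P$ containing a minimal element of $P$, $P_n$ is a chain, and $P_1\uplus\cdots\uplus P_{n-1}$ is a chain peeling of $P\setminus P_n$. $P$ is chain peelable if it has a chain peeling. The ideal $I$ is regarded as a poset with the order induced from the root poset. -}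

module Defs where

open import Level using (Level; 0ℓ; _⊔_) renaming (suc to lsuc)
open import Algebra.Bundles using (CommutativeRing; Ring)
open import Algebra.Module.Bundles using (LeftModule)
open import Data.Fin.Base using (Fin; zero; suc; toℕ)
open import Data.Fin.Properties using (all?)
open import Data.Fin.Subset using (Subset; _∈_; _∉_; _⊆_; _∪_; _─_)
open import Data.Integer.Base as ℤ using (ℤ; 0ℤ; 1ℤ; +_; -[1+_])
import Data.Integer.Properties as ℤₚ
open import Data.List.Base using (List; []; _∷_)
open import Data.Nat.Base using (ℕ; suc)
open import Data.Product.Base using (Σ; ∃-syntax; _×_)
open import Data.Sum.Base using (_⊎_)
open import Data.Vec.Base using (tabulate)
open import Function.Base using (_∘_)
open import Relation.Binary.Core using (Rel)
open import Relation.Binary.PropositionalEquality.Core using (_≡_; _≢_)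
open import Relation.Binary.Structures using (IsStrictTotalOrder)
open import Relation.Nullary.Decidable.Core using (does)
open import Relation.Nullary.Negation.Core using (¬_)
open import Relation.Unary using (Pred; _≐_)

-- The scalars of a Euclidean space. The library has no real numbers, so they
-- range over all ordered fields with trichotomous order; classically, the real
-- numbers are one.
record OrderedField (k ℓ₁ ℓ₂ : Level) : Set (lsuc (k ⊔ ℓ₁ ⊔ ℓ₂)) where
  infix 4 _<_
  field
    commutativeRing : CommutativeRing k ℓ₁
  open CommutativeRing commutativeRing public
  field
    _<_                : Rel Carrier ℓ₂
    isStrictTotalOrder : IsStrictTotalOrder _≈_ _<_
    0≉1                : ¬ (0# ≈ 1#)
    inverse            : ∀ x → ¬ (x ≈ 0#) → ∃[ y ] x * y ≈ 1#
    +-monoˡ-<          : ∀ {x y} z → x < y → x + z < y + z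
    *-positive         : ∀ {x y} → 0# < x → 0# < y → 0# < x * y

module FromInteger {k ℓ} (R : Ring k ℓ) where
  open Ring R
  open import Algebra.Properties.Semiring.Mult semiring using () renaming (_×_ to _×ᴿ_)

  fromℤ : ℤ → Carrier
  fromℤ (+ n)      = n ×ᴿ 1#
  fromℤ (-[1+ n ]) = - (suc n ×ᴿ 1#)

module LinearAlgebra {k ℓ v ℓv} {R : Ring k ℓ} (V : LeftModule R v ℓv) where
  open Ring R using (Carrier; _≈_; 0#)
  open LeftModule V
  open import Algebra.Properties.CommutativeMonoid.Sum +ᴹ-commutativeMonoid
    using (sum)

  linComb : ∀ {m} → (Fin m → Carrier) → (Fin m → Carrierᴹ) → Carrierᴹ
  linComb c w = sum (λ i → c i *ₗ w i)

  LinearlyIndependent : ∀ {m} → (Fin m → Carrierᴹ) → Set (k ⊔ ℓ ⊔ ℓv)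
  LinearlyIndependent w = ∀ c → linComb c w ≈ᴹ 0ᴹ → ∀ i → c i ≈ 0#

  Span : ∀ {m} → (Fin m → Carrierᴹ) → Pred Carrierᴹ (k ⊔ ℓv)
  Span w x = ∃[ c ] linComb c w ≈ᴹ x

  -- The span of the vectors w j with j ∈ S.
  SpanOf : ∀ {N} → (Fin N → Carrierᴹ) → Subset N → Pred Carrierᴹ (k ⊔ ℓ ⊔ ℓv)
  SpanOf w S x = ∃[ c ] (∀ j → j ∉ S → c j ≈ 0#) × linComb c w ≈ᴹ x

  HasDimension : ∀ {p} → Pred Carrierᴹ p → ℕ → Set (k ⊔ ℓ ⊔ v ⊔ ℓv ⊔ p)
  HasDimension W d =
    Σ (Fin d → Carrierᴹ) λ b → LinearlyIndependent b × Span b ≐ W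

record EuclideanSpace {k ℓ₁ ℓ₂} (K : OrderedField k ℓ₁ ℓ₂) (v ℓv : Level)
       : Set (k ⊔ ℓ₁ ⊔ ℓ₂ ⊔ lsuc (v ⊔ ℓv)) where
  private module K = OrderedField K
  field
    leftModule : LeftModule K.ring v ℓv
  open LeftModule leftModule public
  open LinearAlgebra leftModule public
  field
    dimension         : ℕ
    basis             : Fin dimension → Carrierᴹ
    basis-independent : LinearlyIndependent basis
    basis-spans       : ∀ x → Span basis x
    ⟨_,_⟩             : Carrierᴹ → Carrierᴹ → K.Carrier
    ⟨⟩-cong           : ∀ {x x′ y y′} → x ≈ᴹ x′ → y ≈ᴹ y′ → ⟨ x , y ⟩ K.≈ ⟨ x′ , y′ ⟩
    ⟨⟩-sym            : ∀ x y → ⟨ x , y ⟩ K.≈ ⟨ y , x ⟩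
    ⟨⟩-additive       : ∀ x y z → ⟨ x +ᴹ y , z ⟩ K.≈ ⟨ x , z ⟩ K.+ ⟨ y , z ⟩
    ⟨⟩-homogeneous    : ∀ a x y → ⟨ a *ₗ x , y ⟩ K.≈ a K.* ⟨ x , y ⟩
    ⟨⟩-positive       : ∀ x → ¬ (x ≈ᴹ 0ᴹ) → K.0# K.< ⟨ x , x ⟩

-- Finite sets 𝒜 of vectors, given as subsets of the index set of a finite
-- family w of vectors of V. The notions below are meant for 𝒜 consisting of
-- pairwise non-parallel vectors; sets of positive roots of a reduced root
-- system are of this kind.
module Arrangement {k ℓ v ℓv} {R : Ring k ℓ} (V : LeftModule R v ℓv)
                   {N : ℕ} (w : Fin N → LeftModule.Carrierᴹ V) where
  open LinearAlgebra V

  HasRank : Subset N → ℕ → Set (k ⊔ ℓ ⊔ v ⊔ ℓv)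
  HasRank S d = HasDimension (SpanOf w S) d

  cl : Subset N → Subset N → Pred (Fin N) (k ⊔ ℓ ⊔ ℓv)
  cl 𝒜 S j = j ∈ 𝒜 × SpanOf w S (w j)

  IsFlat : Subset N → Subset N → Set (k ⊔ ℓ ⊔ ℓv)
  IsFlat 𝒜 F = F ⊆ 𝒜 × cl 𝒜 F ≐ (_∈ F)

  record IsPartition (𝒜 : Subset N) {n : ℕ} (Π : Fin n → Subset N) : Set where
    field
      within   : ∀ i → Π i ⊆ 𝒜
      covers   : ∀ {j} → j ∈ 𝒜 → ∃[ i ] j ∈ Π i
      disjoint : ∀ {i i′ j} → j ∈ Π i → j ∈ Π i′ → i ≡ i′

  -- upTo Π i is the union of the Π i′ with i′ ≤ i.
  upTo : ∀ {n} → (Fin n → Subset N) → Fin n → Subset N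
  upTo Π zero    = Π zero
  upTo Π (suc i) = Π zero ∪ upTo (Π ∘ suc) i

  Supersolvable : Subset N → Set (k ⊔ ℓ ⊔ v ⊔ ℓv)
  Supersolvable 𝒜 =
    ∃[ n ] HasRank 𝒜 n ×
    Σ (Fin n → Subset N) λ Π → IsPartition 𝒜 Π ×
    (∀ i → HasRank (upTo Π i) (suc (toℕ i)) ×
           (∀ F → IsFlat (upTo Π i) F → HasRank F 2 → ¬ (F ⊆ Π i)))

-- Finite posets, given as subsets P of Fin N with the order induced by _≼_.
module FinitePoset {N : ℕ} (_≼_ : Rel (Fin N) 0ℓ) where

  _≺_ : Rel (Fin N) 0ℓ
  x ≺ y = x ≼ y × x ≢ y

  IsChain : Subset N → Set
  IsChain P = ∀ {x y} → x ∈ P → y ∈ P → x ≼ y ⊎ y ≼ x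

  IsOrderIdeal : (P J : Subset N) → Set
  IsOrderIdeal P J = J ⊆ P × (∀ {x y} → x ∈ J → y ∈ P → y ≺ x → y ∈ J)

  IsOrderFilter : (P F : Subset N) → Set
  IsOrderFilter P F = F ⊆ P × IsOrderIdeal P (P ─ F)

  IsMinimal : (P : Subset N) → Fin N → Set
  IsMinimal P x = x ∈ P × (∀ {y} → y ∈ P → ¬ (y ≺ x))

  -- The blocks are listed in the order Pₙ, …, P₁.
  data ChainPeeling : Subset N → List (Subset N) → Set where
    chain : ∀ {P} → IsChain P → ChainPeeling P (P ∷ [])
    peel  : ∀ {P Pₙ Ps} → ¬ IsChain P →
            IsOrderFilter P Pₙ → (∃[ x ] IsMinimal P x × x ∈ Pₙ) → IsChain Pₙ →
            ChainPeeling (P ─ Pₙ) Ps → ChainPeeling P (Pₙ ∷ Ps)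

  ChainPeelable : Subset N → Set
  ChainPeelable P = ∃[ Ps ] ChainPeeling P Ps

-- Reduced crystallographic root systems Φ = {root i | i : Fin size}. As is
-- common for reflection groups, Φ is not required to span E.
record RootSystem {k ℓ₁ ℓ₂ v ℓv} {K : OrderedField k ℓ₁ ℓ₂}
                  (E : EuclideanSpace K v ℓv) : Set (k ⊔ ℓ₁ ⊔ v ⊔ ℓv) where
  private module K = OrderedField K
  open EuclideanSpace E
  open FromInteger K.ring
  field
    size      : ℕ
    root      : Fin size → Carrierᴹ
    injective : ∀ {α β} → root α ≈ᴹ root β → α ≡ β
    nonzero   : ∀ α → ¬ (root α ≈ᴹ 0ᴹ)
    negation  : ∀ α → ∃[ β ] root β ≈ᴹ -ᴹ root α
    reduced   : ∀ α β t → root β ≈ᴹ t *ₗ root α →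
                root β ≈ᴹ root α ⊎ root β ≈ᴹ -ᴹ root α
    -- cartan β α is the integer 2 ⟨ β , α ⟩ / ⟨ α , α ⟩.
    cartan           : Fin size → Fin size → ℤ
    crystallographic : ∀ β α → fromℤ (cartan β α) K.* ⟨ root α , root α ⟩
                               K.≈ fromℤ (+ 2) K.* ⟨ root β , root α ⟩
    reflection       : ∀ α β → ∃[ γ ] root γ ≈ᴹ
                       root β +ᴹ -ᴹ (fromℤ (cartan β α) *ₗ root α)

record SimpleSystem {k ℓ₁ ℓ₂ v ℓv} {K : OrderedField k ℓ₁ ℓ₂}
                    {E : EuclideanSpace K v ℓv} (Φ : RootSystem E)
                    : Set (k ⊔ ℓ₁ ⊔ v ⊔ ℓv) where
  private module K = OrderedField K
  open EuclideanSpace E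
  open FromInteger K.ring
  open RootSystem Φ
  field
    rank        : ℕ
    simple      : Fin rank → Fin size
    independent : LinearlyIndependent (root ∘ simple)
    -- Determined by expansion, since the simple roots are independent.
    coeff       : Fin size → Fin rank → ℤ
    expansion   : ∀ γ → root γ ≈ᴹ linComb (fromℤ ∘ coeff γ) (root ∘ simple)
    sameSign    : ∀ γ → (∀ i → 0ℤ ℤ.≤ coeff γ i) ⊎ (∀ i → coeff γ i ℤ.≤ 0ℤ)

  Φ⁺ : Subset size
  Φ⁺ = tabulate (λ γ → does (all? (λ i → 0ℤ ℤₚ.≤? coeff γ i)))

  -- The order of the root poset, on Φ⁺.
  _≼_ : Rel (Fin size) 0ℓ
  γ ≼ γ′ = ∀ i → coeff γ i ℤ.≤ coeff γ′ i

  open FinitePoset _≼_ public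
  open Arrangement leftModule root public using (Supersolvable)

  -- The number of bonds joining two distinct nodes of the Dynkin diagram.
  bonds : Fin rank → Fin rank → ℤ
  bonds i j = cartan (simple i) (simple j) ℤ.* cartan (simple j) (simple i)

  SimplyLaced : Set
  SimplyLaced = ∀ i j → i ≢ j → bonds i j ℤ.≤ 1ℤ

  SumIn : Subset size → Fin rank → Fin rank → Fin rank → Set ℓv
  SumIn I i j l = ∃[ γ ] γ ∈ I ×
    root γ ≈ᴹ root (simple i) +ᴹ root (simple j) +ᴹ root (simple l)

  IsStar : Subset size → Set ℓv
  IsStar I = ∃[ a₁ ] ∃[ a₂ ] ∃[ a₃ ] ∃[ a₄ ]
    (a₁ ≢ a₂ × a₁ ≢ a₃ × a₁ ≢ a₄ × a₂ ≢ a₃ × a₂ ≢ a₄ × a₃ ≢ a₄) ×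
    SumIn I a₁ a₂ a₃ × SumIn I a₁ a₂ a₄ × SumIn I a₂ a₃ a₄

{-# OPTIONS --safe #-}
module Submission where

-- Write roots as integral vectors in the basis of simple roots. The symmetrised Cartan form
-- is positive definite and takes the value 2 on every root.
--
-- Not star ⇒ peelable: the null vector 2π + s₁ + s₂ + s₃ + s₄ of an affine D̃ diagram cannot
-- occur, so each component of the diagram has at most one branch vertex, and the end of a
-- suitable arm of it (one leading into a missing triple j + s + t) has a chain above it in I.
--
-- Peelable ⇒ supersolvable: if the roots of I above a simple root α form a chain, then the
-- difference γ - β of any two of them is a root of I without α. So every 2-flat through β
-- and γ leaves the block, and adding the block raises the rank by one.
--
-- Supersolvable ⇒ not star: the unions of initial blocks are closed, and two orthogonal roots
-- span a 2-flat without further roots, so they cannot enter in the same block. Of each of the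
-- triples of pairwise orthogonal roots a, b, c; j+a, j+b, j+c; j+a+b, j+a+c, j+b+c of a star at
-- most one root is in the block completing {a, b, c, j}, and then the earlier blocks
-- already span all of them.

open import Defs
open import Algebra.Module.Bundles using (LeftModule)
open import Data.Empty using (⊥; ⊥-elim)
open import Data.Fin.Base as Fin using (Fin; fromℕ; fromℕ<; inject₁; punchIn; suc; toℕ; zero)
open import Data.Fin.Properties as Fin using (_≟_; all?; any?; toℕ-fromℕ; toℕ-fromℕ<; toℕ-injective; toℕ-inject₁; toℕ<n)
open import Data.Fin.Subset using (Subset; _∈_; _∉_; _∪_; _⊆_; _─_; inside; outside; ∣_∣)
open import Data.Fin.Subset.Properties using (_∈?_; p⊂q⇒∣p∣<∣q∣; p─q⊆p; x∈p∧x∉q⇒x∈p─q; x∈p∪q⁺; x∈p∪q⁻; ⊆-antisym)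
open import Data.Integer.Tactic.RingSolver using (solve-∀)
open import Data.Nat.Base as ℕ using (suc; s≤s; zero; z≤n; ℕ)
open import Data.Product.Base using (_,_; _×_; proj₁; proj₂; Σ-syntax; ∃-syntax)
open import Data.Sum.Base using ([_,_]′; _⊎_; inj₁; inj₂)
open import Function.Base using (_∘_; case_of_)
open import Relation.Nullary using (Dec; no; yes; ¬_)
open import Relation.Nullary.Decidable using (_×-dec_; _→-dec_; _⊎-dec_; dec-true; decidable-stable; does; map′; ¬?)
import Data.Integer.Properties as ℤ
import Data.Nat.Properties as ℕ
open import Function.Bundles using (_⇔_; mk⇔)

-- The peeling step rests on one fact: in an ideal without a star every root has coefficients 0 and
-- 1 (`coefficient≤1`). A root is then a set of vertices of the diagram, and a chain above α means
-- that no root above α can be enlarged by two different simple roots. This condition travels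
-- outwards along an arm (`Arm`), so it only has to be established where the arm starts: at a
-- missing triple or, in a component without branch vertex, at the opposite leaf. No classification
-- of diagrams is used; that a path never closes up and that an arm does not branch again are read
-- off from positive definiteness during the walk. In the second implication the obstacle is that
-- `γ - β` must be a root; it is one because the chain condition forces `⟪ β , γ ⟫ ≡ 1` for distinct
-- roots above α. In the third, a star sinks from stage to stage of the partition until it would lie
-- in the empty one. The form is integral and normalised to 2 on every component, since the scalars
-- are an arbitrary ordered field and components may differ in root length.

module IntegralVectors where

  open import Data.Integer.Base using (ℤ; 0ℤ; 1ℤ; -1ℤ; _+_; _*_; -_; _-_; _≤_; _<_; +≤+) renaming (+_ to pos)
  open import Relation.Binary.PropositionalEquality
  open import Data.Bool.Base using (if_then_else_; true; false)

  -- Linear arithmetic over ℤ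

  -- An inequality is certified by writing its slack as the sum of the slacks of the hypotheses; the
  -- identity between the slacks is then left to the ring solver.
  lin₁ : ∀ {a b c d} → c ≤ d → b - a ≡ d - c → a ≤ b
  lin₁ {a} {b} c≤d eq = ℤ.0≤i-j⇒j≤i (subst (0ℤ ≤_) (sym eq) (ℤ.i≤j⇒0≤j-i c≤d))

  lin₂ : ∀ {a b c d c′ d′} → c ≤ d → c′ ≤ d′ → b - a ≡ (d - c) + (d′ - c′) → a ≤ b
  lin₂ {a} {b} {c} {d} {c′} {d′} p q eq = lin₁ (ℤ.+-mono-≤ p q) (trans eq (regroup d c d′ c′))
    where
    regroup : ∀ d c d′ c′ → (d - c) + (d′ - c′) ≡ (d + d′) - (c + c′)
    regroup = solve-∀

  lin₃ : ∀ {a b c d c′ d′ c″ d″} → c ≤ d → c′ ≤ d′ → c″ ≤ d″ →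
         b - a ≡ (d - c) + (d′ - c′) + (d″ - c″) → a ≤ b
  lin₃ {a} {b} {c} {d} {c′} {d′} {c″} {d″} p q r eq =
    lin₂ (ℤ.+-mono-≤ p q) r (trans eq (regroup d c d′ c′ (d″ - c″)))
    where
    regroup : ∀ d c d′ c′ z → (d - c) + (d′ - c′) + z ≡ ((d + d′) - (c + c′)) + z
    regroup = solve-∀

  1≰0 : ¬ (1ℤ ≤ 0ℤ)
  1≰0 (+≤+ ())

  <⇒1+≤ : ∀ {a b} → a < b → 1ℤ + a ≤ b
  <⇒1+≤ = ℤ.i<j⇒suc[i]≤j

  ≰⇒1+≤ : ∀ {a b} → ¬ (a ≤ b) → 1ℤ + b ≤ a
  ≰⇒1+≤ = <⇒1+≤ ∘ ℤ.≰⇒>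

  ≤∨1+≤ : ∀ a b → a ≤ b ⊎ 1ℤ + b ≤ a
  ≤∨1+≤ a b with a ℤ.≤? b
  ... | yes p = inj₁ p
  ... | no ¬p = inj₂ (≰⇒1+≤ ¬p)

  0≤x*y : ∀ {x y} → 0ℤ ≤ x → 0ℤ ≤ y → 0ℤ ≤ x * y
  0≤x*y {pos m} {pos n} _ _ = subst (0ℤ ≤_) (ℤ.pos-* m n) (+≤+ z≤n)

  1≤⇒≢0 : ∀ {x} → 1ℤ ≤ x → x ≢ 0ℤ
  1≤⇒≢0 p refl = 1≰0 p

  a+b≡c⇒a≡c-b : ∀ {a b c} → a + b ≡ c → a ≡ c - b
  a+b≡c⇒a≡c-b {a} {b} refl = eq a b
    where
    eq : ∀ a b → a ≡ a + b - b
    eq = solve-∀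

  -- Finite sums

  open import Algebra.Properties.Semiring.Sum ℤ.+-*-semiring public
    using (sum; sum-cong-≗; ∑-distrib-+; ∑-comm; *-distribˡ-sum; *-distribʳ-sum)

  sum-zero : ∀ {n} {t : Fin n → ℤ} → (∀ i → t i ≡ 0ℤ) → sum t ≡ 0ℤ
  sum-zero {zero}  h = refl
  sum-zero {suc n} h = cong₂ _+_ (h zero) (sum-zero (h ∘ suc))

  sum-single : ∀ {n} (t : Fin n → ℤ) i → (∀ j → i ≢ j → t j ≡ 0ℤ) → sum t ≡ t i
  sum-single t zero    h = trans (cong (t zero +_) (sum-zero (λ j → h (suc j) λ ()))) (ℤ.+-identityʳ _)
  sum-single t (suc i) h = trans
      (cong₂ _+_ (h zero λ ()) (sum-single (t ∘ suc) i λ j i≢j → h (suc j) λ { refl → i≢j refl }))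
                                 (ℤ.+-identityˡ _)

  sum-mono : ∀ {n} {s t : Fin n → ℤ} → (∀ i → s i ≤ t i) → sum s ≤ sum t
  sum-mono {zero}  h = ℤ.≤-refl
  sum-mono {suc n} h = ℤ.+-mono-≤ (h zero) (sum-mono (h ∘ suc))

  sum-nonneg : ∀ {n} {t : Fin n → ℤ} → (∀ i → 0ℤ ≤ t i) → 0ℤ ≤ sum t
  sum-nonneg {zero}  h = ℤ.≤-refl
  sum-nonneg {suc n} h = ℤ.+-mono-≤ (h zero) (sum-nonneg (h ∘ suc))

  sum≤0⇒zero : ∀ {n} {t : Fin n → ℤ} → (∀ i → 0ℤ ≤ t i) → sum t ≤ 0ℤ → ∀ i → t i ≡ 0ℤ
  sum≤0⇒zero {suc n} {t} h le zero    =
      ℤ.≤-antisym (lin₂ le (sum-nonneg (h ∘ suc)) (eq (t zero) (sum (t ∘ suc)))) (h zero)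
    where
    eq : ∀ a b → 0ℤ - a ≡ (0ℤ - (a + b)) + (b - 0ℤ)
    eq = solve-∀
  sum≤0⇒zero {suc n} {t} h le (suc i) = sum≤0⇒zero (h ∘ suc) (lin₂ le (h zero) (eq (t zero) (sum (t ∘ suc)))) i
    where
    eq : ∀ a b → 0ℤ - b ≡ (0ℤ - (a + b)) + (a - 0ℤ)
    eq = solve-∀

  ∃-positive-term : ∀ {n} (t : Fin n → ℤ) → 1ℤ ≤ sum t → ∃[ i ] 1ℤ ≤ t i
  ∃-positive-term {n} t 1≤Σ with any? (λ i → 1ℤ ℤ.≤? t i)
  ... | yes p = p
  ... | no ¬p = ⊥-elim (1≰0 (ℤ.≤-trans 1≤Σ
    (subst (λ z → sum t ≤ z) (sum-zero {n} {λ _ → 0ℤ} λ _ → refl) (sum-mono {n} t≤0))))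
    where
    t≤0 : ∀ i → t i ≤ 0ℤ
    t≤0 i = case ≤∨1+≤ (t i) 0ℤ of λ { (inj₁ q) → q ; (inj₂ q) → ⊥-elim (¬p (i , q)) }

  ∃-negative-term : ∀ {n} (t : Fin n → ℤ) → sum t ≤ -1ℤ → ∃[ i ] t i ≤ -1ℤ
  ∃-negative-term t neg with any? (λ i → t i ℤ.≤? -1ℤ)
  ... | yes p = p
  ... | no ¬p = ⊥-elim (case ℤ.≤-trans (sum-nonneg λ i → ≰⇒1+≤ (λ q → ¬p (i , q))) neg of λ ())

  -- Integral vectors

  Vector : ℕ → Set
  Vector r = Fin r → ℤ

  infixl 6 _⊕_ _⊖_
  _⊕_ _⊖_ : ∀ {r} → Vector r → Vector r → Vector r
  (x ⊕ y) i = x i + y i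
  (x ⊖ y) i = x i - y i

  infix 4 _≤ᵛ_
  _≤ᵛ_ : ∀ {r} → Vector r → Vector r → Set
  x ≤ᵛ y = ∀ i → x i ≤ y i

  e : ∀ {r} → Fin r → Vector r
  e i j = if does (i ≟ j) then 1ℤ else 0ℤ

  e-same : ∀ {r} (i : Fin r) → e i i ≡ 1ℤ
  e-same i with i ≟ i
  ... | yes _ = refl
  ... | no ¬p = ⊥-elim (¬p refl)

  e-diff : ∀ {r} {i j : Fin r} → i ≢ j → e i j ≡ 0ℤ
  e-diff {i = i} {j} i≢j with i ≟ j
  ... | yes p = ⊥-elim (i≢j p)
  ... | no _  = refl

  0≤e : ∀ {r} (i j : Fin r) → 0ℤ ≤ e i j
  0≤e i j with does (i ≟ j)
  ... | true  = +≤+ z≤n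
  ... | false = +≤+ z≤n

  e≤ : ∀ {r} {x : Vector r} {i} → (∀ j → 0ℤ ≤ x j) → 1ℤ ≤ x i → e i ≤ᵛ x
  e≤ {x = x} {i} x≥0 xi j with i ≟ j
  ... | yes refl = xi
  ... | no _     = x≥0 j

  sum-e : ∀ {r} (f : Vector r) i → sum (λ j → f j * e i j) ≡ f i
  sum-e f i = trans (sum-single _ i λ j i≢j → trans (cong (f j *_) (e-diff i≢j)) (ℤ.*-zeroʳ (f j)))
                    (trans (cong (f i *_) (e-same i)) (ℤ.*-identityʳ (f i)))

  height : ∀ {r} → Vector r → ℤ
  height x = sum x

  height-⊕e : ∀ {r} (x : Vector r) i → height (x ⊕ e i) ≡ height x + 1ℤ
  height-⊕e x i = trans (∑-distrib-+ x (e i)) (cong (height x +_)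
    (trans (sum-cong-≗ λ j → sym (ℤ.*-identityˡ (e i j))) (sum-e (λ _ → 1ℤ) i)))

  height-⊖e : ∀ {r} (x : Vector r) i → height (x ⊖ e i) ≡ height x - 1ℤ
  height-⊖e x i = a+b≡c⇒a≡c-b (trans (sym (height-⊕e (x ⊖ e i) i)) (sum-cong-≗ λ k → eq (x k) (e i k)))
    where
    eq : ∀ a b → a - b + b ≡ a
    eq = solve-∀

  -- The bilinear form of an integral matrix

  module Form {r : ℕ} (A : Fin r → Fin r → ℤ) where

    infix 8 _∙_
    opaque
      -- For a root `x` this is its Cartan integer at the simple root `i` (see `cartan≡∙`). It is
      -- opaque so that pairings stay atoms in linear arithmetic; `∙-def` and `⟪⟫-def` expose the
      -- sums.
      _∙_ : Vector r → Fin r → ℤ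
      x ∙ i = sum λ k → x k * A k i

      ⟪_,_⟫ : Vector r → Vector r → ℤ
      ⟪ x , y ⟫ = sum λ i → x ∙ i * y i

      ∙-def : ∀ x i → x ∙ i ≡ sum λ k → x k * A k i
      ∙-def x i = refl

      ⟪⟫-def : ∀ x y → ⟪ x , y ⟫ ≡ sum λ i → x ∙ i * y i
      ⟪⟫-def x y = refl

      ∙-cong : ∀ {x y} → x ≗ y → ∀ i → x ∙ i ≡ y ∙ i
      ∙-cong x≗y i = sum-cong-≗ λ k → cong (_* A k i) (x≗y k)

      ∙-⊕ : ∀ x y i → (x ⊕ y) ∙ i ≡ x ∙ i + y ∙ i
      ∙-⊕ x y i = trans (sum-cong-≗ λ k → ℤ.*-distribʳ-+ (A k i) (x k) (y k))
          (∑-distrib-+ (λ k → x k * A k i) (λ k → y k * A k i))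

      e∙ : ∀ j i → e j ∙ i ≡ A j i
      e∙ j i = trans (sum-cong-≗ λ k → ℤ.*-comm (e j k) (A k i)) (sum-e (λ k → A k i) j)

      ⟪⟫-cong : ∀ {x x′ y y′} → x ≗ x′ → y ≗ y′ → ⟪ x , y ⟫ ≡ ⟪ x′ , y′ ⟫
      ⟪⟫-cong p q = sum-cong-≗ λ i → cong₂ _*_ (∙-cong p i) (q i)

      ⟪⟫-⊕ʳ : ∀ x y z → ⟪ x , y ⊕ z ⟫ ≡ ⟪ x , y ⟫ + ⟪ x , z ⟫
      ⟪⟫-⊕ʳ x y z = trans (sum-cong-≗ λ i → ℤ.*-distribˡ-+ (x ∙ i) (y i) (z i))
          (∑-distrib-+ (λ i → x ∙ i * y i) (λ i → x ∙ i * z i))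

      ⟪⟫-e : ∀ x i → ⟪ x , e i ⟫ ≡ x ∙ i
      ⟪⟫-e x i = sum-e (x ∙_) i

      ⟪⟫-comm : (∀ i j → A i j ≡ A j i) → ∀ x y → ⟪ x , y ⟫ ≡ ⟪ y , x ⟫
      ⟪⟫-comm A-sym x y = begin
        sum (λ i → sum (λ k → x k * A k i) * y i)
            ≡⟨ sum-cong-≗ (λ i → *-distribʳ-sum (y i) (λ k → x k * A k i)) ⟩
        sum (λ i → sum (λ k → x k * A k i * y i))   ≡⟨ ∑-comm (λ i k → x k * A k i * y i) ⟩
        sum (λ k → sum (λ i → x k * A k i * y i))
            ≡⟨ sum-cong-≗ (λ k → sum-cong-≗ λ i → trans (swap (x k) (A k i) (y i))
            (cong (λ a → y i * a * x k) (A-sym k i))) ⟩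
        sum (λ k → sum (λ i → y i * A i k * x k))
            ≡⟨ sum-cong-≗ (λ k → *-distribʳ-sum (x k) (λ i → y i * A i k)) ⟨
        sum (λ k → sum (λ i → y i * A i k) * x k)   ∎
        where
        open ≡-Reasoning
        swap : ∀ a b c → a * b * c ≡ c * b * a
        swap = solve-∀

    ∙-⊕e : ∀ x j i → (x ⊕ e j) ∙ i ≡ x ∙ i + A j i
    ∙-⊕e x j i = trans (∙-⊕ x (e j) i) (cong (x ∙ i +_) (e∙ j i))

    ∙-⊖ : ∀ x y i → (x ⊖ y) ∙ i ≡ x ∙ i - y ∙ i
    ∙-⊖ x y i = a+b≡c⇒a≡c-b (trans (sym (∙-⊕ (x ⊖ y) y i)) (∙-cong (λ k → eq (x k) (y k)) i))
      where
      eq : ∀ a b → a - b + b ≡ a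
      eq = solve-∀

    ∙-⊖e : ∀ x j i → (x ⊖ e j) ∙ i ≡ x ∙ i - A j i
    ∙-⊖e x j i = trans (∙-⊖ x (e j) i) (cong (λ z → x ∙ i - z) (e∙ j i))

    ⟪⟫-⊖ʳ : ∀ x y z → ⟪ x , y ⊖ z ⟫ ≡ ⟪ x , y ⟫ - ⟪ x , z ⟫
    ⟪⟫-⊖ʳ x y z = a+b≡c⇒a≡c-b (trans (sym (⟪⟫-⊕ʳ x (y ⊖ z) z))
        (⟪⟫-cong {x} (λ _ → refl) (λ k → eq (y k) (z k))))
      where
      eq : ∀ a b → a - b + b ≡ a
      eq = solve-∀

    module Symmetric (A-sym : ∀ i j → A i j ≡ A j i) where

      ⟪⟫-sym : ∀ x y → ⟪ x , y ⟫ ≡ ⟪ y , x ⟫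
      ⟪⟫-sym = ⟪⟫-comm A-sym

      ⟪⟫-⊕ˡ : ∀ x y z → ⟪ x ⊕ y , z ⟫ ≡ ⟪ x , z ⟫ + ⟪ y , z ⟫
      ⟪⟫-⊕ˡ x y z = trans (⟪⟫-sym (x ⊕ y) z) (trans (⟪⟫-⊕ʳ z x y) (cong₂ _+_ (⟪⟫-sym z x) (⟪⟫-sym z y)))

      ⟪⟫-⊖ˡ : ∀ x y z → ⟪ x ⊖ y , z ⟫ ≡ ⟪ x , z ⟫ - ⟪ y , z ⟫
      ⟪⟫-⊖ˡ x y z = trans (⟪⟫-sym (x ⊖ y) z) (trans (⟪⟫-⊖ʳ z x y) (cong₂ _-_ (⟪⟫-sym z x) (⟪⟫-sym z y)))

      norm-⊕ : ∀ x y → ⟪ x ⊕ y , x ⊕ y ⟫ ≡ ⟪ x , x ⟫ + (⟪ x , y ⟫ + ⟪ x , y ⟫) + ⟪ y , y ⟫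
      norm-⊕ x y = begin
        ⟪ x ⊕ y , x ⊕ y ⟫                                 ≡⟨ ⟪⟫-⊕ʳ (x ⊕ y) x y ⟩
        ⟪ x ⊕ y , x ⟫ + ⟪ x ⊕ y , y ⟫                     ≡⟨ cong₂ _+_ (⟪⟫-⊕ˡ x y x) (⟪⟫-⊕ˡ x y y) ⟩
        ⟪ x , x ⟫ + ⟪ y , x ⟫ + (⟪ x , y ⟫ + ⟪ y , y ⟫)
            ≡⟨ cong (λ z → ⟪ x , x ⟫ + z + (⟪ x , y ⟫ + ⟪ y , y ⟫)) (⟪⟫-sym y x) ⟩
        ⟪ x , x ⟫ + ⟪ x , y ⟫ + (⟪ x , y ⟫ + ⟪ y , y ⟫)   ≡⟨ eq ⟪ x , x ⟫ ⟪ x , y ⟫ ⟪ y , y ⟫ ⟩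
        ⟪ x , x ⟫ + (⟪ x , y ⟫ + ⟪ x , y ⟫) + ⟪ y , y ⟫   ∎
        where
        open ≡-Reasoning
        eq : ∀ a b c → a + b + (b + c) ≡ a + (b + b) + c
        eq = solve-∀

      norm-⊖ : ∀ x y → ⟪ x ⊖ y , x ⊖ y ⟫ ≡ ⟪ x , x ⟫ - (⟪ x , y ⟫ + ⟪ x , y ⟫) + ⟪ y , y ⟫
      norm-⊖ x y = begin
        ⟪ x ⊖ y , x ⊖ y ⟫                                 ≡⟨ ⟪⟫-⊖ʳ (x ⊖ y) x y ⟩
        ⟪ x ⊖ y , x ⟫ - ⟪ x ⊖ y , y ⟫                     ≡⟨ cong₂ _-_ (⟪⟫-⊖ˡ x y x) (⟪⟫-⊖ˡ x y y) ⟩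
        ⟪ x , x ⟫ - ⟪ y , x ⟫ - (⟪ x , y ⟫ - ⟪ y , y ⟫)
            ≡⟨ cong (λ z → ⟪ x , x ⟫ - z - (⟪ x , y ⟫ - ⟪ y , y ⟫)) (⟪⟫-sym y x) ⟩
        ⟪ x , x ⟫ - ⟪ x , y ⟫ - (⟪ x , y ⟫ - ⟪ y , y ⟫)   ≡⟨ eq ⟪ x , x ⟫ ⟪ x , y ⟫ ⟪ y , y ⟫ ⟩
        ⟪ x , x ⟫ - (⟪ x , y ⟫ + ⟪ x , y ⟫) + ⟪ y , y ⟫   ∎
        where
        open ≡-Reasoning
        eq : ∀ a b c → a - b - (b - c) ≡ a - (b + b) + c
        eq = solve-∀

-- Positive roots of norm 2 for a positive definite integral form

module PositiveRootSystems where

  open IntegralVectors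
  open import Data.Integer.Base using (ℤ; -[1+_]; 0ℤ; 1ℤ; -1ℤ; _+_; _*_; -_; _-_; _≤_; +≤+; -≤+) renaming (+_ to pos)
  open import Relation.Binary.PropositionalEquality

  2ℤ -2ℤ : ℤ
  2ℤ = pos 2
  -2ℤ = -[1+ 1 ]

  nonneg-sum-zero : ∀ {a b} → 0ℤ ≤ a → 0ℤ ≤ b → a + b ≡ 0ℤ → a ≡ 0ℤ
  nonneg-sum-zero {a} {b} p q s = ℤ.≤-antisym (lin₂ q (ℤ.≤-reflexive s) (eq a b)) p
    where
    eq : ∀ a b → 0ℤ - a ≡ (b - 0ℤ) + (0ℤ - (a + b))
    eq = solve-∀

  1≤product : ∀ {a b} → 0ℤ ≤ b → 1ℤ ≤ a * b → 1ℤ ≤ a × 1ℤ ≤ b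
  1≤product {a} {pos zero} _ p = ⊥-elim (1≰0 (subst (1ℤ ≤_) (ℤ.*-zeroʳ a) p))
  1≤product {a} {pos (suc n)} _ p with ≤∨1+≤ a 0ℤ
  ... | inj₁ a≤0 = ⊥-elim (1≰0 (ℤ.≤-trans p (ℤ.*-monoʳ-≤-nonNeg (pos (suc n)) a≤0)))
  ... | inj₂ 1≤a = 1≤a , +≤+ (s≤s z≤n)

  -- What the combinatorial part needs of a simply laced root system. Of the reflections it keeps
  -- the simple ones at pairing -1 and 1, where they add or subtract the simple root.
  record PositiveRoots (r : ℕ) : Set₁ where
    field
      A      : Fin r → Fin r → ℤ
      A-sym  : ∀ i j → A i j ≡ A j i
      A-diag : ∀ i → A i i ≡ 2ℤ
      A-off  : ∀ {i j} → i ≢ j → A i j ≡ 0ℤ ⊎ A i j ≡ -1ℤ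
    open Form A public
    open Symmetric A-sym public
    field
      posdef      : ∀ x → ⟪ x , x ⟫ ≤ 0ℤ → ∀ i → x i ≡ 0ℤ
      Root        : Vector r → Set
      root-resp   : ∀ {x y} → x ≗ y → Root x → Root y
      root-nonneg : ∀ {x} → Root x → ∀ i → 0ℤ ≤ x i
      root-norm   : ∀ {x} → Root x → ⟪ x , x ⟫ ≡ 2ℤ
      root-simple : ∀ i → Root (e i)
      root-up     : ∀ {x i} → Root x → x ∙ i ≡ -1ℤ → Root (x ⊕ e i)
      root-down   : ∀ {x i} → Root x → x ∙ i ≡ 1ℤ → Root (x ⊖ e i)

    Adjacent : Fin r → Fin r → Set
    Adjacent i j = A i j ≡ -1ℤ

    adjacent-sym : ∀ {i j} → Adjacent i j → Adjacent j i
    adjacent-sym {i} {j} = trans (A-sym j i)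

    adjacent⇒≢ : ∀ {i j} → Adjacent i j → i ≢ j
    adjacent⇒≢ {i} adj refl = case trans (sym (A-diag i)) adj of λ ()

    A≤0 : ∀ {i j} → i ≢ j → A i j ≤ 0ℤ
    A≤0 i≢j with A-off i≢j
    ... | inj₁ p = ℤ.≤-reflexive p
    ... | inj₂ p = subst (_≤ 0ℤ) (sym p) -≤+

    root-nonzero : ∀ {x} → Root x → ¬ (∀ i → x i ≡ 0ℤ)
    root-nonzero {x} ρ x≡0 = case trans (sym (root-norm ρ))
        (trans (⟪⟫-def x x) (sum-zero λ i → trans (cong (x ∙ i *_) (x≡0 i)) (ℤ.*-zeroʳ (x ∙ i)))) of λ ()

    -- A product of -2 or less would make `x ⊕ y` a vector of norm at most 0, hence zero, but two
    -- nonzero nonnegative vectors cannot cancel. The upper bound below uses `x ⊖ y` instead, which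
    -- may indeed vanish.
    root-bound : ∀ {x y} → Root x → Root y → -1ℤ ≤ ⟪ x , y ⟫
    root-bound {x} {y} ρx ρy with ≤∨1+≤ -1ℤ ⟪ x , y ⟫
    ... | inj₁ p = p
    ... | inj₂ p = ⊥-elim (root-nonzero ρx λ i → nonneg-sum-zero (root-nonneg ρx i) (root-nonneg ρy i)
        (posdef (x ⊕ y) N≤0 i))
      where
      eq : ∀ b → 0ℤ - (2ℤ + (b + b) + 2ℤ) ≡ (-1ℤ - (1ℤ + b)) + (-1ℤ - (1ℤ + b))
      eq = solve-∀
      N≤0 : ⟪ x ⊕ y , x ⊕ y ⟫ ≤ 0ℤ
      N≤0 = subst (_≤ 0ℤ) (sym (trans (norm-⊕ x y) (cong₂ (λ a c → a + (⟪ x , y ⟫ + ⟪ x , y ⟫) + c)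
          (root-norm ρx) (root-norm ρy))))
        (lin₂ p p (eq ⟪ x , y ⟫))

    root-upper : ∀ {x y} → Root x → Root y → ⟪ x , y ⟫ ≤ 1ℤ ⊎ x ≗ y
    root-upper {x} {y} ρx ρy with ≤∨1+≤ ⟪ x , y ⟫ 1ℤ
    ... | inj₁ p = inj₁ p
    ... | inj₂ p = inj₂ λ i → ℤ.i-j≡0⇒i≡j (x i) (y i) (posdef (x ⊖ y) N≤0 i)
      where
      eq : ∀ b → 0ℤ - (2ℤ - (b + b) + 2ℤ) ≡ (b - (1ℤ + 1ℤ)) + (b - (1ℤ + 1ℤ))
      eq = solve-∀
      N≤0 : ⟪ x ⊖ y , x ⊖ y ⟫ ≤ 0ℤ
      N≤0 = subst (_≤ 0ℤ) (sym (trans (norm-⊖ x y) (cong₂ (λ a c → a - (⟪ x , y ⟫ + ⟪ x , y ⟫) + c)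
          (root-norm ρx) (root-norm ρy))))
        (lin₂ p p (eq ⟪ x , y ⟫))

    ∙-bound : ∀ {x} → Root x → ∀ i → -1ℤ ≤ x ∙ i
    ∙-bound {x} ρ i = subst (-1ℤ ≤_) (⟪⟫-e x i) (root-bound ρ (root-simple i))

    ∙-upper : ∀ {x} → Root x → ∀ i → x ∙ i ≤ 1ℤ ⊎ x ≗ e i
    ∙-upper {x} ρ i with root-upper ρ (root-simple i)
    ... | inj₁ p = inj₁ (subst (_≤ 1ℤ) (⟪⟫-e x i) p)
    ... | inj₂ p = inj₂ p

    ∙≤-1⇒≡ : ∀ {x i} → Root x → x ∙ i ≤ -1ℤ → x ∙ i ≡ -1ℤ
    ∙≤-1⇒≡ {i = i} ρ p = ℤ.≤-antisym p (∙-bound ρ i)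

    raise : ∀ {x i} → Root x → x ∙ i ≤ -1ℤ → Root (x ⊕ e i)
    raise ρ p = root-up ρ (∙≤-1⇒≡ ρ p)

    lower : ∀ {x i} → Root x → 1ℤ ≤ x ∙ i → Root (x ⊖ e i) ⊎ x ≗ e i
    lower {i = i} ρ p with ∙-upper ρ i
    ... | inj₁ q = inj₁ (root-down ρ (ℤ.≤-antisym q p))
    ... | inj₂ q = inj₂ q

    root-height : ∀ {x} → Root x → 1ℤ ≤ height x
    root-height {x} ρ with ≤∨1+≤ (height x) 0ℤ
    ... | inj₁ p = ⊥-elim (root-nonzero ρ (sum≤0⇒zero (root-nonneg ρ) p))
    ... | inj₂ p = p

    -- The norm of `γ ⊖ β` is a sum of terms `(γ ⊖ β) ∙ i * (γ ⊖ β) i`. If it is positive, some `i`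
    -- has `β i < γ i` and `β ∙ i < γ ∙ i`. Then either `β` pairs to -1 with `i` and can be raised,
    -- or `γ` pairs positively with `i` and can be lowered towards `β`, which is an induction on the
    -- height of `γ`.
    rise : ∀ {β γ} → Root β → Root γ → β ≤ᵛ γ →
           β ≗ γ ⊎ ∃[ s ] Root (β ⊕ e s) × β ⊕ e s ≤ᵛ γ
    rise {β} {γ} ρβ ρ = go _ ρ (ℤ.≤-reflexive (sym (ℤ.0≤i⇒+∣i∣≡i (sum-nonneg (root-nonneg ρ)))))
      where
      go : ∀ n {γ} → Root γ → height γ ≤ pos n → β ≤ᵛ γ →
           β ≗ γ ⊎ ∃[ s ] Root (β ⊕ e s) × β ⊕ e s ≤ᵛ γ
      go zero    {γ} ργ ht le = ⊥-elim (1≰0 (ℤ.≤-trans (root-height ργ) ht))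
      go (suc n) {γ} ργ ht le with ≤∨1+≤ ⟪ γ ⊖ β , γ ⊖ β ⟫ 0ℤ
      ... | inj₁ N≤0 = inj₁ λ i → sym (ℤ.i-j≡0⇒i≡j (γ i) (β i) (posdef (γ ⊖ β) N≤0 i))
      ... | inj₂ N>0 with ∃-positive-term _ (subst (1ℤ ≤_) (⟪⟫-def (γ ⊖ β) (γ ⊖ β)) N>0)
      ... | i , term with 1≤product (ℤ.i≤j⇒0≤j-i (le i)) term
      ... | slope , gap with ≤∨1+≤ (β ∙ i) -1ℤ
      ... | inj₁ p = inj₂ (i , raise ρβ p , βi≤)
        where
        eq : ∀ g b → g - (b + 1ℤ) ≡ (g - b) - 1ℤ
        eq = solve-∀
        βi≤ : β ⊕ e i ≤ᵛ γ
        βi≤ j with i ≟ j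
        ... | yes refl = lin₁ gap (eq (γ i) (β i))
        ... | no _     = subst (_≤ γ j) (sym (ℤ.+-identityʳ (β j))) (le j)
      ... | inj₂ p with lower ργ (lin₂ p slope′ (eq (γ ∙ i) (β ∙ i)))
        where
        slope′ : 1ℤ ≤ γ ∙ i - β ∙ i
        slope′ = subst (1ℤ ≤_) (∙-⊖ γ β i) slope
        eq : ∀ g b → g - 1ℤ ≡ (b - (1ℤ + -1ℤ)) + ((g - b) - 1ℤ)
        eq = solve-∀
      ... | inj₂ γ≗ei = ⊥-elim (root-nonzero ρβ β≡0)
        where
        eq : ∀ g b → 0ℤ - b ≡ (1ℤ - g) + ((g - b) - 1ℤ)
        eq = solve-∀
        β≤0 : ∀ j → β j ≤ 0ℤ
        β≤0 j with i ≟ j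
        ... | yes refl = lin₂ (ℤ.≤-reflexive (trans (γ≗ei i) (e-same i))) gap (eq (γ i) (β i))
        ... | no i≢j   = ℤ.≤-trans (le j) (ℤ.≤-reflexive (trans (γ≗ei j) (e-diff i≢j)))
        β≡0 : ∀ j → β j ≡ 0ℤ
        β≡0 j = ℤ.≤-antisym (β≤0 j) (root-nonneg ρβ j)
      ... | inj₁ ργ′ with go n ργ′ ht′ le′
        where
        eq : ∀ h n → n - (h - 1ℤ) ≡ (1ℤ + n) - h
        eq = solve-∀
        ht′ : height (γ ⊖ e i) ≤ pos n
        ht′ = subst (_≤ pos n) (sym (height-⊖e γ i)) (lin₁ ht (eq (height γ) (pos n)))
        eq′ : ∀ g b → g - 1ℤ - b ≡ (g - b) - 1ℤ
        eq′ = solve-∀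
        le′ : β ≤ᵛ γ ⊖ e i
        le′ j with i ≟ j
        ... | yes refl = lin₁ gap (eq′ (γ i) (β i))
        ... | no _     = subst (β j ≤_) (sym (ℤ.+-identityʳ (γ j))) (le j)
      ... | inj₁ β≗ = inj₂ (i , root-resp (sym ∘ βi≗γ) ργ , ℤ.≤-reflexive ∘ βi≗γ)
        where
        eq : ∀ a b → a - b + b ≡ a
        eq = solve-∀
        βi≗γ : β ⊕ e i ≗ γ
        βi≗γ j = trans (cong (_+ e i j) (β≗ j)) (eq (γ j) (e i j))
      ... | inj₂ (s , ρs , s≤) = inj₂ (s , ρs , λ j → lin₂ (s≤ j) (0≤e i j) (eq (γ j) (e i j) ((β ⊕ e s) j)))
        where
        eq : ∀ g a b → g - b ≡ (g - a - b) + (a - 0ℤ)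
        eq = solve-∀

    ∙≤0 : ∀ {x i} → (∀ k → 0ℤ ≤ x k) → x i ≡ 0ℤ → x ∙ i ≤ 0ℤ
    ∙≤0 {x} {i} x≥0 xi≡0 with ≤∨1+≤ (x ∙ i) 0ℤ
    ... | inj₁ p = p
    ... | inj₂ p with ∃-positive-term _ (subst (1ℤ ≤_) (∙-def x i) p)
    ... | k , t with 1≤product (x≥0 k) (subst (1ℤ ≤_) (ℤ.*-comm (x k) (A k i)) t)
    ... | 1≤A , 1≤x with k ≟ i
    ... | yes refl = ⊥-elim (1≤⇒≢0 1≤x xi≡0)
    ... | no k≢i   = ⊥-elim (1≰0 (ℤ.≤-trans 1≤A (A≤0 k≢i)))

    ⊖e-nonneg : ∀ {x : Vector r} {j} → (∀ k → 0ℤ ≤ x k) → 1ℤ ≤ x j → ∀ k → 0ℤ ≤ (x ⊖ e j) k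
    ⊖e-nonneg x≥0 xj k = ℤ.i≤j⇒0≤j-i (e≤ x≥0 xj k)

    ⊖e-diff : ∀ (x : Vector r) {j k} → j ≢ k → (x ⊖ e j) k ≡ x k
    ⊖e-diff x {j} {k} j≢k = trans (cong (λ z → x k - z) (e-diff j≢k)) (ℤ.+-identityʳ (x k))

    ⊖e-same : ∀ (x : Vector r) {j} → (x ⊖ e j) j ≡ x j - 1ℤ
    ⊖e-same x {j} = cong (λ z → x j - z) (e-same j)

    ⊕e-diff : ∀ (x : Vector r) {j k} → j ≢ k → (x ⊕ e j) k ≡ x k
    ⊕e-diff x {j} {k} j≢k = trans (cong (x k +_) (e-diff j≢k)) (ℤ.+-identityʳ (x k))

    ⊕e-same : ∀ (x : Vector r) {j} → (x ⊕ e j) j ≡ x j + 1ℤ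
    ⊕e-same x {j} = cong (x j +_) (e-same j)

    adjacent⇒∙≤-1 : ∀ {x i j} → (∀ k → 0ℤ ≤ x k) → x i ≡ 0ℤ → 1ℤ ≤ x j → Adjacent j i → x ∙ i ≤ -1ℤ
    adjacent⇒∙≤-1 {x} {i} {j} x≥0 xi xj adj =
      lin₁ (subst (_≤ 0ℤ) (trans (∙-⊖e x j i) (cong (λ z → x ∙ i - z) adj))
             (∙≤0 (⊖e-nonneg x≥0 xj) (trans (⊖e-diff x (adjacent⇒≢ adj)) xi)))
           (eq (x ∙ i))
      where
      eq : ∀ a → -1ℤ - a ≡ 0ℤ - (a - -1ℤ)
      eq = solve-∀

    two-adjacent⇒∙≤-2 : ∀ {x i j j′} → (∀ k → 0ℤ ≤ x k) → x i ≡ 0ℤ → j ≢ j′ →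
                        1ℤ ≤ x j → Adjacent j i → 1ℤ ≤ x j′ → Adjacent j′ i → x ∙ i ≤ -2ℤ
    two-adjacent⇒∙≤-2 {x} {i} {j} {j′} x≥0 xi j≢j′ xj adj xj′ adj′ =
      lin₁ (subst (_≤ -1ℤ) (trans (∙-⊖e x j i) (cong (λ z → x ∙ i - z) adj))
             (adjacent⇒∙≤-1 (⊖e-nonneg x≥0 xj) (trans (⊖e-diff x (adjacent⇒≢ adj)) xi)
                 (subst (1ℤ ≤_) (sym (⊖e-diff x j≢j′)) xj′) adj′))
           (eq (x ∙ i))
      where
      eq : ∀ a → -2ℤ - a ≡ -1ℤ - (a - -1ℤ)
      eq = solve-∀

    -- `x ∙ s` is `2 * x s` minus the coefficients of `x` at the neighbours of `s`, so a value below
    -- `2 * x s` betrays a neighbour in the support.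
    neighbour : ∀ {x s} → (∀ k → 0ℤ ≤ x k) → 1ℤ + x ∙ s ≤ x s + x s →
                ∃[ a ] a ≢ s × 1ℤ ≤ x a × Adjacent a s
    neighbour {x} {s} x≥0 h = found (∃-negative-term t Σt≤-1)
      where
      t : Fin r → ℤ
      -- The diagonal contribution is subtracted at `s`, so that a negative term must come from a
      -- neighbour.
      t k = x k * A k s + - (x s + x s) * e s k
      Σt : sum t ≡ x ∙ s + - (x s + x s)
      Σt = trans (∑-distrib-+ (λ k → x k * A k s) (λ k → - (x s + x s) * e s k))
                 (cong₂ _+_ (sym (∙-def x s)) (sum-e (λ _ → - (x s + x s)) s))
      eq : ∀ a b → -1ℤ - (a + - (b + b)) ≡ (b + b) - (1ℤ + a)
      eq = solve-∀
      Σt≤-1 : sum t ≤ -1ℤ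
      Σt≤-1 = subst (_≤ -1ℤ) (sym Σt) (lin₁ h (eq (x ∙ s) (x s)))
      found : ∃[ k ] t k ≤ -1ℤ → ∃[ a ] a ≢ s × 1ℤ ≤ x a × Adjacent a s
      found (k , tk) with k ≟ s
      ... | yes refl = case subst (_≤ -1ℤ)
          (trans (cong₂ (λ a b → x k * a + - (x k + x k) * b) (A-diag k) (e-same k)) (eq′ (x k))) tk of λ ()
        where
        eq′ : ∀ a → a * 2ℤ + - (a + a) * 1ℤ ≡ 0ℤ
        eq′ = solve-∀
      ... | no k≢s with A-off k≢s
      ... | inj₁ z = case subst (_≤ -1ℤ)
          (trans (cong₂ (λ a b → x k * a + - (x s + x s) * b) z (e-diff (k≢s ∘ sym))) (eq′ (x k) (x s))) tk of
          λ ()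
        where
        eq′ : ∀ a b → a * 0ℤ + - (b + b) * 0ℤ ≡ 0ℤ
        eq′ = solve-∀
      ... | inj₂ adj = k , k≢s , lin₁
          (subst (_≤ -1ℤ) (trans (cong₂ (λ a b → x k * a + - (x s + x s) * b) adj (e-diff (k≢s ∘ sym)))
          (eq′ (x k) (x s))) tk) (eq″ (x k)) , adj
        where
        eq′ : ∀ a b → a * -1ℤ + - (b + b) * 0ℤ ≡ - a
        eq′ = solve-∀
        eq″ : ∀ a → a - 1ℤ ≡ -1ℤ - - a
        eq″ = solve-∀

    -- The roots π, s₁, …, s₄ would span an affine diagram of type D̃₄, whose null
    -- vector is 2π + s₁ + s₂ + s₃ + s₄.
    no-four-neighbours : ∀ {π s₁ s₂ s₃ s₄} → Root π →
      s₁ ≢ s₂ → s₁ ≢ s₃ → s₁ ≢ s₄ → s₂ ≢ s₃ → s₂ ≢ s₄ → s₃ ≢ s₄ →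
      π ∙ s₁ ≤ -1ℤ → π ∙ s₂ ≤ -1ℤ → π ∙ s₃ ≤ -1ℤ → π ∙ s₄ ≤ -1ℤ → ⊥
    no-four-neighbours {π} {s₁} {s₂} {s₃} {s₄} ρ d₁₂ d₁₃ d₁₄ d₂₃ d₂₄ d₃₄ p₁ p₂ p₃ p₄ =
      root-nonzero ρ λ i → nonneg-sum-zero (π≥0 i) (π≥0 i)
        (cancel s₁ (⊕-nonneg π≥0 π≥0) (cancel s₂ y₁≥0 (cancel s₃ y₂≥0 (cancel s₄ y₃≥0 (posdef y₄ N₄)))) i)
      where
      π≥0 = root-nonneg ρ
      y₀ y₁ y₂ y₃ y₄ : Vector r
      y₀ = π ⊕ π
      y₁ = y₀ ⊕ e s₁
      y₂ = y₁ ⊕ e s₂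
      y₃ = y₂ ⊕ e s₃
      y₄ = y₃ ⊕ e s₄
      ⊕-nonneg : ∀ {x y : Vector r} → (∀ k → 0ℤ ≤ x k) → (∀ k → 0ℤ ≤ y k) → ∀ k → 0ℤ ≤ (x ⊕ y) k
      ⊕-nonneg p q k = ℤ.+-mono-≤ (p k) (q k)
      y₁≥0 = ⊕-nonneg (⊕-nonneg π≥0 π≥0) (0≤e s₁)
      y₂≥0 = ⊕-nonneg y₁≥0 (0≤e s₂)
      y₃≥0 = ⊕-nonneg y₂≥0 (0≤e s₃)
      cancel : ∀ {x : Vector r} s → (∀ k → 0ℤ ≤ x k) → (∀ k → (x ⊕ e s) k ≡ 0ℤ) → ∀ k → x k ≡ 0ℤ
      cancel s x≥0 h k = nonneg-sum-zero (x≥0 k) (0≤e s k) (h k)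
      double : ∀ {s} → π ∙ s ≤ -1ℤ → y₀ ∙ s ≤ -2ℤ
      double {s} p = subst (_≤ -2ℤ) (sym (∙-⊕ π π s)) (ℤ.+-mono-≤ p p)
      extend : ∀ {y s t} → s ≢ t → y ∙ t ≤ -2ℤ → (y ⊕ e s) ∙ t ≤ -2ℤ
      extend {y} {s} {t} s≢t p = subst (_≤ -2ℤ) (sym (∙-⊕e y s t)) (ℤ.+-mono-≤ p (A≤0 s≢t))
      shrink : ∀ {y s n} → ⟪ y , y ⟫ ≤ n → y ∙ s ≤ -2ℤ → ⟪ y ⊕ e s , y ⊕ e s ⟫ ≤ n - 2ℤ
      shrink {y} {s} {n} N p = subst (_≤ n - 2ℤ)
        (sym (trans (norm-⊕ y (e s)) (cong₂ (λ a b → ⟪ y , y ⟫ + (a + a) + b) (⟪⟫-e y s)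
            (root-norm (root-simple s)))))
        (lin₃ N p p (eq n ⟪ y , y ⟫ (y ∙ s)))
        where
        eq : ∀ n a b → n - 2ℤ - (a + (b + b) + 2ℤ) ≡ (n - a) + (-2ℤ - b) + (-2ℤ - b)
        eq = solve-∀
      -- `2π` has norm 8, and each of the four simple roots pairs to at most -2 with the sum before
      -- it, so adding it lowers the norm by at least 2.
      N₀ : ⟪ y₀ , y₀ ⟫ ≤ pos 8
      N₀ = ℤ.≤-reflexive (trans (norm-⊕ π π) (cong (λ a → a + (a + a) + a) (root-norm ρ)))
      N₄ : ⟪ y₄ , y₄ ⟫ ≤ 0ℤ
      N₄ = shrink (shrink (shrink (shrink N₀ (double p₁)) (extend d₁₂ (double p₂)))
                    (extend {y₁} d₂₃ (extend d₁₃ (double p₃))))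
             (extend {y₂} d₃₄ (extend {y₁} d₂₄ (extend d₁₄ (double p₄))))

-- Ideals of positive roots and their stars

module RootIdeals where

  open IntegralVectors
  open PositiveRootSystems
  open import Data.Integer.Base using (ℤ; 0ℤ; 1ℤ; -1ℤ; _+_; _*_; -_; _-_; _≤_; +≤+; -≤+; -≤-) renaming (+_ to pos)
  open import Relation.Binary.PropositionalEquality

  height-≤ : ∀ {r} {x : Vector r} → (∀ i → x i ≤ 1ℤ) → height x ≤ pos r
  height-≤ {zero}  h = ℤ.≤-refl
  height-≤ {suc r} h = ℤ.+-mono-≤ (h zero) (height-≤ (h ∘ suc))

  0<⊎≡0 : ∀ {a} → 0ℤ ≤ a → 1ℤ ≤ a ⊎ a ≡ 0ℤ
  0<⊎≡0 {pos zero}    _ = inj₂ refl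
  0<⊎≡0 {pos (suc n)} _ = inj₁ (+≤+ (s≤s z≤n))

  e≤1 : ∀ {r} (i j : Fin r) → e i j ≤ 1ℤ
  e≤1 i j with i ≟ j
  ... | yes _ = ℤ.≤-refl
  ... | no _  = +≤+ z≤n

  ⊕e-≤ : ∀ {r} {x y : Vector r} {i} → y ≤ᵛ x → y i ≡ 0ℤ → 1ℤ ≤ x i → y ⊕ e i ≤ᵛ x
  ⊕e-≤ {x = x} {y} {i} y≤x yi xi j with i ≟ j
  ... | yes refl = subst (_≤ x i) (cong (_+ 1ℤ) (sym yi)) xi
  ... | no _     = subst (_≤ x j) (sym (ℤ.+-identityʳ (y j))) (y≤x j)

  ≤-⊕e : ∀ {r} (x : Vector r) i → x ≤ᵛ x ⊕ e i
  ≤-⊕e x i j = subst (_≤ x j + e i j) (ℤ.+-identityʳ (x j)) (ℤ.+-mono-≤ (ℤ.≤-refl {x j}) (0≤e i j))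

  ⊖e-≤ : ∀ {r} (x : Vector r) i → x ⊖ e i ≤ᵛ x
  ⊖e-≤ x i j = lin₁ (0≤e i j) (eq (x j) (e i j))
    where
    eq : ∀ a b → a - (a - b) ≡ b - 0ℤ
    eq = solve-∀

  ⊖e⊕e : ∀ {r} (x : Vector r) i → x ⊖ e i ⊕ e i ≗ x
  ⊖e⊕e x i j = eq (x j) (e i j)
    where
    eq : ∀ a b → a - b + b ≡ a
    eq = solve-∀

  module Ideal {r : ℕ} (R : PositiveRoots r)
    (P : Vector r → Set)
    (P-resp : ∀ {x y} → x ≗ y → P x → P y)
    (P? : ∀ x → Dec (P x))
    (P-root : ∀ {x} → P x → PositiveRoots.Root R x)
    (P-ideal : ∀ {x y} → P x → PositiveRoots.Root R y → y ≤ᵛ x → P y)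
    where
    open PositiveRoots R

    triple : Fin r → Fin r → Fin r → Vector r
    triple j a b = e j ⊕ e a ⊕ e b

    -- A star with its centre `j` made explicit. `IsStar` records no adjacencies; `IsStar⇒star`
    -- recovers them.
    record Star : Set where
      field
        {j a b c} : Fin r
        a≢b : a ≢ b
        a≢c : a ≢ c
        b≢c : b ≢ c
        aj  : Adjacent a j
        bj  : Adjacent b j
        cj  : Adjacent c j
        jab : P (triple j a b)
        jac : P (triple j a c)
        jbc : P (triple j b c)

    P-nonneg : ∀ {x} → P x → ∀ i → 0ℤ ≤ x i
    P-nonneg = root-nonneg ∘ P-root

    P-simple : ∀ {x i} → P x → 1ℤ ≤ x i → P (e i)
    P-simple {i = i} Px xi = P-ideal Px (root-simple i) (e≤ (P-nonneg Px) xi)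

    P-cover : ∀ {x} s → P x → P (x ⊕ e s) → P (e s)
    P-cover {x} s Px Pxs = P-simple Pxs
        (subst (1ℤ ≤_) (sym (⊕e-same x)) (ℤ.+-mono-≤ (P-nonneg Px s) (ℤ.≤-refl {1ℤ})))

    triple-root : ∀ {j a b} → a ≢ b → Adjacent a j → Adjacent b j → Root (triple j a b)
    triple-root {j} {a} {b} a≢b aj bj = raise ja (subst (_≤ -1ℤ) (sym (∙-⊕e (e j) a b))
        (subst (λ z → z + A a b ≤ -1ℤ) (sym (trans (e∙ j b) (adjacent-sym bj)))
            (ℤ.+-mono-≤ (ℤ.≤-refl { -1ℤ}) (A≤0 a≢b))))
      where
      ja : Root (e j ⊕ e a)
      ja = root-up (root-simple j) (trans (e∙ j a) (adjacent-sym aj))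

    triple-≤ : ∀ {x j a b} → (∀ k → 0ℤ ≤ x k) → a ≢ b → Adjacent a j → Adjacent b j →
               1ℤ ≤ x j → 1ℤ ≤ x a → 1ℤ ≤ x b → triple j a b ≤ᵛ x
    triple-≤ {x} {j} {a} {b} x≥0 a≢b aj bj xj xa xb =
      ⊕e-≤ (⊕e-≤ (e≤ x≥0 xj) (e-diff (adjacent⇒≢ aj ∘ sym)) xa)
           (trans (⊕e-diff (e j) a≢b) (e-diff (adjacent⇒≢ bj ∘ sym))) xb

    P-triple : ∀ {x j a b} → P x → a ≢ b → Adjacent a j → Adjacent b j →
               1ℤ ≤ x j → 1ℤ ≤ x a → 1ℤ ≤ x b → P (triple j a b)
    P-triple Px a≢b aj bj xj xa xb =
      P-ideal Px (triple-root a≢b aj bj) (triple-≤ (P-nonneg Px) a≢b aj bj xj xa xb)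

    -- Both roots have norm 2, so `2 = 2 + 2 (x ∙ s) + 2`.
    cover⇒∙ : ∀ {x s} → Root x → Root (x ⊕ e s) → x ∙ s ≡ -1ℤ
    cover⇒∙ {x} {s} ρ ρ′ = ℤ.≤-antisym below (∙-bound ρ s)
      where
      norm : 2ℤ ≡ 2ℤ + (x ∙ s + x ∙ s) + 2ℤ
      norm = trans (sym (root-norm ρ′)) (trans (norm-⊕ x (e s))
        (trans (cong₂ (λ a b → a + (⟪ x , e s ⟫ + ⟪ x , e s ⟫) + b) (root-norm ρ) (root-norm (root-simple s)))
               (cong (λ z → 2ℤ + (z + z) + 2ℤ) (⟪⟫-e x s))))
      below : x ∙ s ≤ -1ℤ
      below with ≤∨1+≤ (x ∙ s) -1ℤ
      ... | inj₁ p = p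
      ... | inj₂ p = case lin₃ {2ℤ} {0ℤ} p p (ℤ.≤-reflexive (sym norm)) (eq (x ∙ s)) of λ { (+≤+ ()) }
        where
        eq : ∀ b → 0ℤ - 2ℤ ≡ (b - (1ℤ + -1ℤ)) + (b - (1ℤ + -1ℤ)) + (2ℤ - (2ℤ + (b + b) + 2ℤ))
        eq = solve-∀

    private
      neighbour′ : ∀ {x s} → (∀ k → 0ℤ ≤ x k) → 1ℤ ≤ x s → x ∙ s ≤ 1ℤ → ∃[ a ] a ≢ s × 1ℤ ≤ x a × Adjacent a s
      neighbour′ {x} {s} x≥0 xs x∙s = neighbour x≥0 (lin₃ x∙s xs xs (eq (x ∙ s) (x s)))
        where
        eq : ∀ a b → (b + b) - (1ℤ + a) ≡ (1ℤ - a) + (b - 1ℤ) + (b - 1ℤ)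
        eq = solve-∀

      remove : ∀ {x s a n} → Adjacent a s → x ∙ s ≤ n → (x ⊖ e a) ∙ s ≤ n + 1ℤ
      remove {x} {s} {a} {n} as p = subst (_≤ n + 1ℤ) (sym (trans (∙-⊖e x a s) (cong (λ z → x ∙ s - z) as)))
                                          (ℤ.+-mono-≤ p ℤ.≤-refl)

      ¬1≤⊖e : ∀ {x : Vector r} {a} → x a ≤ 1ℤ → ¬ (1ℤ ≤ (x ⊖ e a) a)
      ¬1≤⊖e {x} {a} p q = 1≰0 (lin₂ p (subst (1ℤ ≤_) (⊖e-same x) q) (eq (x a)))
        where
        eq : ∀ a → 0ℤ - 1ℤ ≡ (1ℤ - a) + (a - 1ℤ - 1ℤ)
        eq = solve-∀

      1≤⊖e⇒1≤ : ∀ (x : Vector r) a {b} → 1ℤ ≤ (x ⊖ e a) b → 1ℤ ≤ x b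
      1≤⊖e⇒1≤ x a {b} p = ℤ.≤-trans p (⊖e-≤ x a b)

    -- s has three neighbours in the support of x, found by removing them one by one.
    star-at : ∀ {x s} → P x → (∀ i → x i ≤ 1ℤ) → 1ℤ ≤ x s → x ∙ s ≤ -1ℤ → Star
    star-at {x} {s} Px x≤1 xs x∙s = first (neighbour′ x≥0 xs (ℤ.≤-trans x∙s -≤+))
      where
      Neighbour : Vector r → Set
      Neighbour y = ∃[ a ] a ≢ s × 1ℤ ≤ y a × Adjacent a s
      x≥0 = P-nonneg Px
      third : ∀ a b → a ≢ s → 1ℤ ≤ x a → Adjacent a s → b ≢ s → 1ℤ ≤ (x ⊖ e a) b → Adjacent b s →
              Neighbour (x ⊖ e a ⊖ e b) → Star
      third a b a≢s xa as b≢s x′b bs (c , c≢s , x″c , cs) = record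
        { a≢b = a≢b ; a≢c = a≢c ; b≢c = b≢c ; aj = as ; bj = bs ; cj = cs
        ; jab = P-triple Px a≢b as bs xs xa xb
        ; jac = P-triple Px a≢c as cs xs xa xc
        ; jbc = P-triple Px b≢c bs cs xs xb xc }
        where
        x′c = 1≤⊖e⇒1≤ (x ⊖ e a) b x″c
        xb = 1≤⊖e⇒1≤ x a x′b
        xc = 1≤⊖e⇒1≤ x a x′c
        a≢b : a ≢ b
        a≢b refl = ¬1≤⊖e {x} (x≤1 a) x′b
        a≢c : a ≢ c
        a≢c refl = ¬1≤⊖e {x} (x≤1 a) x′c
        b≢c : b ≢ c
        b≢c refl = ¬1≤⊖e {x ⊖ e a} (ℤ.≤-trans (⊖e-≤ x a b) (x≤1 b)) x″c
      second : ∀ a → a ≢ s → 1ℤ ≤ x a → Adjacent a s → Neighbour (x ⊖ e a) → Star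
      second a a≢s xa as (b , b≢s , x′b , bs) = third a b a≢s xa as b≢s x′b bs
        (neighbour′ (⊖e-nonneg (⊖e-nonneg x≥0 xa) x′b)
          (subst (1ℤ ≤_) (sym (trans (⊖e-diff (x ⊖ e a) b≢s) (⊖e-diff x a≢s))) xs)
          (remove {x ⊖ e a} bs (remove as x∙s)))
      first : Neighbour x → Star
      first (a , a≢s , xa , as) = second a a≢s xa as
        (neighbour′ (⊖e-nonneg x≥0 xa) (subst (1ℤ ≤_) (sym (⊖e-diff x a≢s)) xs)
            (ℤ.≤-trans (remove as x∙s) (+≤+ z≤n)))

    -- Ideals without a star

    module _ (¬star : ¬ Star) where

      -- Subtract a simple root `s` with pairing 1. By induction the smaller root `γ ⊖ e s` has
      -- coefficients at most 1, and its pairing with `s` is -1. If it still contained `s`, then -1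
      -- would be 2 minus the number of neighbours of `s` in its support, so `s` would have three of
      -- them and be the centre of a star. Hence it avoids `s`, and `γ s` is 1.
      coefficient≤1 : ∀ {γ} → P γ → ∀ i → γ i ≤ 1ℤ
      coefficient≤1 Pγ = go _ Pγ (ℤ.≤-reflexive (sym (ℤ.0≤i⇒+∣i∣≡i (sum-nonneg (P-nonneg Pγ)))))
        where
        go : ∀ n {γ} → P γ → height γ ≤ pos n → ∀ i → γ i ≤ 1ℤ
        go zero    Pγ ht i = ⊥-elim (1≰0 (ℤ.≤-trans (root-height (P-root Pγ)) ht))
        go (suc n) {γ} Pγ ht i
          with ∃-positive-term _ (subst (1ℤ ≤_) (trans (sym (root-norm (P-root Pγ))) (⟪⟫-def γ γ))
              (+≤+ (s≤s z≤n)))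
        ... | s , term with 1≤product (P-nonneg Pγ s) term
        ... | slope , γs with ∙-upper (P-root Pγ) s
        ... | inj₂ γ≗es = subst (_≤ 1ℤ) (sym (γ≗es i)) (e≤1 s i)
        ... | inj₁ slope≤1 = conclude
          where
          Pγ′ : P (γ ⊖ e s)
          Pγ′ = P-ideal Pγ (root-down (P-root Pγ) (ℤ.≤-antisym slope≤1 slope)) (⊖e-≤ γ s)
          eq : ∀ h n → n - (h - 1ℤ) ≡ (1ℤ + n) - h
          eq = solve-∀
          IH : ∀ k → (γ ⊖ e s) k ≤ 1ℤ
          IH = go n Pγ′ (subst (_≤ pos n) (sym (height-⊖e γ s)) (lin₁ ht (eq (height γ) (pos n))))
          γ′∙s : (γ ⊖ e s) ∙ s ≤ -1ℤ
          γ′∙s = subst (_≤ -1ℤ) (sym (trans (∙-⊖e γ s s) (cong (λ z → γ ∙ s - z) (A-diag s))))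
              (ℤ.+-mono-≤ slope≤1 (ℤ.≤-refl { -2ℤ}))
          conclude : γ i ≤ 1ℤ
          conclude with s ≟ i
          ... | no s≢i = subst (_≤ 1ℤ) (⊖e-diff γ s≢i) (IH i)
          ... | yes refl with 0<⊎≡0 (P-nonneg Pγ′ s)
          ... | inj₁ 1≤γ′s = ⊥-elim (¬star (star-at Pγ′ IH 1≤γ′s γ′∙s))
          ... | inj₂ γ′s≡0 = ℤ.≤-reflexive (ℤ.i-j≡0⇒i≡j (γ s) 1ℤ (trans (sym (⊖e-same γ)) γ′s≡0))

      -- Supports are connected: the first step of `rise` from `e z` towards `δ` can only add a
      -- neighbour of `z`.
      alone : ∀ {δ z} → P δ → 1ℤ ≤ δ z → (∀ a → P (e a) → Adjacent a z → δ a ≡ 0ℤ) → δ ≗ e z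
      alone {δ} {z} Pδ δz h with rise (root-simple z) (P-root Pδ) (e≤ (P-nonneg Pδ) δz)
      ... | inj₁ eq = sym ∘ eq
      ... | inj₂ (s , ρ , ≤δ) = ⊥-elim (1≤⇒≢0 δs (h s (P-simple Pδ δs) (adjacent-sym adj)))
        where
        adj : Adjacent z s
        adj = trans (sym (e∙ z s)) (cover⇒∙ (root-simple z) ρ)
        δs : 1ℤ ≤ δ s
        δs = subst (_≤ δ s) (trans (⊕e-same (e z)) (cong (_+ 1ℤ) (e-diff (adjacent⇒≢ adj)))) (≤δ s)

      UniqueCovers : Fin r → Set
      UniqueCovers w = ∀ {σ s t} → P σ → 1ℤ ≤ σ w → P (σ ⊕ e s) → P (σ ⊕ e t) → s ≡ t

      -- Climb from `e w` towards both roots at once with `rise`. By uniqueness both climbs take the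
      -- same simple root at every step, until one of the two roots is reached. The number `n`
      -- bounds the height still missing below `β`.
      unique-covers⇒chain : ∀ {w} → P (e w) → UniqueCovers w → ∀ {β γ} → P β → P γ →
                            1ℤ ≤ β w → 1ℤ ≤ γ w → β ≤ᵛ γ ⊎ γ ≤ᵛ β
      unique-covers⇒chain {w} Pw unique {β} {γ} Pβ Pγ βw γw =
        go _ Pw (ℤ.≤-reflexive (sym (e-same w))) (e≤ (P-nonneg Pβ) βw) (e≤ (P-nonneg Pγ) γw)
           (ℤ.≤-trans (ℤ.≤-reflexive (sym (ℤ.0≤i⇒+∣i∣≡i (sum-nonneg (P-nonneg Pβ)))))
             (lin₁ (sum-nonneg (0≤e w)) (eq (height (e w)) _)))
        where
        eq : ∀ a b → a + b - b ≡ a - 0ℤ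
        eq = solve-∀
        go : ∀ n {σ} → P σ → 1ℤ ≤ σ w → σ ≤ᵛ β → σ ≤ᵛ γ → height β ≤ height σ + pos n → β ≤ᵛ γ ⊎ γ ≤ᵛ β
        go n {σ} Pσ σw σ≤β σ≤γ ht with rise (P-root Pσ) (P-root Pβ) σ≤β | rise (P-root Pσ) (P-root Pγ) σ≤γ
        ... | inj₁ σ≗β | _ = inj₁ λ i → subst (_≤ γ i) (σ≗β i) (σ≤γ i)
        ... | inj₂ _ | inj₁ σ≗γ = inj₂ λ i → subst (_≤ β i) (σ≗γ i) (σ≤β i)
        ... | inj₂ (s , ρs , s≤β) | inj₂ (t , ρt , t≤γ) with unique {σ} {s} {t} Pσ σw (P-ideal Pβ ρs s≤β)
            (P-ideal Pγ ρt t≤γ)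
        go zero {σ} Pσ σw σ≤β σ≤γ ht | inj₂ (s , ρs , s≤β) | inj₂ (t , ρt , t≤γ) | refl =
          ⊥-elim (1≰0 (lin₂ ht (subst (_≤ height β) (height-⊕e σ s) (sum-mono s≤β))
              (eq′ (height σ) (height β))))
          where
          eq′ : ∀ a b → 0ℤ - 1ℤ ≡ (a + 0ℤ - b) + (b - (a + 1ℤ))
          eq′ = solve-∀
        go (suc n) {σ} Pσ σw σ≤β σ≤γ ht | inj₂ (s , ρs , s≤β) | inj₂ (t , ρt , t≤γ) | refl =
          go n (P-ideal Pβ ρs s≤β) (ℤ.≤-trans σw (≤-⊕e σ s w)) s≤β t≤γ
             (subst (λ h → height β ≤ h + pos n) (sym (height-⊕e σ s))
                 (lin₁ ht (eq′ (height σ) (height β) (pos n))))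
          where
          eq′ : ∀ a b n → a + 1ℤ + n - b ≡ a + (1ℤ + n) - b
          eq′ = solve-∀

      -- Walks along the diagram

      UniqueNeighbour : Fin r → Fin r → Set
      UniqueNeighbour u w = ∀ a → P (e a) → Adjacent a w → a ≡ u

      -- ρ is the sum of the vertices of a path ending in u, and w continues the path.
      record Tip (ρ : Vector r) (u w : Fin r) : Set where
        field
          root    : Root ρ
          ≤1      : ∀ k → ρ k ≤ 1ℤ
          through : 1ℤ ≤ ρ u
          edge    : Adjacent u w
          fresh   : ρ w ≡ 0ℤ

        ρ≥0 : ∀ k → 0ℤ ≤ ρ k
        ρ≥0 = root-nonneg root

        next∙ : ρ ∙ w ≤ -1ℤ
        next∙ = adjacent⇒∙≤-1 ρ≥0 fresh through edge

        -- A second neighbour of `w` on the path would close a cycle; then `ρ ∙ w ≤ -2`, which is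
        -- impossible for two positive roots.
        only : ∀ {x} → 1ℤ ≤ ρ x → Adjacent x w → x ≡ u
        only {x} ρx xw with x ≟ u
        ... | yes p = p
        ... | no x≢u = case ℤ.≤-trans (∙-bound root w) (two-adjacent⇒∙≤-2 ρ≥0 fresh x≢u ρx xw through edge) of
            λ { (-≤- ()) }

        step : ∀ {z} → Adjacent w z → z ≢ u → Tip (ρ ⊕ e w) w z
        step {z} wz z≢u = record
          { root    = raise root next∙
          ; ≤1      = λ k → ⊕e-≤ {x = λ _ → 1ℤ} ≤1 fresh ℤ.≤-refl k
          ; through = ℤ.≤-reflexive (sym (trans (⊕e-same ρ) (cong (_+ 1ℤ) fresh)))
          ; edge    = wz
          ; fresh   = trans (⊕e-diff ρ (adjacent⇒≢ wz)) ρz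
          }
          where
          ρz : ρ z ≡ 0ℤ
          ρz with 0<⊎≡0 (ρ≥0 z)
          ... | inj₁ p = ⊥-elim (z≢u (only p (adjacent-sym wz)))
          ... | inj₂ p = p

      start : ∀ {u w} → Adjacent u w → Tip (e u) u w
      start {u} uw = record
        { root = root-simple u ; ≤1 = e≤1 u ; through = ℤ.≤-reflexive (sym (e-same u))
        ; edge = uw ; fresh = e-diff (adjacent⇒≢ uw) }

      module _ (Goal : Set) (Q : Vector r → Fin r → Fin r → Set)
        (Q-step : ∀ {ρ u w z} → Tip ρ u w → P (e w) → Q ρ u w → P (e z) → Adjacent w z → z ≢ u →
                  Goal ⊎ Q (ρ ⊕ e w) w z)
        where

        -- `Q` is an invariant of the walk, and `Goal` an early exit from it. The walk ends because
        -- path sums have coefficients at most 1, hence height at most `r`, while every step raises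
        -- the height by 1.
        walk : ∀ {ρ u w} → Tip ρ u w → P (e w) → Q ρ u w →
               Goal ⊎ ∃[ ρ ] ∃[ u ] ∃[ w ] Tip ρ u w × P (e w) × Q ρ u w × UniqueNeighbour u w
        walk {ρ} tip = go r tip (subst (_≤ height ρ + pos r) (ℤ.+-identityˡ (pos r))
                     (ℤ.+-mono-≤ (sum-nonneg (Tip.ρ≥0 tip)) (ℤ.≤-refl {pos r})))
          where
          go : ∀ n {ρ u w} → Tip ρ u w → pos r ≤ height ρ + pos n → P (e w) → Q ρ u w →
               Goal ⊎ ∃[ ρ ] ∃[ u ] ∃[ w ] Tip ρ u w × P (e w) × Q ρ u w × UniqueNeighbour u w
          go n {ρ} {u} {w} tip ht Pw q
            with any? (λ a → P? (e a) ×-dec (A w a ℤ.≟ -1ℤ) ×-dec ¬? (a ≟ u))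
          ... | no ¬next = inj₂ (ρ , u , w , tip , Pw , q , end)
            where
            end : UniqueNeighbour u w
            end a Pa aw with a ≟ u
            ... | yes p = p
            ... | no a≢u = ⊥-elim (¬next (a , Pa , adjacent-sym aw , a≢u))
          ... | yes (z , Pz , wz , z≢u) with Q-step tip Pw q Pz wz z≢u
          ... | inj₁ goal = inj₁ goal
          go zero {ρ} {u} {w} tip ht Pw q | yes (z , Pz , wz , z≢u) | inj₂ q′ =
            ⊥-elim (1≰0 (lin₂ ht (subst (_≤ pos r) (height-⊕e ρ w) (height-≤ (Tip.≤1 (Tip.step tip wz z≢u))))
                (eq (height ρ) (pos r))))
            where
            eq : ∀ a b → 0ℤ - 1ℤ ≡ (a + 0ℤ - b) + (b - (a + 1ℤ))
            eq = solve-∀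
          go (suc n) {ρ} {u} {w} tip ht Pw q | yes (z , Pz , wz , z≢u) | inj₂ q′ =
            go n (Tip.step tip wz z≢u) (subst (λ h → pos r ≤ h + pos n) (sym (height-⊕e ρ w))
                (lin₁ ht (eq (height ρ) (pos r) (pos n)))) Pz q′
            where
            eq : ∀ a b n → a + 1ℤ + n - b ≡ a + (1ℤ + n) - b
            eq = solve-∀

      -- A member of P that contains w, but not the next vertex z of the path, can be
      -- extended through z in only one way at its far end.
      Arm : Fin r → Fin r → Set
      Arm w z = ∀ {δ x y} → P δ → 1ℤ ≤ δ w → δ z ≡ 0ℤ → P (δ ⊕ e z) → x ≢ z → y ≢ z →
                δ ∙ x ≤ -1ℤ → δ ∙ y ≤ -1ℤ → P (δ ⊕ e z ⊕ e x) → P (δ ⊕ e z ⊕ e y) → x ≡ y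

      -- By `outward`, `w` is the only neighbour of `z` that can lie in `δ` or be `x` or `y`. If `w`
      -- is not in `δ`, then `δ` is `e z` and both additions must be `w`. Otherwise `z` is an end of
      -- the support of `δ`; without it, `δ` falls under `Arm w z`, with `z` as the first addition
      -- and `x`, `y` as the second ones.
      arm-step : ∀ {w z} → Adjacent w z → Arm w z → ∀ {δ x y} → P δ → 1ℤ ≤ δ z →
                 (∀ a → P (e a) → Adjacent a z → a ≢ w → δ a ≡ 0ℤ × a ≢ x × a ≢ y) →
                 P (δ ⊕ e x) → P (δ ⊕ e y) → x ≡ y
      arm-step {w} {z} wz arm {δ} {x} {y} Pδ δz outward Pδx Pδy with 0<⊎≡0 (P-nonneg Pδ w)
      ... | inj₂ δw≡0 = trans (is-w Pδx (proj₁ ∘ proj₂)) (sym (is-w Pδy (proj₂ ∘ proj₂)))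
        where
        vanish : ∀ a → P (e a) → Adjacent a z → δ a ≡ 0ℤ
        vanish a Pa az with a ≟ w
        ... | yes refl = δw≡0
        ... | no a≢w   = proj₁ (outward a Pa az a≢w)
        is-w : ∀ {v} → P (δ ⊕ e v) → (∀ {a} → δ a ≡ 0ℤ × a ≢ x × a ≢ y → a ≢ v) → v ≡ w
        is-w {v} Pδv excluded with v ≟ w
        ... | yes p = p
        ... | no v≢w = ⊥-elim (excluded (outward v Pv vz v≢w) refl)
          where
          Pv : P (e v)
          Pv = P-cover v Pδ Pδv
          vz : Adjacent v z
          vz = adjacent-sym (trans (sym (e∙ z v))
              (trans (sym (∙-cong (alone Pδ δz vanish) v)) (cover⇒∙ (P-root Pδ) (P-root Pδv))))
      ... | inj₁ 1≤δw = arm Pδ′ δ′w δ′z (P-resp (sym ∘ ⊖e⊕e δ z) Pδ) (≢z Pδx) (≢z Pδy)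
                          (∙-δ′ Pδx (proj₁ ∘ proj₂)) (∙-δ′ Pδy (proj₂ ∘ proj₂))
                          (P-resp (λ k → cong (_+ e x k) (sym (⊖e⊕e δ z k))) Pδx)
                          (P-resp (λ k → cong (_+ e y k) (sym (⊖e⊕e δ z k))) Pδy)
        where
        w≢z = adjacent⇒≢ wz
        -- If the pairing were at most 0, `z` would still have a neighbour in the support after the
        -- removal of `w`.
        1≤δ∙z : 1ℤ ≤ δ ∙ z
        1≤δ∙z with ≤∨1+≤ (δ ∙ z) 0ℤ
        ... | inj₂ p = p
        ... | inj₁ p = ⊥-elim (found (neighbour′ (⊖e-nonneg (P-nonneg Pδ) 1≤δw)
                         (subst (1ℤ ≤_) (sym (⊖e-diff δ w≢z)) δz) (remove wz p)))
          where
          found : ¬ (∃[ a ] a ≢ z × 1ℤ ≤ (δ ⊖ e w) a × Adjacent a z)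
          found (a , a≢z , δ′a , az) with a ≟ w
          ... | yes refl = ¬1≤⊖e {δ} {a} (coefficient≤1 Pδ a) δ′a
          ... | no a≢w   = 1≤⇒≢0 δa (proj₁ (outward a (P-simple Pδ δa) az a≢w))
            where
            δa : 1ℤ ≤ δ a
            δa = 1≤⊖e⇒1≤ δ w δ′a
        ρ′ : Root (δ ⊖ e z)
        ρ′ with lower (P-root Pδ) 1≤δ∙z
        ... | inj₁ ρ = ρ
        ... | inj₂ δ≗ez = ⊥-elim (1≤⇒≢0 1≤δw (trans (δ≗ez w) (e-diff (w≢z ∘ sym))))
        Pδ′ : P (δ ⊖ e z)
        Pδ′ = P-ideal Pδ ρ′ (⊖e-≤ δ z)
        δ′w : 1ℤ ≤ (δ ⊖ e z) w
        δ′w = subst (1ℤ ≤_) (sym (⊖e-diff δ (w≢z ∘ sym))) 1≤δw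
        δ′z : (δ ⊖ e z) z ≡ 0ℤ
        δ′z = trans (⊖e-same δ) (cong (_- 1ℤ) (ℤ.≤-antisym (coefficient≤1 Pδ z) δz))
        ≢z : ∀ {v} → P (δ ⊕ e v) → v ≢ z
        ≢z Pδv refl = case subst (1ℤ ≤_) (cover⇒∙ (P-root Pδ) (P-root Pδv)) 1≤δ∙z of λ ()
        ∙-δ′ : ∀ {v} → P (δ ⊕ e v) → (∀ {a} → δ a ≡ 0ℤ × a ≢ x × a ≢ y → a ≢ v) → (δ ⊖ e z) ∙ v ≤ -1ℤ
        ∙-δ′ {v} Pδv excluded with A-off (≢z Pδv)
        ... | inj₁ Avz = ℤ.≤-reflexive
            (trans (∙-⊖e δ z v) (cong₂ _-_ (cover⇒∙ (P-root Pδ) (P-root Pδv)) (trans (A-sym z v) Avz)))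
        ... | inj₂ vz with v ≟ w
        ... | yes refl = ⊥-elim (1≰0
            (lin₂ (coefficient≤1 Pδv v) 1≤δw
            (trans (eq (δ v)) (cong (λ q → 1ℤ - q + (δ v - 1ℤ)) (sym (⊕e-same δ))))))
          where
          eq : ∀ a → 0ℤ - 1ℤ ≡ (1ℤ - (a + 1ℤ)) + (a - 1ℤ)
          eq = solve-∀
        ... | no v≢w = ⊥-elim (excluded (outward v Pv vz v≢w) refl)
          where
          Pv : P (e v)
          Pv = P-cover v Pδ Pδv

      -- The bounds on `δ ∙ x` and `δ ∙ y` in `Arm` serve here: they show that `x` and `y` can be
      -- added to `δ` without `z′`, and then `z′` is no longer in the way of `arm-step`.
      arm-continue : ∀ {w z z′} → Adjacent w z → Arm w z →
                     (∀ a → P (e a) → Adjacent a z → a ≢ w → a ≡ z′) → Arm z z′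
      arm-continue {w} {z} {z′} wz arm only {δ} {x} {y} Pδ δz δz′ Pδz′ x≢z′ y≢z′ δ∙x δ∙y Px Py =
        arm-step wz arm Pδ δz outward (cut δ∙x Px) (cut δ∙y Py)
        where
        outward : ∀ a → P (e a) → Adjacent a z → a ≢ w → δ a ≡ 0ℤ × a ≢ x × a ≢ y
        outward a Pa az a≢w with only a Pa az a≢w
        ... | refl = δz′ , x≢z′ ∘ sym , y≢z′ ∘ sym
        cut : ∀ {v} → δ ∙ v ≤ -1ℤ → P (δ ⊕ e z′ ⊕ e v) → P (δ ⊕ e v)
        cut {v} p Pv = P-ideal Pv (raise (P-root Pδ) p) λ k → ℤ.+-mono-≤ (≤-⊕e δ z′ k) (ℤ.≤-refl {e v k})

      arm-end : ∀ {w z} → Adjacent w z → Arm w z → UniqueNeighbour w z → UniqueCovers z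
      arm-end wz arm end Pσ σz = arm-step wz arm Pσ σz λ a Pa az a≢w → ⊥-elim (a≢w (end a Pa az))

      ChainVertex : Set
      ChainVertex = ∃[ w ] P (e w) × UniqueCovers w

      walk-end : ∀ {Q : Vector r → Fin r → Fin r → Set} → (∀ {ρ u w} → Q ρ u w → Arm u w) →
                 ChainVertex ⊎ (∃[ ρ ] ∃[ u ] ∃[ w ] Tip ρ u w × P (e w) × Q ρ u w × UniqueNeighbour u w) →
                     ChainVertex
      walk-end arm (inj₁ found) = found
      walk-end arm (inj₂ (_ , _ , w , tip , Pw , q , end)) = w , Pw , arm-end (Tip.edge tip) (arm q) end

      record Branch (j a b c : Fin r) : Set where
        field
          a≢b : a ≢ b
          a≢c : a ≢ c
          b≢c : b ≢ c
          aj  : Adjacent a j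
          bj  : Adjacent b j
          cj  : Adjacent c j
          Pa  : P (e a)
          Pb  : P (e b)
          Pc  : P (e c)

      -- The walk leaves `j` through `b`, away from `a` and `c`. The missing triple makes `c` a
      -- spare neighbour of every root that contains `j` and can be extended by `b`. Later on, `a`
      -- and `c` together forbid a further branching.
      missing-triple⇒chain-vertex : ∀ {j a b c} → Branch j a b c → ¬ P (triple j b c) → ChainVertex
      missing-triple⇒chain-vertex {j} {a} {b} {c} br ¬jbc =
          walk-end {Q} proj₁ (walk ChainVertex Q Q-step (start (adjacent-sym bj)) Pb
          (base , ℤ.≤-reflexive (sym (e-same j)) , e-diff (adjacent⇒≢ aj ∘ sym) , e-diff (adjacent⇒≢ cj ∘ sym) ,
              a≢b ∘ sym , b≢c))
        where
        open Branch br
        Q : Vector r → Fin r → Fin r → Set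
        Q ρ u w = Arm u w × 1ℤ ≤ ρ j × ρ a ≡ 0ℤ × ρ c ≡ 0ℤ × w ≢ a × w ≢ c
        base : Arm j b
        base {δ} {x} {y} Pδ δj δb Pδb x≢b y≢b δ∙x δ∙y Px Py with x ≟ y
        ... | yes p = p
        -- The four neighbours of `δ` are `b`, `c`, `x` and `y`. The root `c` is neither in `δ` nor
        -- equal to `x` or `y`, since otherwise the missing triple would lie below a member of `P`.
        ... | no x≢y = ⊥-elim (no-four-neighbours (P-root Pδ) b≢c (x≢b ∘ sym) (y≢b ∘ sym) (≢c Px) (≢c Py) x≢y
                         (ℤ.≤-reflexive (cover⇒∙ (P-root Pδ) (P-root Pδb)))
                         (adjacent⇒∙≤-1 (P-nonneg Pδ) δc δj (adjacent-sym cj)) δ∙x δ∙y)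
          where
          1≤δb : 1ℤ ≤ (δ ⊕ e b) b
          1≤δb = ℤ.≤-reflexive (sym (trans (⊕e-same δ) (cong (_+ 1ℤ) δb)))
          δc : δ c ≡ 0ℤ
          δc with 0<⊎≡0 (P-nonneg Pδ c)
          ... | inj₂ p = p
          ... | inj₁ p = ⊥-elim (¬jbc (P-triple Pδb b≢c bj cj (ℤ.≤-trans δj (≤-⊕e δ b j)) 1≤δb
              (ℤ.≤-trans p (≤-⊕e δ b c))))
          ≢c : ∀ {v} → P (δ ⊕ e b ⊕ e v) → c ≢ v
          ≢c Pv refl = ¬jbc (P-triple Pv b≢c bj cj
            (ℤ.≤-trans (ℤ.≤-trans δj (≤-⊕e δ b j)) (≤-⊕e (δ ⊕ e b) c j))
            (ℤ.≤-trans 1≤δb (≤-⊕e (δ ⊕ e b) c b))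
            (subst (1ℤ ≤_) (sym (⊕e-same (δ ⊕ e b))) (ℤ.+-mono-≤ (P-nonneg Pδb c) (ℤ.≤-refl {1ℤ}))))
        Q-step : ∀ {ρ u w z} → Tip ρ u w → P (e w) → Q ρ u w → P (e z) → Adjacent w z → z ≢ u →
                 ChainVertex ⊎ Q (ρ ⊕ e w) w z
        Q-step {ρ} {u} {w} {z} tip Pw (arm , ρj , ρa , ρc , w≢a , w≢c) Pz wz z≢u =
          inj₂ (arm-continue edge arm unique , ρ′j , ρ′a , ρ′c , avoid aj (Tip.step tip wz z≢u) , avoid cj
              (Tip.step tip wz z≢u))
          where
          open Tip tip
          ρ′j : 1ℤ ≤ (ρ ⊕ e w) j
          ρ′j = ℤ.≤-trans ρj (≤-⊕e ρ w j)
          ρ′a : (ρ ⊕ e w) a ≡ 0ℤ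
          ρ′a = trans (⊕e-diff ρ w≢a) ρa
          ρ′c : (ρ ⊕ e w) c ≡ 0ℤ
          ρ′c = trans (⊕e-diff ρ w≢c) ρc
          j≢w : j ≢ w
          j≢w refl = 1≤⇒≢0 ρj fresh
          avoid : ∀ {v t} → Adjacent v j → Tip (ρ ⊕ e w) w t → t ≢ v
          avoid vj tip′ refl = j≢w (Tip.only tip′ ρ′j (adjacent-sym vj))
          unique : ∀ t → P (e t) → Adjacent t w → t ≢ u → t ≡ z
          unique t Pt tw t≢u with t ≟ z
          ... | yes p = p
          -- The path from `j` to `w` is a root with the neighbours `a`, `c` at one end and `t`, `z`
          -- at the other: the affine diagram of type D̃ with a longer middle.
          ... | no t≢z = ⊥-elim (no-four-neighbours (Tip.root tipt) t≢z (avoid aj tipt) (avoid cj tipt)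
              (avoid aj tipz) (avoid cj tipz) a≢c
                           (Tip.next∙ tipt) (Tip.next∙ tipz)
                           (adjacent⇒∙≤-1 (Tip.ρ≥0 tipt) ρ′a ρ′j (adjacent-sym aj))
                               (adjacent⇒∙≤-1 (Tip.ρ≥0 tipt) ρ′c ρ′j (adjacent-sym cj)))
            where
            tipt = Tip.step tip (adjacent-sym tw) t≢u
            tipz = Tip.step tip wz z≢u

      branch⇒chain-vertex : ∀ {j a b c} → Branch j a b c → ChainVertex
      branch⇒chain-vertex {j} {a} {b} {c} br with P? (triple j a b) | P? (triple j a c) | P? (triple j b c)
      ... | _ | _ | no ¬jbc = missing-triple⇒chain-vertex br ¬jbc
      ... | _ | no ¬jac | yes _ = missing-triple⇒chain-vertex (record { a≢b = a≢b ∘ sym ; a≢c = b≢c ; b≢c = a≢c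
          ; aj = bj ; bj = aj ; cj = cj ; Pa = Pb ; Pb = Pa ; Pc = Pc }) ¬jac
        where open Branch br
      ... | no ¬jab | yes _ | yes _ =
          missing-triple⇒chain-vertex (record { a≢b = a≢c ∘ sym ; a≢c = b≢c ∘ sym ; b≢c = a≢b ; aj = cj
          ; bj = aj ; cj = bj ; Pa = Pc ; Pb = Pa ; Pc = Pb }) ¬jab
        where open Branch br
      ... | yes jab | yes jac | yes jbc =
          ⊥-elim (¬star (record { a≢b = a≢b ; a≢c = a≢c ; b≢c = b≢c ; aj = aj ; bj = bj ; cj = cj ; jab = jab
          ; jac = jac ; jbc = jbc }))
        where open Branch br

      -- At a leaf the arm condition is vacuous: `δ` is `e v`, and any `x` that can be added is the
      -- unique neighbour `z`. A branch vertex met on the walk settles the search through one of its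
      -- missing triples; otherwise the condition is carried to the opposite leaf.
      from-leaf : ∀ {v z} → P (e v) → P (e z) → Adjacent v z → UniqueNeighbour z v → ChainVertex
      from-leaf {v} {z} Pv Pz vz end = walk-end {Q} proj₁ (walk ChainVertex Q Q-step (start vz) Pz (base , Pv))
        where
        Q : Vector r → Fin r → Fin r → Set
        Q ρ u w = Arm u w × P (e u)
        base : Arm v z
        base {δ} {x} Pδ δv δz Pδz x≢z y≢z δ∙x δ∙y Px Py = ⊥-elim (x≢z (end x Px′ (adjacent-sym vx)))
          where
          only-z : ∀ a → P (e a) → Adjacent a v → δ a ≡ 0ℤ
          only-z a Pa av = trans (cong δ (end a Pa av)) δz
          vx : Adjacent v x
          vx = trans (sym (e∙ v x)) (trans (sym (∙-cong (alone Pδ δv only-z) x)) (∙≤-1⇒≡ (P-root Pδ) δ∙x))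
          Px′ : P (e x)
          Px′ = P-cover x Pδz Px
        Q-step : ∀ {ρ u w z} → Tip ρ u w → P (e w) → Q ρ u w → P (e z) → Adjacent w z → z ≢ u →
                 ChainVertex ⊎ Q (ρ ⊕ e w) w z
        Q-step {ρ} {u} {w} {z} tip Pw (arm , Pu) Pz wz z≢u
          with any? (λ a → P? (e a) ×-dec (A a w ℤ.≟ -1ℤ) ×-dec ¬? (a ≟ u) ×-dec ¬? (a ≟ z))
        ... | yes (t , Pt , tw , t≢u , t≢z) = inj₁ (branch⇒chain-vertex (record
                { a≢b = z≢u ∘ sym ; a≢c = t≢u ∘ sym ; b≢c = t≢z ∘ sym ; aj = Tip.edge tip
                ; bj = adjacent-sym wz ; cj = tw ; Pa = Pu ; Pb = Pz ; Pc = Pt }))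
        ... | no none = inj₂ (arm-continue (Tip.edge tip) arm unique , Pw)
          where
          unique : ∀ t → P (e t) → Adjacent t w → t ≢ u → t ≡ z
          unique t Pt tw t≢u with t ≟ z
          ... | yes p = p
          ... | no t≢z = ⊥-elim (none (t , Pt , tw , t≢u , t≢z))

      -- An isolated vertex has no covers at all. Otherwise a first walk, whose invariant says
      -- merely that the last vertex of the path is in `P`, finds a leaf from which to start the
      -- real one.
      chain-vertex : ∀ {v} → P (e v) → ChainVertex
      chain-vertex {v} Pv with any? (λ a → P? (e a) ×-dec (A v a ℤ.≟ -1ℤ))
      ... | no none = v , Pv , λ {σ} {s} Pσ σv Ps _ → ⊥-elim (none (s ,
                P-cover s Pσ Ps ,
                trans (sym (e∙ v s)) (trans
                    (sym (∙-cong (alone Pσ σv λ a Pa av → ⊥-elim (none (a , Pa , adjacent-sym av))) s))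
                  (cover⇒∙ (P-root Pσ) (P-root Ps)))))
      ... | yes (w , Pw , vw) with walk ChainVertex (λ _ u _ → P (e u)) (λ _ Pw _ _ _ _ → inj₂ Pw) (start vw) Pw
          Pv
      ... | inj₁ found = found
      ... | inj₂ (_ , u , w , tip , Pw , Pu , end) = from-leaf Pw Pu (adjacent-sym (Tip.edge tip)) end

    -- Differences of roots in a chain

    module _ {α : Fin r}
      (chain : ∀ {β γ} → P β → P γ → 1ℤ ≤ β α → 1ℤ ≤ γ α → β ≤ᵛ γ ⊎ γ ≤ᵛ β) where

      private
        squeeze : ∀ {x y : Vector r} {s} → x ≤ᵛ y → y ≤ᵛ x ⊕ e s → y ≗ x ⊎ y ≗ x ⊕ e s
        squeeze {x} {y} {s} x≤y y≤x′ with ≤∨1+≤ (y s) (x s)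
        ... | inj₁ ys≤xs = inj₁ λ k → ℤ.≤-antisym (y≤x k) (x≤y k)
          where
          y≤x : ∀ k → y k ≤ x k
          y≤x k with s ≟ k
          ... | yes refl = ys≤xs
          ... | no s≢k   = subst (y k ≤_) (⊕e-diff x s≢k) (y≤x′ k)
        ... | inj₂ xs<ys = inj₂ λ k → ℤ.≤-antisym (y≤x′ k) (x′≤y k)
          where
          x′≤y : ∀ k → (x ⊕ e s) k ≤ y k
          x′≤y k with s ≟ k
          ... | yes refl = subst (_≤ y s) (ℤ.+-comm 1ℤ (x s)) xs<ys
          ... | no s≢k   = subst (_≤ y k) (sym (ℤ.+-identityʳ (x k))) (x≤y k)

      -- The terms (γ ∙ s) * γ s add up to 2, and the one of α cannot account for all of it.
      descend : ∀ {γ} → P γ → 1ℤ ≤ γ α → γ ≗ e α ⊎ ∃[ s ] γ ∙ s ≡ 1ℤ × P (γ ⊖ e s) × 1ℤ ≤ (γ ⊖ e s) α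
      descend {γ} Pγ γα with ∙-upper (P-root Pγ) α
      ... | inj₂ γ≗eα = inj₁ γ≗eα
      ... | inj₁ γ∙α≤1 with ≤∨1+≤ (γ ∙ α * γ α) 1ℤ
      ... | inj₂ 2≤ = inj₂ (α , γ∙α , P-ideal Pγ (root-down (P-root Pγ) γ∙α) (⊖e-≤ γ α) ,
                            subst (1ℤ ≤_) (sym (⊖e-same γ))
                                (lin₁ (subst (λ c → 1ℤ + 1ℤ ≤ c * γ α) γ∙α 2≤) (eq (γ α))))
        where
        eq : ∀ a → a - 1ℤ - 1ℤ ≡ 1ℤ * a - (1ℤ + 1ℤ)
        eq = solve-∀
        γ∙α : γ ∙ α ≡ 1ℤ
        γ∙α = ℤ.≤-antisym γ∙α≤1 (proj₁ (1≤product (P-nonneg Pγ α) (ℤ.≤-trans (+≤+ (s≤s z≤n)) 2≤)))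
      ... | inj₁ ≤1 = other (∃-positive-term t 1≤Σt)
        where
        t : Fin r → ℤ
        t k = γ ∙ k * γ k + - (γ ∙ α * γ α) * e α k
        Σt : sum t ≡ 2ℤ + - (γ ∙ α * γ α)
        Σt = trans (∑-distrib-+ (λ k → γ ∙ k * γ k) (λ k → - (γ ∙ α * γ α) * e α k))
                   (cong₂ _+_ (trans (sym (⟪⟫-def γ γ)) (root-norm (P-root Pγ)))
                       (sum-e (λ _ → - (γ ∙ α * γ α)) α))
        1≤Σt : 1ℤ ≤ sum t
        1≤Σt = subst (1ℤ ≤_) (sym Σt) (lin₁ ≤1 (eq (γ ∙ α * γ α)))
          where
          eq : ∀ a → 2ℤ + - a - 1ℤ ≡ 1ℤ - a
          eq = solve-∀
        other : ∃[ s ] 1ℤ ≤ t s → γ ≗ e α ⊎ ∃[ s ] γ ∙ s ≡ 1ℤ × P (γ ⊖ e s) × 1ℤ ≤ (γ ⊖ e s) α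
        other (s , ts) with α ≟ s
        ... | yes refl = ⊥-elim (1≰0 (subst (1ℤ ≤_) (eq (γ ∙ α * γ α)) ts))
          where
          eq : ∀ a → a + - a * 1ℤ ≡ 0ℤ
          eq = solve-∀
        ... | no α≢s with ∙-upper (P-root Pγ) s
        ... | inj₂ γ≗es = ⊥-elim (1≤⇒≢0 γα (trans (γ≗es α) (e-diff (α≢s ∘ sym))))
        ... | inj₁ γ∙s≤1 = inj₂ (s , γ∙s , P-ideal Pγ (root-down (P-root Pγ) γ∙s) (⊖e-≤ γ s) , subst (1ℤ ≤_)
            (sym (⊖e-diff γ (α≢s ∘ sym))) γα)
          where
          eq : ∀ a b → a + - b * 0ℤ ≡ a
          eq = solve-∀
          γ∙s : γ ∙ s ≡ 1ℤ
          γ∙s = ℤ.≤-antisym γ∙s≤1 (proj₁ (1≤product (P-nonneg Pγ s)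
            (subst (1ℤ ≤_) (eq (γ ∙ s * γ s) (γ ∙ α * γ α)) ts)))

      -- Induction on the height of `γ`, through `γ′ = γ ⊖ e s` from `descend`. If `β ≗ γ′`, the
      -- product is 2 - 1. If `⟪ β , γ′ ⟫` is 1, then `⟪ β , γ ⟫` is `1 + β ∙ s`, and the case
      -- `β ∙ s ≡ -1` has to be excluded: there `β ⊕ e s` would be a member orthogonal to `γ′`,
      -- although the chain makes it comparable to `γ′`. So `β ∙ s` is 0, and `γ′ ⊖ β` pairs to -1
      -- with `s` and can be raised to `γ ⊖ β`.
      chain-product : ∀ {β γ} → P β → P γ → 1ℤ ≤ β α → 1ℤ ≤ γ α → β ≤ᵛ γ →
                      β ≗ γ ⊎ ⟪ β , γ ⟫ ≡ 1ℤ × Root (γ ⊖ β)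
      chain-product Pβ Pγ = go _ Pβ Pγ (ℤ.≤-reflexive (sym (ℤ.0≤i⇒+∣i∣≡i (sum-nonneg (P-nonneg Pγ)))))
        where
        go : ∀ n {β γ} → P β → P γ → height γ ≤ pos n → 1ℤ ≤ β α → 1ℤ ≤ γ α → β ≤ᵛ γ →
             β ≗ γ ⊎ ⟪ β , γ ⟫ ≡ 1ℤ × Root (γ ⊖ β)
        go zero Pβ Pγ ht βα γα β≤γ = ⊥-elim (1≰0 (ℤ.≤-trans (root-height (P-root Pγ)) ht))
        go (suc n) {β} {γ} Pβ Pγ ht βα γα β≤γ with descend Pγ γα
        ... | inj₁ γ≗eα = inj₁ λ k → ℤ.≤-antisym (β≤γ k) (subst (_≤ β k) (sym (γ≗eα k)) (e≤ (P-nonneg Pβ) βα k))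
        ... | inj₂ (s , γ∙s , Pγ′ , γ′α) = split (chain Pβ Pγ′ βα γ′α)
          where
          γ′ = γ ⊖ e s
          γ′⊕es : γ′ ⊕ e s ≗ γ
          γ′⊕es = ⊖e⊕e γ s
          eqₕ : ∀ h n → n - (h - 1ℤ) ≡ (1ℤ + n) - h
          eqₕ = solve-∀
          ht′ : height γ′ ≤ pos n
          ht′ = subst (_≤ pos n) (sym (height-⊖e γ s)) (lin₁ ht (eqₕ (height γ) (pos n)))
          γ′∙s : γ′ ∙ s ≡ -1ℤ
          γ′∙s = trans (∙-⊖e γ s s) (cong₂ _-_ γ∙s (A-diag s))
          product : ∀ x → ⟪ x , γ ⟫ ≡ ⟪ x , γ′ ⟫ + x ∙ s
          product x = trans (⟪⟫-cong {x} (λ _ → refl) (sym ∘ γ′⊕es))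
              (trans (⟪⟫-⊕ʳ x γ′ (e s)) (cong (⟪ x , γ′ ⟫ +_) (⟪⟫-e x s)))
          below : β ≤ᵛ γ′ → β ≗ γ ⊎ ⟪ β , γ ⟫ ≡ 1ℤ × Root (γ ⊖ β)
          below β≤γ′ with go n Pβ Pγ′ ht′ βα γ′α β≤γ′
          ... | inj₁ β≗γ′ = inj₂ (trans (product β)
              (cong₂ _+_ (trans (⟪⟫-cong β≗γ′ (λ _ → refl)) (root-norm (P-root Pγ′)))
              (trans (∙-cong β≗γ′ s) γ′∙s)) ,
                                  root-resp (λ k → sym (trans (cong (λ z → γ k - z) (β≗γ′ k))
                                      (eq (γ k) (e s k)))) (root-simple s))
            where
            eq : ∀ g a → g - (g - a) ≡ a
            eq = solve-∀
          ... | inj₂ (βγ′ , ρ′) with root-upper (P-root Pβ) (P-root Pγ)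
          ... | inj₂ β≗γ = inj₁ β≗γ
          ... | inj₁ βγ≤1 = inj₂ (trans (product β) (cong₂ _+_ βγ′ β∙s) ,
                  root-resp (λ k → eq (γ k) (e s k) (β k))
                    (root-up ρ′ (trans (∙-⊖ γ′ β s) (cong₂ _-_ γ′∙s β∙s))))
            where
            eq : ∀ g a b → g - a - b + a ≡ g - b
            eq = solve-∀
            eq₀ : ∀ a → 0ℤ - a ≡ 1ℤ - (1ℤ + a)
            eq₀ = solve-∀
            zero-product : ⟪ β ⊕ e s , γ′ ⟫ ≡ 0ℤ
            zero-product = trans (⟪⟫-⊕ˡ β (e s) γ′)
                (cong₂ _+_ βγ′ (trans (⟪⟫-sym (e s) γ′) (trans (⟪⟫-e γ′ s) γ′∙s)))
            absurd : β ∙ s ≤ -1ℤ → ⊥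
            absurd p = compare (chain Pβs Pγ′ βsα γ′α)
              where
              ρβs : Root (β ⊕ e s)
              ρβs = raise (P-root Pβ) p
              βs≤γ : β ⊕ e s ≤ᵛ γ
              βs≤γ k = subst ((β ⊕ e s) k ≤_) (γ′⊕es k) (ℤ.+-mono-≤ (β≤γ′ k) (ℤ.≤-refl {e s k}))
              Pβs : P (β ⊕ e s)
              Pβs = P-ideal Pγ ρβs βs≤γ
              βsα : 1ℤ ≤ (β ⊕ e s) α
              βsα = ℤ.≤-trans βα (≤-⊕e β s α)
              equal : γ′ ≗ β ⊕ e s → ⊥
              equal eq = case trans (sym zero-product)
                  (trans (⟪⟫-cong (sym ∘ eq) (λ _ → refl)) (root-norm (P-root Pγ′))) of λ ()
              compare : β ⊕ e s ≤ᵛ γ′ ⊎ γ′ ≤ᵛ β ⊕ e s → ⊥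
              compare (inj₁ le) with go n Pβs Pγ′ ht′ βsα γ′α le
              ... | inj₁ eq = equal (sym ∘ eq)
              ... | inj₂ (one , _) = case trans (sym zero-product) one of λ ()
              compare (inj₂ ge) with squeeze {s = s} β≤γ′ ge
              ... | inj₁ eq = case trans (sym βγ′)
                  (trans (⟪⟫-cong (sym ∘ eq) (λ _ → refl)) (root-norm (P-root Pγ′))) of λ ()
              ... | inj₂ eq = equal eq
            β∙s : β ∙ s ≡ 0ℤ
            β∙s with ≤∨1+≤ (β ∙ s) -1ℤ
            ... | inj₁ p = ⊥-elim (absurd p)
            ... | inj₂ p = ℤ.≤-antisym (lin₁ (subst (_≤ 1ℤ) (trans (product β) (cong (_+ β ∙ s) βγ′)) βγ≤1)
                (eq₀ (β ∙ s))) p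
          split : β ≤ᵛ γ′ ⊎ γ′ ≤ᵛ β → β ≗ γ ⊎ ⟪ β , γ ⟫ ≡ 1ℤ × Root (γ ⊖ β)
          split (inj₁ β≤γ′) = below β≤γ′
          split (inj₂ γ′≤β) with squeeze {s = s} γ′≤β (λ k → subst (β k ≤_) (sym (γ′⊕es k)) (β≤γ k))
          ... | inj₁ β≗γ′ = below (ℤ.≤-reflexive ∘ β≗γ′)
          ... | inj₂ β≗γ  = inj₁ λ k → trans (β≗γ k) (γ′⊕es k)

      -- The difference has product 1 - 2 = -1 with `β`. If it contained `α`, the chain would make
      -- it comparable to `β`, and `chain-product` would give product 1 or equality.
      chain-difference : ∀ {β γ} → P β → P γ → 1ℤ ≤ β α → 1ℤ ≤ γ α → β ≤ᵛ γ →
                         β ≗ γ ⊎ P (γ ⊖ β) × (γ ⊖ β) α ≡ 0ℤ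
      chain-difference {β} {γ} Pβ Pγ βα γα β≤γ with chain-product Pβ Pγ βα γα β≤γ
      ... | inj₁ eq = inj₁ eq
      ... | inj₂ (one , ρ) = inj₂ (Pδ , δα)
        where
        Pδ : P (γ ⊖ β)
        Pδ = P-ideal Pγ ρ λ k → lin₁ (P-nonneg Pβ k) (eq (γ k) (β k))
          where
          eq : ∀ g b → g - (g - b) ≡ b - 0ℤ
          eq = solve-∀
        product : ⟪ β , γ ⊖ β ⟫ ≡ -1ℤ
        product = trans (⟪⟫-⊖ʳ β γ β) (cong₂ _-_ one (root-norm (P-root Pβ)))
        equal : β ≗ γ ⊖ β → ⊥
        equal eq = case trans (sym product)
            (trans (⟪⟫-cong {β} (λ _ → refl) (sym ∘ eq)) (root-norm (P-root Pβ))) of λ ()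
        incomparable : 1ℤ ≤ (γ ⊖ β) α → β ≤ᵛ γ ⊖ β ⊎ γ ⊖ β ≤ᵛ β → ⊥
        incomparable δα (inj₁ le) with chain-product Pβ Pδ βα δα le
        ... | inj₁ eq = equal eq
        ... | inj₂ (one′ , _) = case trans (sym product) one′ of λ ()
        incomparable δα (inj₂ ge) with chain-product Pδ Pβ δα βα ge
        ... | inj₁ eq = equal (sym ∘ eq)
        ... | inj₂ (one′ , _) = case trans (sym product) (trans (⟪⟫-sym β (γ ⊖ β)) one′) of λ ()
        δα : (γ ⊖ β) α ≡ 0ℤ
        δα with 0<⊎≡0 (P-nonneg Pδ α)
        ... | inj₁ p = ⊥-elim (incomparable p (chain Pβ Pδ βα p))
        ... | inj₂ p = p

-- Spans, independence and dimension

module LinearProperties {k ℓ₁ ℓ₂ v ℓv} (K : OrderedField k ℓ₁ ℓ₂)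
                        (V : LeftModule (OrderedField.ring K) v ℓv) where

  open import Level using (_⊔_)
  open import Data.Vec.Functional using (insertAt)
  open import Data.Vec.Functional.Properties using (insertAt-lookup; insertAt-punchIn)
  open import Relation.Binary.PropositionalEquality as ≡ using (_≡_; _≢_)
  open import Relation.Binary.Structures using (IsStrictTotalOrder)
  open import Relation.Unary using (Pred)
  private module K = OrderedField K
  open K using (_≈_; 0#; 1#; _+_; _*_; -_; ring)
  open LeftModule V
  open LinearAlgebra V
  open import Algebra.Properties.Ring ring using (-‿distribˡ-*; -1*x≈-x; x∙y⁻¹≈ε⇒x≈y)
  open import Algebra.Module.Properties.LeftModule V using (inverseˡ-uniqueᴹ)
  open import Algebra.Properties.CommutativeMonoid.Sum +ᴹ-commutativeMonoid
    using () renaming (sum to sumᴹ; sum-cong-≋ to sumᴹ-cong; ∑-distrib-+ to sumᴹ-distrib-+; sum-remove to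
        sumᴹ-remove)
  open import Relation.Binary.Reasoning.Setoid ≈ᴹ-setoid

  infix 4 _≟0
  _≟0 : ∀ x → Dec (x ≈ 0#)
  x ≟0 = IsStrictTotalOrder._≟_ K.isStrictTotalOrder x 0#

  record IsSubmodule {p} (W : Pred Carrierᴹ p) : Set (k ⊔ v ⊔ ℓv ⊔ p) where
    field
      resp : ∀ {x y} → x ≈ᴹ y → W x → W y
      zer  : W 0ᴹ
      add  : ∀ {x y} → W x → W y → W (x +ᴹ y)
      mul  : ∀ a {x} → W x → W (a *ₗ x)

    sums : ∀ {n} (t : Fin n → Carrierᴹ) → (∀ i → W (t i)) → W (sumᴹ t)
    sums {zero}  t h = zer
    sums {suc n} t h = add (h zero) (sums (t ∘ suc) (h ∘ suc))

  sum-zeroᴹ : ∀ {n} (t : Fin n → Carrierᴹ) → (∀ i → t i ≈ᴹ 0ᴹ) → sumᴹ t ≈ᴹ 0ᴹ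
  sum-zeroᴹ {zero}  t h = ≈ᴹ-refl
  sum-zeroᴹ {suc n} t h = ≈ᴹ-trans (+ᴹ-cong (h zero) (sum-zeroᴹ (t ∘ suc) (h ∘ suc))) (+ᴹ-identityˡ 0ᴹ)

  sum-singleᴹ : ∀ {n} (t : Fin n → Carrierᴹ) i → (∀ j → i ≢ j → t j ≈ᴹ 0ᴹ) → sumᴹ t ≈ᴹ t i
  sum-singleᴹ t zero    h = ≈ᴹ-trans (+ᴹ-congˡ (sum-zeroᴹ (t ∘ suc) λ j → h (suc j) λ ())) (+ᴹ-identityʳ _)
  sum-singleᴹ t (suc i) h = ≈ᴹ-trans
      (+ᴹ-cong (h zero λ ()) (sum-singleᴹ (t ∘ suc) i λ j i≢j → h (suc j) λ { ≡.refl → i≢j ≡.refl }))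
                                     (+ᴹ-identityˡ _)

  *ₗ-distrib-sum : ∀ {n} a (t : Fin n → Carrierᴹ) → a *ₗ sumᴹ t ≈ᴹ sumᴹ (λ i → a *ₗ t i)
  *ₗ-distrib-sum {zero}  a t = *ₗ-zeroʳ a
  *ₗ-distrib-sum {suc n} a t = ≈ᴹ-trans (*ₗ-distribˡ a (t zero) (sumᴹ (t ∘ suc)))
      (+ᴹ-congˡ (*ₗ-distrib-sum a (t ∘ suc)))

  linComb-cong : ∀ {n} {c d : Fin n → K.Carrier} (w : Fin n → Carrierᴹ) →
                 (∀ i → c i ≈ d i) → linComb c w ≈ᴹ linComb d w
  linComb-cong {n} w h = sumᴹ-cong {n} λ i → *ₗ-congʳ (h i)

  linComb-zero : ∀ {n} {c : Fin n → K.Carrier} (w : Fin n → Carrierᴹ) → (∀ i → c i ≈ 0#) → linComb c w ≈ᴹ 0ᴹ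
  linComb-zero w h = sum-zeroᴹ _ λ i → ≈ᴹ-trans (*ₗ-congʳ (h i)) (*ₗ-zeroˡ (w i))

  linComb-+ : ∀ {n} (c d : Fin n → K.Carrier) (w : Fin n → Carrierᴹ) →
              linComb (λ i → c i + d i) w ≈ᴹ linComb c w +ᴹ linComb d w
  linComb-+ {n} c d w = ≈ᴹ-trans (sumᴹ-cong {n} λ i → *ₗ-distribʳ (w i) (c i) (d i))
      (sumᴹ-distrib-+ (λ i → c i *ₗ w i) (λ i → d i *ₗ w i))

  linComb-* : ∀ {n} a (c : Fin n → K.Carrier) (w : Fin n → Carrierᴹ) →
              linComb (λ i → a * c i) w ≈ᴹ a *ₗ linComb c w
  linComb-* {n} a c w = ≈ᴹ-trans (sumᴹ-cong {n} λ i → *ₗ-assoc a (c i) (w i))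
      (≈ᴹ-sym (*ₗ-distrib-sum a (λ i → c i *ₗ w i)))

  δ : ∀ {n} → Fin n → Fin n → K.Carrier
  δ i j with i ≟ j
  ... | yes _ = 1#
  ... | no  _ = 0#

  δ-same : ∀ {n} (i : Fin n) → δ i i ≈ 1#
  δ-same i with i ≟ i
  ... | yes _ = K.refl
  ... | no ¬p = ⊥-elim (¬p ≡.refl)

  linComb-δ : ∀ {n} i (w : Fin n → Carrierᴹ) → linComb (δ i) w ≈ᴹ w i
  linComb-δ i w = ≈ᴹ-trans (sum-singleᴹ _ i off) (≈ᴹ-trans (*ₗ-congʳ (δ-same i)) (*ₗ-identityˡ (w i)))
    where
    off : ∀ j → i ≢ j → δ i j *ₗ w j ≈ᴹ 0ᴹ
    off j i≢j with i ≟ j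
    ... | yes p = ⊥-elim (i≢j p)
    ... | no _  = *ₗ-zeroˡ (w j)

  Span-submodule : ∀ {n} (b : Fin n → Carrierᴹ) → IsSubmodule (Span b)
  Span-submodule b = record
    { resp = λ { x≈y (c , p) → c , ≈ᴹ-trans p x≈y }
    ; zer  = (λ _ → 0#) , linComb-zero b (λ _ → K.refl)
    ; add  = λ { (c , p) (d , q) → (λ i → c i + d i) , ≈ᴹ-trans (linComb-+ c d b) (+ᴹ-cong p q) }
    ; mul  = λ { a (c , p) → (λ i → a * c i) , ≈ᴹ-trans (linComb-* a c b) (*ₗ-congˡ p) }
    }

  ∈-Span : ∀ {n} (b : Fin n → Carrierᴹ) i → Span b (b i)
  ∈-Span b i = δ i , linComb-δ i b

  Span-minimal : ∀ {n p} {W : Pred Carrierᴹ p} (b : Fin n → Carrierᴹ) → IsSubmodule W →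
                 (∀ i → W (b i)) → ∀ {x} → Span b x → W x
  Span-minimal b sub h (c , p) = resp p (sums _ λ i → mul (c i) (h i))
    where open IsSubmodule sub

  SpanOf-submodule : ∀ {N} (w : Fin N → Carrierᴹ) (S : Subset N) → IsSubmodule (SpanOf w S)
  SpanOf-submodule w S = record
    { resp = λ { x≈y (c , z , p) → c , z , ≈ᴹ-trans p x≈y }
    ; zer  = (λ _ → 0#) , (λ _ _ → K.refl) , linComb-zero w (λ _ → K.refl)
    ; add  = λ { (c , z , p) (d , z′ , q) → (λ i → c i + d i) ,
                 (λ j j∉S → K.trans (K.+-cong (z j j∉S) (z′ j j∉S)) (K.+-identityˡ 0#)) ,
                 ≈ᴹ-trans (linComb-+ c d w) (+ᴹ-cong p q) }
    ; mul  = λ { a (c , z , p) → (λ i → a * c i) , (λ j j∉S → K.trans (K.*-congˡ (z j j∉S)) (K.zeroʳ a)) ,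
                 ≈ᴹ-trans (linComb-* a c w) (*ₗ-congˡ p) }
    }

  ∈-SpanOf : ∀ {N} (w : Fin N → Carrierᴹ) {S : Subset N} {j} → j ∈ S → SpanOf w S (w j)
  ∈-SpanOf w {S} {j} j∈S = δ j , off , linComb-δ j w
    where
    off : ∀ i → i ∉ S → δ j i ≈ 0#
    off i i∉S with j ≟ i
    ... | yes ≡.refl = ⊥-elim (i∉S j∈S)
    ... | no _       = K.refl

  SpanOf-minimal : ∀ {N p} {W : Pred Carrierᴹ p} (w : Fin N → Carrierᴹ) {S : Subset N} → IsSubmodule W →
                   (∀ {j} → j ∈ S → W (w j)) → ∀ {x} → SpanOf w S x → W x
  SpanOf-minimal {W = W} w {S} sub h (c , z , p) = resp p (sums _ term)
    where
    open IsSubmodule sub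
    term : ∀ j → W (c j *ₗ w j)
    term j with j ∈? S
    ... | yes j∈S = mul (c j) (h j∈S)
    ... | no j∉S  = resp (≈ᴹ-sym (≈ᴹ-trans (*ₗ-congʳ (z j j∉S)) (*ₗ-zeroˡ (w j)))) zer

  independent⇒nonzero : ∀ {n} {b : Fin n → Carrierᴹ} → LinearlyIndependent b → ∀ i → ¬ (b i ≈ᴹ 0ᴹ)
  independent⇒nonzero {b = b} ind i bi≈0 =
      K.0≉1 (K.trans (K.sym (ind (δ i) (≈ᴹ-trans (linComb-δ i b) bi≈0) i)) (δ-same i))

  coordinates-unique : ∀ {n} {b : Fin n → Carrierᴹ} → LinearlyIndependent b → ∀ {c d} →
                       linComb c b ≈ᴹ linComb d b → ∀ i → c i ≈ d i
  coordinates-unique {b = b} ind {c} {d} p i = x∙y⁻¹≈ε⇒x≈y (c i) (d i)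
    (K.trans (K.+-congˡ (K.sym (-1*x≈-x (d i)))) (ind _ vanish i))
    where
    vanish : linComb (λ i → c i + - 1# * d i) b ≈ᴹ 0ᴹ
    vanish = begin
      linComb (λ i → c i + - 1# * d i) b            ≈⟨ linComb-+ c (λ i → - 1# * d i) b ⟩
      linComb c b +ᴹ linComb (λ i → - 1# * d i) b   ≈⟨ +ᴹ-cong p (linComb-* (- 1#) d b) ⟩
      linComb d b +ᴹ - 1# *ₗ linComb d b            ≈⟨ +ᴹ-congʳ (*ₗ-identityˡ (linComb d b)) ⟨
      1# *ₗ linComb d b +ᴹ - 1# *ₗ linComb d b      ≈⟨ *ₗ-distribʳ (linComb d b) 1# (- 1#) ⟨
      (1# + - 1#) *ₗ linComb d b                    ≈⟨ *ₗ-congʳ (K.-‿inverseʳ 1#) ⟩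
      0# *ₗ linComb d b                             ≈⟨ *ₗ-zeroˡ (linComb d b) ⟩
      0ᴹ                                            ∎

  -ᴹ-*ₗ : ∀ a x → - a *ₗ x ≈ᴹ -ᴹ (a *ₗ x)
  -ᴹ-*ₗ a x = inverseˡ-uniqueᴹ (- a *ₗ x) (a *ₗ x)
    (≈ᴹ-trans (≈ᴹ-sym (*ₗ-distribʳ x (- a) a)) (≈ᴹ-trans (*ₗ-congʳ (K.-‿inverseˡ a)) (*ₗ-zeroˡ x)))

  -- Steinitz: eliminate the first spanning vector.
  exchange : ∀ {m n} (b : Fin m → Carrierᴹ) (b′ : Fin n → Carrierᴹ) →
             LinearlyIndependent b → (∀ i → Span b′ (b i)) → m ℕ.≤ n
  exchange {zero}  {n}     b b′ ind sp = z≤n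
  exchange {suc m} {zero}  b b′ ind sp =
      ⊥-elim (independent⇒nonzero {b = b} ind zero (≈ᴹ-sym (proj₂ (sp zero))))
  exchange {suc m} {suc n} b b′ ind sp with any? (λ i → ¬? (proj₁ (sp i) zero ≟0))
  ... | no none = ℕ.m≤n⇒m≤1+n (exchange b (b′ ∘ suc) ind λ i → proj₁ (sp i) ∘ suc ,
                    ≈ᴹ-trans (≈ᴹ-trans (≈ᴹ-sym (+ᴹ-identityˡ _))
                        (+ᴹ-congʳ (≈ᴹ-sym (≈ᴹ-trans (*ₗ-congʳ (vanish i)) (*ₗ-zeroˡ (b′ zero))))))
                             (proj₂ (sp i)))
    where
    vanish : ∀ i → proj₁ (sp i) zero ≈ 0#
    vanish i with proj₁ (sp i) zero ≟0
    ... | yes p = p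
    ... | no ¬p = ⊥-elim (none (i , ¬p))
  ... | yes (i₀ , pivot) with K.inverse (proj₁ (sp i₀) zero) pivot
  ... | t , pt≈1 = s≤s (exchange d (b′ ∘ suc) d-independent d-span)
    where
    C : Fin (suc m) → Fin (suc n) → K.Carrier
    C i = proj₁ (sp i)
    q : Fin m → K.Carrier
    q l = - (C (punchIn i₀ l) zero * t)
    d : Fin m → Carrierᴹ
    d l = b (punchIn i₀ l) +ᴹ q l *ₗ b i₀
    head-vanishes : ∀ l → C (punchIn i₀ l) zero + q l * C i₀ zero ≈ 0#
    head-vanishes l = K.trans (K.+-congˡ (K.trans (K.sym (-‿distribˡ-* (C (punchIn i₀ l) zero * t) (C i₀ zero)))
      (K.-‿cong (K.trans (K.*-assoc _ t _) (K.trans (K.*-congˡ (K.trans (K.*-comm t _) pt≈1))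
          (K.*-identityʳ _)))))) (K.-‿inverseʳ _)
    d-span : ∀ l → Span (b′ ∘ suc) (d l)
    d-span l = (λ j → C (punchIn i₀ l) (suc j) + q l * C i₀ (suc j)) , (begin
      linComb (λ j → C (punchIn i₀ l) (suc j) + q l * C i₀ (suc j)) (b′ ∘ suc)   ≈⟨ +ᴹ-identityˡ _ ⟨
      0ᴹ +ᴹ linComb (λ j → C (punchIn i₀ l) (suc j) + q l * C i₀ (suc j)) (b′ ∘ suc)
        ≈⟨ +ᴹ-congʳ (≈ᴹ-trans (*ₗ-congʳ (head-vanishes l)) (*ₗ-zeroˡ (b′ zero))) ⟨
      linComb (λ j → C (punchIn i₀ l) j + q l * C i₀ j) b′
          ≈⟨ linComb-+ (C (punchIn i₀ l)) (λ j → q l * C i₀ j) b′ ⟩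
      linComb (C (punchIn i₀ l)) b′ +ᴹ linComb (λ j → q l * C i₀ j) b′
          ≈⟨ +ᴹ-cong (proj₂ (sp (punchIn i₀ l)))
                                                                                     (≈ᴹ-trans (linComb-* (q l)
                                                                                         (C i₀) b′) (*ₗ-congˡ (proj₂ (sp i₀)))) ⟩
      d l ∎)
    d-independent : LinearlyIndependent d
    d-independent c h l = K.trans (K.reflexive (≡.sym (insertAt-punchIn c i₀ s l)))
        (ind c′ c′-zero (punchIn i₀ l))
      where
      open import Algebra.Properties.CommutativeMonoid.Sum K.+-commutativeMonoid using () renaming (sum to sumᴷ)
      -- A relation with coefficients `c` among the `d l` is a relation among the `b i`, and this is
      -- the coefficient that it gives to the pivot `b i₀`.
      s : K.Carrier
      s = sumᴷ (λ l → c l * q l)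
      c′ : Fin (suc m) → K.Carrier
      c′ = insertAt c i₀ s
      sum-*ₗ : ∀ {n} (f : Fin n → K.Carrier) x → sumᴷ f *ₗ x ≈ᴹ sumᴹ (λ i → f i *ₗ x)
      sum-*ₗ {zero}  f x = *ₗ-zeroˡ x
      sum-*ₗ {suc n} f x = ≈ᴹ-trans (*ₗ-distribʳ x (f zero) _) (+ᴹ-congˡ (sum-*ₗ (f ∘ suc) x))
      c′-zero : linComb c′ b ≈ᴹ 0ᴹ
      c′-zero = begin
        linComb c′ b ≈⟨ sumᴹ-remove {i = i₀} (λ i → c′ i *ₗ b i) ⟩
        c′ i₀ *ₗ b i₀ +ᴹ sumᴹ (λ l → c′ (punchIn i₀ l) *ₗ b (punchIn i₀ l))
          ≈⟨ +ᴹ-cong (*ₗ-congʳ (K.reflexive (insertAt-lookup c i₀ s)))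
                     (sumᴹ-cong {m} λ l → *ₗ-congʳ (K.reflexive (insertAt-punchIn c i₀ s l))) ⟩
        s *ₗ b i₀ +ᴹ linComb c (b ∘ punchIn i₀)             ≈⟨ +ᴹ-congʳ (sum-*ₗ (λ l → c l * q l) (b i₀)) ⟩
        sumᴹ (λ l → (c l * q l) *ₗ b i₀) +ᴹ linComb c (b ∘ punchIn i₀)   ≈⟨ +ᴹ-comm _ _ ⟩
        linComb c (b ∘ punchIn i₀) +ᴹ sumᴹ (λ l → (c l * q l) *ₗ b i₀)
            ≈⟨ sumᴹ-distrib-+ (λ l → c l *ₗ b (punchIn i₀ l)) (λ l → (c l * q l) *ₗ b i₀) ⟨
        sumᴹ (λ l → c l *ₗ b (punchIn i₀ l) +ᴹ (c l * q l) *ₗ b i₀)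
          ≈⟨ sumᴹ-cong {m} (λ l → ≈ᴹ-trans (+ᴹ-congˡ (*ₗ-assoc (c l) (q l) (b i₀)))
              (≈ᴹ-sym (*ₗ-distribˡ (c l) (b (punchIn i₀ l)) (q l *ₗ b i₀)))) ⟩
        linComb c d                                         ≈⟨ h ⟩
        0ᴹ ∎

  dimension-≤ : ∀ {p p′ m n} {W : Pred Carrierᴹ p} {W′ : Pred Carrierᴹ p′} →
                HasDimension W m → HasDimension W′ n → (∀ {x} → W x → W′ x) → m ℕ.≤ n
  dimension-≤ (b , ind , ⊆W , ⊇W) (b′ , _ , ⊆W′ , ⊇W′) W⊆W′ =
    exchange b b′ ind λ i → ⊇W′ (W⊆W′ (⊆W (∈-Span b i)))

-- Finite arrangements and supersolvable partitions

module ArrangementTheory where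

  open import Level using (_⊔_)
  open import Data.Fin.Relation.Unary.Top using (view; ‵fromℕ; ‵inject₁)
  open import Data.Vec.Base using (tabulate; _∷_; there)
  open import Data.Vec.Properties using (lookup∘tabulate; []=⇒lookup; lookup⇒[]=)
  open import Relation.Binary.PropositionalEquality as ≡ using (_≡_; _≢_; refl; subst)
  open import Relation.Unary using (Pred)

  subset : ∀ {N p} {Q : Fin N → Set p} → (∀ j → Dec (Q j)) → Subset N
  subset Q? = tabulate (does ∘ Q?)

  ∈-subset⁺ : ∀ {N p} {Q : Fin N → Set p} (Q? : ∀ j → Dec (Q j)) {j} → Q j → j ∈ subset Q?
  ∈-subset⁺ Q? {j} q = lookup⇒[]= j _ (≡.trans (lookup∘tabulate (does ∘ Q?) j) (dec-true (Q? j) q))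

  ∈-subset⁻ : ∀ {N p} {Q : Fin N → Set p} (Q? : ∀ j → Dec (Q j)) {j} → j ∈ subset Q? → Q j
  ∈-subset⁻ Q? {j} j∈ with ≡.trans (≡.sym (lookup∘tabulate (does ∘ Q?) j)) ([]=⇒lookup j∈)
  ... | eq with Q? j
  ... | yes q = q
  ... | no _  = case eq of λ ()

  ∈─⇒∉ : ∀ {N} {p q : Subset N} {x} → x ∈ p ─ q → x ∉ q
  ∈─⇒∉ {p = _ ∷ p} {inside ∷ q}  (there x∈) (there x∈q) = ∈─⇒∉ x∈ x∈q
  ∈─⇒∉ {p = _ ∷ p} {outside ∷ q} (there x∈) (there x∈q) = ∈─⇒∉ x∈ x∈q

  -- The double negation shift for finite domains. It permits case distinctions on membership in a
  -- span inside the proof of a negation.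
  ¬¬-∀ : ∀ {N p} {Q : Fin N → Set p} → (∀ j → ¬ ¬ Q j) → ¬ ¬ (∀ j → Q j)
  ¬¬-∀ {zero}  h ¬all = ¬all λ ()
  ¬¬-∀ {suc N} h ¬all = h zero λ q → ¬¬-∀ (h ∘ suc) λ qs → ¬all λ { zero → q ; (suc j) → qs j }

  ¬¬-dec : ∀ {p} {Q : Set p} → ¬ ¬ Dec Q
  ¬¬-dec ¬d = ¬d (no λ q → ¬d (yes q))

  module ArrangementProperties {k ℓ₁ ℓ₂ v ℓv} (K : OrderedField k ℓ₁ ℓ₂)
         (V : LeftModule (OrderedField.ring K) v ℓv) {N : ℕ} (w : Fin N → LeftModule.Carrierᴹ V) where
    private module K = OrderedField K
    open K using (_≈_; 0#; 1#; _+_; _*_; -_)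
    open LeftModule V
    open LinearAlgebra V
    open LinearProperties K V
    open Arrangement V w

    module _ {p} {W : Pred Carrierᴹ p} (sub : IsSubmodule W) where
      open IsSubmodule sub

      divide : ∀ {a x} → ¬ (a ≈ 0#) → W (a *ₗ x) → W x
      divide {a} {x} a≉0 ax with K.inverse a a≉0
      ... | t , at≈1 = resp (≈ᴹ-trans (≈ᴹ-sym (*ₗ-assoc t a x))
          (≈ᴹ-trans (*ₗ-congʳ (K.trans (K.*-comm t a) at≈1)) (*ₗ-identityˡ x)))
                            (mul t ax)

      neg : ∀ {x} → W x → W (-ᴹ x)
      neg {x} wx = resp (≈ᴹ-trans (-ᴹ-*ₗ 1# x) (-ᴹ‿cong (*ₗ-identityˡ x))) (mul (- 1#) wx)

      cancelʳ : ∀ {x y} → W (x +ᴹ y) → W y → W x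
      cancelʳ {x} {y} wxy wy = resp
          (≈ᴹ-trans (+ᴹ-assoc x y (-ᴹ y)) (≈ᴹ-trans (+ᴹ-congˡ (-ᴹ‿inverseʳ y)) (+ᴹ-identityʳ x)))
                                    (add wxy (neg wy))

      cancelˡ : ∀ {x y} → W (x +ᴹ y) → W x → W y
      cancelˡ {x} {y} wxy = cancelʳ (resp (+ᴹ-comm x y) wxy)

    SpanOf-mono : ∀ {S S′} → S ⊆ S′ → ∀ {x} → SpanOf w S x → SpanOf w S′ x
    SpanOf-mono {S} {S′} S⊆S′ = SpanOf-minimal w (SpanOf-submodule w S′) (λ j∈ → ∈-SpanOf w (S⊆S′ j∈))

    Line : Carrierᴹ → Fin 1 → Carrierᴹ
    Line x _ = x

    multiple : ∀ {x y} → Span (Line x) y → ∃[ t ] y ≈ᴹ t *ₗ x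
    multiple (c , p) = c zero , ≈ᴹ-trans (≈ᴹ-sym p) (+ᴹ-identityʳ _)

    zero-submodule : IsSubmodule (_≈ᴹ 0ᴹ)
    zero-submodule = record
      { resp = λ x≈y x≈0 → ≈ᴹ-trans (≈ᴹ-sym x≈y) x≈0
      ; zer  = ≈ᴹ-refl
      ; add  = λ p q → ≈ᴹ-trans (+ᴹ-cong p q) (+ᴹ-identityˡ 0ᴹ)
      ; mul  = λ a p → ≈ᴹ-trans (*ₗ-congˡ p) (*ₗ-zeroʳ a)
      }

    rank-empty : ∀ {S} → (∀ {j} → j ∉ S) → HasRank S 0
    rank-empty {S} empty = (λ ()) , (λ _ _ ()) ,
      Span-minimal (λ ()) (SpanOf-submodule w S) (λ ()) ,
      SpanOf-minimal w (Span-submodule (λ ())) (⊥-elim ∘ empty)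

    rank-extend : ∀ {Q P n α} → HasRank Q n → Q ⊆ P → α ∈ P → ¬ SpanOf w Q (w α) →
                  (∀ {j} → j ∈ P → ∃[ a ] ∃[ y ] SpanOf w Q y × w j ≈ᴹ a *ₗ w α +ᴹ y) →
                  HasRank P (suc n)
    rank-extend {Q} {P} {n} {α} (b , ind , ⊆Q , ⊇Q) Q⊆P α∈P α∉Q decompose = b′ , ind′ ,
      Span-minimal b′ (SpanOf-submodule w P)
          (λ { zero → ∈-SpanOf w α∈P ; (suc i) → SpanOf-mono Q⊆P (⊆Q (∈-Span b i)) }) ,
      SpanOf-minimal w (Span-submodule b′) member
      where
      b′ : Fin (suc n) → Carrierᴹ
      b′ zero    = w α
      b′ (suc i) = b i
      open IsSubmodule (Span-submodule b′)
      member : ∀ {j} → j ∈ P → Span b′ (w j)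
      member j∈P with decompose j∈P
      ... | a , y , y∈Q , eq = resp (≈ᴹ-sym eq)
          (add (mul a (∈-Span b′ zero)) (Span-minimal b (Span-submodule b′) (λ i → ∈-Span b′ (suc i)) (⊇Q y∈Q)))
      ind′ : LinearlyIndependent b′
      ind′ c h with c zero ≟0
      ... | no c₀≉0 = ⊥-elim (α∉Q
          (⊆Q (divide sub c₀≉0 (cancelʳ sub (IsSubmodule.resp sub (≈ᴹ-sym h) (IsSubmodule.zer sub))
          (c ∘ suc , ≈ᴹ-refl)))))
        where sub = Span-submodule b
      ... | yes c₀≈0 = λ { zero → c₀≈0 ; (suc i) → ind (c ∘ suc) tail≈0 i }
        where
        tail≈0 : linComb (c ∘ suc) b ≈ᴹ 0ᴹ
        tail≈0 = cancelˡ zero-submodule h (≈ᴹ-trans (*ₗ-congʳ c₀≈0) (*ₗ-zeroˡ (w α)))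

    two-distinct : ∀ {F} → HasRank F 2 → ∃[ β ] ∃[ γ ] β ∈ F × γ ∈ F × β ≢ γ
    two-distinct {F} rank with any? (_∈? F)
    ... | no none = case dimension-≤ rank (rank-empty {F} (λ j∈F → none (_ , j∈F))) (λ x → x) of λ ()
    ... | yes (β , β∈F) with any? (λ γ → (γ ∈? F) ×-dec ¬? (β ≟ γ))
    ... | yes (γ , γ∈F , β≢γ) = β , γ , β∈F , γ∈F , β≢γ
    ... | no none = case exchange (proj₁ rank) (Line (w β)) (proj₁ (proj₂ rank)) (λ i →
                      SpanOf-minimal w (Span-submodule (Line (w β))) only
                          (proj₁ (proj₂ (proj₂ rank)) (∈-Span (proj₁ rank) i))) of λ { (s≤s ()) }
      where
      only : ∀ {j} → j ∈ F → Span (Line (w β)) (w j)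
      only {j} j∈F with β ≟ j
      ... | yes refl = ∈-Span (Line (w β)) zero
      ... | no β≢j   = ⊥-elim (none (j , j∈F , β≢j))

    ∈-upTo⁻ : ∀ {n} {Π : Fin n → Subset N} {i j} → j ∈ upTo Π i → ∃[ i′ ] i′ Fin.≤ i × j ∈ Π i′
    ∈-upTo⁻ {i = zero}          j∈ = zero , z≤n , j∈
    ∈-upTo⁻ {Π = Π} {i = suc i} j∈ with x∈p∪q⁻ (Π zero) _ j∈
    ... | inj₁ j∈Π = zero , z≤n , j∈Π
    ... | inj₂ j∈′ with ∈-upTo⁻ {Π = Π ∘ suc} {i} j∈′
    ... | i′ , i′≤i , j∈Π = suc i′ , s≤s i′≤i , j∈Π

    ∈-upTo⁺ : ∀ {n} {Π : Fin n → Subset N} {i j} i′ → i′ Fin.≤ i → j ∈ Π i′ → j ∈ upTo Π i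
    ∈-upTo⁺ {i = zero}  zero     _         j∈ = j∈
    ∈-upTo⁺ {i = suc i} zero     _         j∈ = x∈p∪q⁺ (inj₁ j∈)
    ∈-upTo⁺ {Π = Π} {suc i} (suc i′) (s≤s le) j∈ = x∈p∪q⁺ (inj₂ (∈-upTo⁺ {Π = Π ∘ suc} i′ le j∈))

    -- A supersolvable partition read from the last block downwards, to match the recursion of
    -- `ChainPeeling`. The indexing of `Supersolvable` runs the other way, so `tower⇒partition`
    -- appends each block at the end with `snoc`.
    data Tower : Subset N → ℕ → Set (k ⊔ ℓ₁ ⊔ v ⊔ ℓv) where
      ground : ∀ {P} → (∀ {j} → j ∉ P) → Tower P 0
      storey : ∀ {Q R P n} → Tower Q n → Q ∪ R ≡ P → (∀ {j} → j ∈ Q → j ∉ R) → HasRank P (suc n) →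
              (∀ F → IsFlat P F → HasRank F 2 → ¬ (F ⊆ R)) → Tower P (suc n)

    snoc : ∀ {n} → (Fin n → Subset N) → Subset N → Fin (suc n) → Subset N
    snoc {zero}  Π R _       = R
    snoc {suc n} Π R zero    = Π zero
    snoc {suc n} Π R (suc i) = snoc (Π ∘ suc) R i

    snoc-inject₁ : ∀ {n} (Π : Fin n → Subset N) R i → snoc Π R (inject₁ i) ≡ Π i
    snoc-inject₁ Π R zero    = refl
    snoc-inject₁ Π R (suc i) = snoc-inject₁ (Π ∘ suc) R i

    snoc-fromℕ : ∀ {n} (Π : Fin n → Subset N) R → snoc Π R (fromℕ n) ≡ R
    snoc-fromℕ {zero}  Π R = refl
    snoc-fromℕ {suc n} Π R = snoc-fromℕ (Π ∘ suc) R

    upTo-snoc : ∀ {n} (Π : Fin n → Subset N) R i → upTo (snoc Π R) (inject₁ i) ≡ upTo Π i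
    upTo-snoc Π R zero    = refl
    upTo-snoc Π R (suc i) = ≡.cong (Π zero ∪_) (upTo-snoc (Π ∘ suc) R i)

    Condition : ∀ {n} → (Fin n → Subset N) → Fin n → Set _
    Condition Π i = HasRank (upTo Π i) (suc (toℕ i)) × (∀ F → IsFlat (upTo Π i) F → HasRank F 2 → ¬ (F ⊆ Π i))

    upTo-last : ∀ {n P} {Π : Fin (suc n) → Subset N} → IsPartition P Π → upTo Π (fromℕ n) ≡ P
    upTo-last {n} {P} {Π} part = ⊆-antisym
      (λ j∈ → let i , _ , j∈Π = ∈-upTo⁻ {Π = Π} {fromℕ n} j∈ in within i j∈Π)
      (λ j∈ → let i , j∈Π = covers j∈ in ∈-upTo⁺ {Π = Π} i (Fin.≤fromℕ i) j∈Π)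
      where open IsPartition part

    tower⇒partition : ∀ {P n} → Tower P n → Σ[ Π ∈ (Fin n → Subset N) ] IsPartition P Π × (∀ i → Condition Π i)
    tower⇒partition (ground ∉P) =
        (λ ()) , record { within = λ () ; covers = ⊥-elim ∘ ∉P ; disjoint = λ { {()} } } , λ ()
    tower⇒partition {P} {suc n} (storey {Q} {R} tower refl apart rank flats) with tower⇒partition tower
    ... | Π , part , cond = Π′ , part′ , cond′
      where
      open IsPartition part
      Π′ = snoc Π R
      within′ : ∀ i → Π′ i ⊆ Q ∪ R
      within′ i with view i
      ... | ‵fromℕ     = λ j∈ → x∈p∪q⁺ (inj₂ (subst (_ ∈_) (snoc-fromℕ Π R) j∈))
      ... | ‵inject₁ i = λ j∈ → x∈p∪q⁺ (inj₁ (within i (subst (_ ∈_) (snoc-inject₁ Π R i) j∈)))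
      covers′ : ∀ {j} → j ∈ Q ∪ R → ∃[ i ] j ∈ Π′ i
      covers′ j∈ with x∈p∪q⁻ Q R j∈
      ... | inj₂ j∈R = fromℕ n , subst (_ ∈_) (≡.sym (snoc-fromℕ Π R)) j∈R
      ... | inj₁ j∈Q with covers j∈Q
      ... | i , j∈Π = inject₁ i , subst (_ ∈_) (≡.sym (snoc-inject₁ Π R i)) j∈Π
      disjoint′ : ∀ i i′ {j} → j ∈ Π′ i → j ∈ Π′ i′ → i ≡ i′
      disjoint′ i i′ p q with view i | view i′
      ... | ‵fromℕ     | ‵fromℕ      = refl
      ... | ‵fromℕ     | ‵inject₁ i′ =
          ⊥-elim (apart (within i′ (subst (_ ∈_) (snoc-inject₁ Π R i′) q)) (subst (_ ∈_) (snoc-fromℕ Π R) p))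
      ... | ‵inject₁ i | ‵fromℕ      =
          ⊥-elim (apart (within i (subst (_ ∈_) (snoc-inject₁ Π R i) p)) (subst (_ ∈_) (snoc-fromℕ Π R) q))
      ... | ‵inject₁ i | ‵inject₁ i′ =
          ≡.cong inject₁ (disjoint (subst (_ ∈_) (snoc-inject₁ Π R i) p) (subst (_ ∈_) (snoc-inject₁ Π R i′) q))
      part′ : IsPartition (Q ∪ R) Π′
      part′ = record { within = within′ ; covers = covers′ ; disjoint = λ {i} {i′} → disjoint′ i i′ }
      transport : ∀ {S S′ R R′ : Subset N} {m m′} → S ≡ S′ → R ≡ R′ → m ≡ m′ →
                  HasRank S m × (∀ F → IsFlat S F → HasRank F 2 → ¬ (F ⊆ R)) →
                  HasRank S′ m′ × (∀ F → IsFlat S′ F → HasRank F 2 → ¬ (F ⊆ R′))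
      transport refl refl refl c = c
      cond′ : ∀ i → Condition Π′ i
      cond′ i with view i
      ... | ‵fromℕ     = transport (≡.sym (upTo-last part′)) (≡.sym (snoc-fromℕ Π R))
          (≡.cong suc (≡.sym (toℕ-fromℕ n))) (rank , flats)
      ... | ‵inject₁ i = transport (≡.sym (upTo-snoc Π R i)) (≡.sym (snoc-inject₁ Π R i))
          (≡.cong suc (≡.sym (toℕ-inject₁ i))) (cond i)

    tower-rank : ∀ {P n} → Tower P n → HasRank P n
    tower-rank (ground ∉P)        = rank-empty ∉P
    tower-rank (storey _ _ _ r _) = r

    tower⇒supersolvable : ∀ {P n} → Tower P n → Supersolvable P
    tower⇒supersolvable {P} {n} tower = n , tower-rank tower , tower⇒partition tower

    Pair : Fin N → Fin N → Fin 2 → Carrierᴹ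
    Pair β γ zero       = w β
    Pair β γ (suc zero) = w γ

    rank-pair : ∀ {F β γ} → LinearlyIndependent (Pair β γ) → β ∈ F → γ ∈ F →
                (∀ {j} → j ∈ F → Span (Pair β γ) (w j)) → HasRank F 2
    rank-pair {F} {β} {γ} ind β∈F γ∈F h = Pair β γ , ind ,
      Span-minimal (Pair β γ) (SpanOf-submodule w F) (λ { zero → ∈-SpanOf w β∈F ; (suc zero) → ∈-SpanOf w γ∈F })
          ,
      SpanOf-minimal w (Span-submodule (Pair β γ)) h

    -- Closedness of the initial unions of blocks

    module Modular {𝒜 : Subset N}
      (nonzero     : ∀ {j} → j ∈ 𝒜 → ¬ (w j ≈ᴹ 0ᴹ))
      (nonparallel : ∀ {i j} → i ∈ 𝒜 → j ∈ 𝒜 → ∀ t → w i ≈ᴹ t *ₗ w j → i ≡ j)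
      {n} {Π : Fin n → Subset N} (part : IsPartition 𝒜 Π) (cond : ∀ i → Condition Π i) where
      open IsPartition part

      pair-independent : ∀ {β γ} → β ∈ 𝒜 → γ ∈ 𝒜 → β ≢ γ → LinearlyIndependent (Pair β γ)
      pair-independent {β} {γ} β∈ γ∈ β≢γ c h = λ { zero → c₀≈0 ; (suc zero) → c₁≈0 }
        where
        h′ : c zero *ₗ w β +ᴹ c (suc zero) *ₗ w γ ≈ᴹ 0ᴹ
        h′ = ≈ᴹ-trans (+ᴹ-congˡ (≈ᴹ-sym (+ᴹ-identityʳ _))) h
        c₁≈0 : c (suc zero) ≈ 0#
        c₁≈0 with c (suc zero) ≟0
        ... | yes p = p
        ... | no ¬p = ⊥-elim (β≢γ (≡.sym (nonparallel γ∈ β∈ _ (proj₂ (multiple (divide sub ¬p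
                        (cancelˡ sub (resp (≈ᴹ-sym h′) zer) (mul (c zero) (∈-Span (Line (w β)) zero)))))))))
          where
          sub = Span-submodule (Line (w β))
          open IsSubmodule sub
        c₀≈0 : c zero ≈ 0#
        c₀≈0 with c zero ≟0
        ... | yes p = p
        ... | no ¬p = ⊥-elim (nonzero β∈
            (divide zero-submodule ¬p (cancelʳ zero-submodule h′ (≈ᴹ-trans (*ₗ-congʳ c₁≈0) (*ₗ-zeroˡ (w γ))))))

      initial? : ∀ m j → Dec (∃[ i ] toℕ i ℕ.< m × j ∈ Π i)
      initial? m j = any? λ i → (toℕ i ℕ.<? m) ×-dec (j ∈? Π i)

      -- Compared with `upTo`, this has an additional empty stage 0. So the first block also has a
      -- predecessor, and descending arguments have a bottom.
      initial : ℕ → Subset N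
      initial m = subset (initial? m)

      upTo≡initial : ∀ i → upTo Π i ≡ initial (suc (toℕ i))
      upTo≡initial i = ⊆-antisym
        (λ j∈ → let i′ , i′≤i , j∈Π = ∈-upTo⁻ {Π = Π} j∈ in ∈-subset⁺ (initial? (suc (toℕ i))) (i′ , s≤s i′≤i , j∈Π))
        (λ j∈ → let i′ , i′<  , j∈Π = ∈-subset⁻ (initial? (suc (toℕ i))) j∈ in ∈-upTo⁺ {Π = Π} i′ (ℕ.≤-pred i′<) j∈Π)

      initial-zero : ∀ {j} → j ∉ initial 0
      initial-zero j∈ = case ∈-subset⁻ (initial? 0) j∈ of λ ()

      initial-mono : ∀ {m m′} → m ℕ.≤ m′ → initial m ⊆ initial m′
      initial-mono {m} {m′} m≤m′ j∈ = let i , i<m , j∈Π = ∈-subset⁻ (initial? m) j∈ in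
                                      ∈-subset⁺ (initial? m′) (i , ℕ.<-≤-trans i<m m≤m′ , j∈Π)

      initial-rank : ∀ {m} → m ℕ.≤ n → HasRank (initial m) m
      initial-rank {zero}  _   = rank-empty initial-zero
      initial-rank {suc m} m<n = subst (λ l → HasRank (initial (suc l)) (suc l)) (toℕ-fromℕ< m<n)
        (subst (λ S → HasRank S (suc (toℕ i))) (upTo≡initial i) (proj₁ (cond i)))
        where i = fromℕ< m<n

      initial-new : ∀ {i j} → j ∈ upTo Π i → j ∈ Π i ⊎ j ∈ initial (toℕ i)
      initial-new {i} {j} j∈ with ∈-upTo⁻ {Π = Π} j∈
      ... | i′ , i′≤i , j∈Π with i′ ≟ i
      ... | yes refl = inj₁ j∈Π
      ... | no i′≢i  = inj₂ (∈-subset⁺ (initial? (toℕ i)) (i′ , ℕ.≤∧≢⇒< i′≤i (i′≢i ∘ toℕ-injective) , j∈Π))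

      -- If one element of the block were in the span of the earlier blocks, then all
      -- would be, since the 2-flat through two elements of the block meets an earlier one.
      new-not-in-span : ∀ {i β} → β ∈ Π i → ¬ SpanOf w (initial (toℕ i)) (w β)
      new-not-in-span {i} {β} β∈Π β∈span = ¬¬-∀ all-in-span λ h →
        -- All blocks up to `i` would lie in the span of the earlier ones, whose rank is smaller by
        -- 1.
        ℕ.1+n≰n (dimension-≤ (proj₁ (cond i)) (initial-rank (ℕ.<⇒≤ (toℕ<n i)))
          (SpanOf-minimal w sub λ j∈ → case initial-new j∈ of λ { (inj₁ j∈Π) → h _ j∈Π
              ; (inj₂ j∈U) → ∈-SpanOf w j∈U }))
        where
        U = initial (toℕ i)
        sub = SpanOf-submodule w U
        all-in-span : ∀ γ → ¬ ¬ (γ ∈ Π i → SpanOf w U (w γ))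
        all-in-span γ ¬h with β ≟ γ
        ... | yes refl = ¬h λ _ → β∈span
        ... | no β≢γ with γ ∈? Π i
        ... | no γ∉Π = ¬h (⊥-elim ∘ γ∉Π)
        -- The 2-flat has to be a `Subset`, so membership in the span of `β` and `γ` is decided
        -- under the double negation.
        ... | yes γ∈Π = ¬¬-∀ {Q = λ j → Dec (Span (Pair β γ) (w j))} (λ _ → ¬¬-dec) use
          where
          use : ¬ (∀ j → Dec (Span (Pair β γ) (w j)))
          use span? with any? (λ j → (j ∈? F) ×-dec ¬? (j ∈? Π i))
            where
            F = subset (λ j → (j ∈? upTo Π i) ×-dec span? j)
          ... | no none = proj₂ (cond i) F flat (rank-pair (pair-independent (within i β∈Π) (within i γ∈Π) β≢γ)
              β∈F γ∈F (proj₂ ∘ F⁻))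
                            λ {j} j∈F → decidable-stable (j ∈? Π i) λ j∉Π → none (j , j∈F , j∉Π)
            where
            F? = λ j → (j ∈? upTo Π i) ×-dec span? j
            F = subset F?
            F⁻ : ∀ {j} → j ∈ F → j ∈ upTo Π i × Span (Pair β γ) (w j)
            F⁻ = ∈-subset⁻ F?
            β∈F : β ∈ F
            β∈F = ∈-subset⁺ F? (∈-upTo⁺ {Π = Π} i ℕ.≤-refl β∈Π , ∈-Span (Pair β γ) zero)
            γ∈F : γ ∈ F
            γ∈F = ∈-subset⁺ F? (∈-upTo⁺ {Π = Π} i ℕ.≤-refl γ∈Π , ∈-Span (Pair β γ) (suc zero))
            flat : IsFlat (upTo Π i) F
            flat = (proj₁ ∘ F⁻) ,
              (λ { (j∈A , j∈span) → ∈-subset⁺ F? (j∈A , SpanOf-minimal w (Span-submodule (Pair β γ))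
                  (proj₂ ∘ F⁻) j∈span) }) ,
              (λ j∈F → proj₁ (F⁻ j∈F) , ∈-SpanOf w j∈F)
          ... | yes (δ , δ∈F , δ∉Π) = new (∈-subset⁻ (λ j → (j ∈? upTo Π i) ×-dec span? j) δ∈F)
            where
            new : ¬ (δ ∈ upTo Π i × Span (Pair β γ) (w δ))
            new (δ∈A , c , p) with initial-new δ∈A
            ... | inj₁ δ∈Π = δ∉Π δ∈Π
            ... | inj₂ δ∈U with c (suc zero) ≟0
            -- Here `δ` is a multiple of `β`, hence `β` itself, which lies in the block.
            ... | yes c₁≈0 = δ∉Π (subst (_∈ Π i) (≡.sym (nonparallel δ∈𝒜 (within i β∈Π) (c zero) δ≈)) β∈Π)
              where
              δ∈𝒜 : δ ∈ 𝒜
              δ∈𝒜 = let _ , _ , δ∈Π = ∈-upTo⁻ {Π = Π} {i} δ∈A in within _ δ∈Π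
              δ≈ : w δ ≈ᴹ c zero *ₗ w β
              δ≈ = ≈ᴹ-trans (≈ᴹ-sym p) (≈ᴹ-trans
                  (+ᴹ-congˡ (≈ᴹ-trans (+ᴹ-identityʳ _) (≈ᴹ-trans (*ₗ-congʳ c₁≈0) (*ₗ-zeroˡ (w γ)))))
                  (+ᴹ-identityʳ _))
            -- Solve the relation for `γ`: both `δ` and `β` are in the span of the earlier blocks.
            ... | no c₁≉0 = ¬h λ _ → divide sub c₁≉0 (cancelˡ sub
                    (IsSubmodule.resp sub (≈ᴹ-trans (≈ᴹ-sym p) (+ᴹ-congˡ (+ᴹ-identityʳ _))) (∈-SpanOf w δ∈U))
                    (IsSubmodule.mul sub (c zero) β∈span))

      initial-closed : ∀ {m j} → j ∈ 𝒜 → SpanOf w (initial m) (w j) → j ∈ initial m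
      initial-closed {m} j∈𝒜 j∈span with covers j∈𝒜
      ... | i , j∈Π with toℕ i ℕ.<? m
      ... | yes i<m = ∈-subset⁺ (initial? m) (i , i<m , j∈Π)
      ... | no i≮m  = ⊥-elim (new-not-in-span j∈Π (SpanOf-mono (initial-mono (ℕ.≮⇒≥ i≮m)) j∈span))

      -- Otherwise `β` and `γ` would both be in the block added at this stage, and the set of these
      -- two elements would be a 2-flat inside it.
      pair-flat-meets : ∀ {m β γ} → β ∈ initial (suc m) → γ ∈ initial (suc m) → β ≢ γ →
                        (∀ {j} → j ∈ 𝒜 → Span (Pair β γ) (w j) → j ≡ β ⊎ j ≡ γ) →
                        β ∈ initial m ⊎ γ ∈ initial m
      pair-flat-meets {m} {β} {γ} β∈ γ∈ β≢γ only with β ∈? initial m | γ ∈? initial m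
      ... | yes p | _     = inj₁ p
      ... | no _  | yes q = inj₂ q
      ... | no ¬p | no ¬q = ⊥-elim contra
        where
        new : ∀ {j} → j ∈ initial (suc m) → j ∉ initial m → ∃[ i ] toℕ i ≡ m × j ∈ Π i
        new j∈ j∉ with ∈-subset⁻ (initial? (suc m)) j∈
        ... | i , i<1+m , j∈Π with toℕ i ℕ.<? m
        ... | yes i<m = ⊥-elim (j∉ (∈-subset⁺ (initial? m) (i , i<m , j∈Π)))
        ... | no i≮m  = i , ℕ.≤-antisym (ℕ.≤-pred i<1+m) (ℕ.≮⇒≥ i≮m) , j∈Π
        contra : ⊥
        contra with new β∈ ¬p | new γ∈ ¬q
        ... | i , refl , β∈Π | i′ , eq , γ∈Π′ = proj₂ (cond i) F flat
                  (rank-pair (pair-independent (within i β∈Π) (within i γ∈Π) β≢γ) β∈F γ∈F in-span)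
                  (λ j∈F → case F⁻ j∈F of λ { (inj₁ refl) → β∈Π ; (inj₂ refl) → γ∈Π })
          where
          γ∈Π : γ ∈ Π i
          γ∈Π = subst (λ l → γ ∈ Π l) (toℕ-injective eq) γ∈Π′
          open import Relation.Nullary.Decidable using (_⊎-dec_)
          F? = λ j → (j ≟ β) ⊎-dec (j ≟ γ)
          F = subset F?
          F⁻ : ∀ {j} → j ∈ F → j ≡ β ⊎ j ≡ γ
          F⁻ = ∈-subset⁻ F?
          β∈F : β ∈ F
          β∈F = ∈-subset⁺ F? (inj₁ refl)
          γ∈F : γ ∈ F
          γ∈F = ∈-subset⁺ F? (inj₂ refl)
          in-span : ∀ {j} → j ∈ F → Span (Pair β γ) (w j)
          in-span j∈F with F⁻ j∈F
          ... | inj₁ refl = ∈-Span (Pair β γ) zero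
          ... | inj₂ refl = ∈-Span (Pair β γ) (suc zero)
          F⊆ : F ⊆ upTo Π i
          F⊆ j∈F with F⁻ j∈F
          ... | inj₁ refl = ∈-upTo⁺ {Π = Π} i ℕ.≤-refl β∈Π
          ... | inj₂ refl = ∈-upTo⁺ {Π = Π} i ℕ.≤-refl γ∈Π
          flat : IsFlat (upTo Π i) F
          flat = F⊆ , (λ { (j∈A , j∈span) → ∈-subset⁺ F? (only (let _ , _ , j∈Π = ∈-upTo⁻ {Π = Π} {i} j∈A in within _ j∈Π)
                             (SpanOf-minimal w (Span-submodule (Pair β γ)) in-span j∈span)) }) ,
                 (λ j∈F → F⊆ j∈F , ∈-SpanOf w j∈F)

-- The integers inside an ordered field

module FieldProperties {k ℓ₁ ℓ₂} (K : OrderedField k ℓ₁ ℓ₂) where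

  open IntegralVectors
  open import Data.Integer.Base as ℤ using (ℤ; -[1+_]; 0ℤ; 1ℤ; +≤+) renaming (+_ to pos)
  open import Relation.Binary.PropositionalEquality as ≡ using (_≡_; refl)
  open import Relation.Binary.Definitions using (tri<; tri≈; tri>)
  open import Relation.Binary.Structures using (IsStrictTotalOrder)
  open OrderedField K hiding (zero) renaming (refl to ≈-refl)
  open IsStrictTotalOrder isStrictTotalOrder public
    using (compare; irrefl; <-resp-≈; <-respʳ-≈; <-respˡ-≈) renaming (trans to <-trans; _≟_ to _≟ᴷ_)
  open FromInteger ring
  open import Algebra.Properties.Semiring.Mult semiring using (×-homo-+; ×1-homo-*) renaming (_×_ to _×ᴿ_)
  open import Algebra.Properties.Ring ring
    using (-‿distribˡ-*; -‿distribʳ-*; -‿involutive; -0#≈0#; -‿+-comm)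
  open import Algebra.Properties.Semiring.Sum semiring public
    using () renaming (sum to sumᴷ; sum-cong-≋ to sumᴷ-cong; ∑-distrib-+ to sumᴷ-distrib-+; *-distribʳ-sum to
        *-distribʳ-sumᴷ; *-distribˡ-sum to *-distribˡ-sumᴷ)
  open import Relation.Binary.Reasoning.Setoid setoid

  fromℤ-⊖ : ∀ m n → fromℤ (m ℤ.⊖ n) ≈ m ×ᴿ 1# - n ×ᴿ 1#
  fromℤ-⊖ m zero = sym (trans (+-congˡ -0#≈0#) (+-identityʳ _))
  fromℤ-⊖ zero (suc n) = sym (+-identityˡ _)
  fromℤ-⊖ (suc m) (suc n) = begin
    fromℤ (suc m ℤ.⊖ suc n)                   ≡⟨ ≡.cong fromℤ (ℤ.[1+m]⊖[1+n]≡m⊖n m n) ⟩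
    fromℤ (m ℤ.⊖ n)                           ≈⟨ fromℤ-⊖ m n ⟩
    a - b
        ≈⟨ +-congʳ (trans (sym (+-identityʳ a)) (+-congˡ (sym (-‿inverseʳ 1#)))) ⟩
    a + (1# - 1#) - b
        ≈⟨ +-congʳ (trans (sym (+-assoc a 1# (- 1#))) (+-congʳ (+-comm a 1#))) ⟩
    1# + a - 1# - b                           ≈⟨ +-assoc (1# + a) (- 1#) (- b) ⟩
    1# + a + (- 1# - b)                       ≈⟨ +-congˡ (-‿+-comm 1# b) ⟩
    1# + a - (1# + b)                         ∎
    where
    a = m ×ᴿ 1#
    b = n ×ᴿ 1#

  fromℤ-+ : ∀ x y → fromℤ (x ℤ.+ y) ≈ fromℤ x + fromℤ y
  fromℤ-+ (pos m)  (pos n)  = ×-homo-+ 1# m n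
  fromℤ-+ (pos m)  -[1+ n ] = fromℤ-⊖ m (suc n)
  fromℤ-+ -[1+ m ] (pos n)  = trans (fromℤ-⊖ n (suc m)) (+-comm _ _)
  fromℤ-+ -[1+ m ] -[1+ n ] =
      trans (-‿cong (trans (reflexive (≡.cong (_×ᴿ 1#) (≡.cong suc (≡.sym (ℕ.+-suc m n)))))
      (×-homo-+ 1# (suc m) (suc n))))
                                    (sym (-‿+-comm _ _))

  fromℤ-neg : ∀ x → fromℤ (ℤ.- x) ≈ - fromℤ x
  fromℤ-neg (pos zero)    = sym -0#≈0#
  fromℤ-neg (pos (suc n)) = ≈-refl
  fromℤ-neg -[1+ n ]      = sym (-‿involutive _)

  fromℤ-* : ∀ x y → fromℤ (x ℤ.* y) ≈ fromℤ x * fromℤ y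
  fromℤ-* (pos m) y = nonneg y
    where
    nonneg : ∀ y → fromℤ (pos m ℤ.* y) ≈ fromℤ (pos m) * fromℤ y
    nonneg (pos n)  = trans (reflexive (≡.cong fromℤ (≡.sym (ℤ.pos-* m n)))) (×1-homo-* m n)
    nonneg -[1+ n ] = begin
      fromℤ (pos m ℤ.* -[1+ n ])             ≡⟨ ≡.cong fromℤ (ℤ.neg-distribʳ-* (pos m) (pos (suc n))) ⟨
      fromℤ (ℤ.- (pos m ℤ.* pos (suc n)))    ≈⟨ fromℤ-neg (pos m ℤ.* pos (suc n)) ⟩
      - fromℤ (pos m ℤ.* pos (suc n))        ≈⟨ -‿cong (nonneg (pos (suc n))) ⟩
      - (fromℤ (pos m) * fromℤ (pos (suc n))) ≈⟨ -‿distribʳ-* _ _ ⟩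
      fromℤ (pos m) * - fromℤ (pos (suc n))  ∎
  fromℤ-* -[1+ m ] y = begin
    fromℤ (-[1+ m ] ℤ.* y)               ≡⟨ ≡.cong fromℤ (ℤ.neg-distribˡ-* (pos (suc m)) y) ⟨
    fromℤ (ℤ.- (pos (suc m) ℤ.* y))      ≈⟨ fromℤ-neg (pos (suc m) ℤ.* y) ⟩
    - fromℤ (pos (suc m) ℤ.* y)          ≈⟨ -‿cong (fromℤ-* (pos (suc m)) y) ⟩
    - (fromℤ (pos (suc m)) * fromℤ y)    ≈⟨ -‿distribˡ-* _ _ ⟩
    - fromℤ (pos (suc m)) * fromℤ y      ∎

  fromℤ-1 : fromℤ 1ℤ ≈ 1#
  fromℤ-1 = +-identityʳ 1#

  fromℤ-sum : ∀ {n} (f : Fin n → ℤ) → fromℤ (sum f) ≈ sumᴷ (λ i → fromℤ (f i))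
  fromℤ-sum {zero}  f = ≈-refl
  fromℤ-sum {suc n} f = trans (fromℤ-+ (f zero) _) (+-congˡ (fromℤ-sum (f ∘ suc)))

  negative⇒ : ∀ {x} → x < 0# → 0# < - x
  negative⇒ {x} x<0 = <-respʳ-≈ (+-identityˡ (- x)) (<-respˡ-≈ (-‿inverseʳ x) (+-monoˡ-< (- x) x<0))

  0<1 : 0# < 1#
  0<1 with compare 0# 1#
  ... | tri< p _ _ = p
  ... | tri≈ _ p _ = ⊥-elim (0≉1 p)
  ... | tri> _ _ p = <-respʳ-≈
      (trans (sym (-‿distribˡ-* 1# (- 1#))) (trans (-‿cong (*-identityˡ (- 1#))) (-‿involutive 1#)))
                       (*-positive (negative⇒ p) (negative⇒ p))

  0<+ : ∀ {x y} → 0# < x → 0# < y → 0# < x + y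
  0<+ {x} {y} p q = <-trans q (<-respˡ-≈ (+-identityˡ y) (+-monoˡ-< y p))

  0<1+n : ∀ n → 0# < suc n ×ᴿ 1#
  0<1+n zero    = <-respʳ-≈ (sym fromℤ-1) 0<1
  0<1+n (suc n) = 0<+ 0<1 (0<1+n n)

  <⇒≉ : ∀ {x y} → x < y → ¬ (x ≈ y)
  <⇒≉ p q = irrefl q p

  fromℤ-positive : ∀ {x} → 0# < fromℤ x → 1ℤ ℤ.≤ x
  fromℤ-positive {pos zero}    p = ⊥-elim (<⇒≉ p (≈-refl))
  fromℤ-positive {pos (suc n)} p = +≤+ (s≤s z≤n)
  fromℤ-positive { -[1+ n ]}   p = ⊥-elim (<⇒≉ (<-respʳ-≈ (-‿inverseˡ _) (0<+ p (0<1+n n))) (≈-refl))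

  fromℤ-zero : ∀ {x} → fromℤ x ≈ 0# → x ≡ 0ℤ
  fromℤ-zero {pos zero}    p = refl
  fromℤ-zero {pos (suc n)} p = ⊥-elim (<⇒≉ (0<1+n n) (sym p))
  fromℤ-zero { -[1+ n ]}   p =
      ⊥-elim (<⇒≉ (0<1+n n) (sym (trans (sym (-‿involutive _)) (trans (-‿cong p) -0#≈0#))))

  fromℤ-injective : ∀ {x y} → fromℤ x ≈ fromℤ y → x ≡ y
  fromℤ-injective {x} {y} p = ℤ.i-j≡0⇒i≡j x y (fromℤ-zero (trans (fromℤ-+ x (ℤ.- y))
    (trans (+-cong p (fromℤ-neg y)) (-‿inverseʳ (fromℤ y)))))

  *-cancelʳ : ∀ {x y z} → ¬ (z ≈ 0#) → x * z ≈ y * z → x ≈ y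
  *-cancelʳ {x} {y} {z} z≉0 p with inverse z z≉0
  ... | t , zt≈1 = trans (undo x) (trans (*-congʳ p) (sym (undo y)))
    where
    undo : ∀ u → u ≈ u * z * t
    undo u = sym (trans (*-assoc u z t) (trans (*-congˡ zt≈1) (*-identityʳ u)))

  *-cancelʳ-positive : ∀ {x z} → 0# < z → 0# < x * z → 0# < x
  *-cancelʳ-positive {x} {z} 0<z 0<xz with compare 0# x
  ... | tri< p _ _ = p
  ... | tri≈ _ p _ = ⊥-elim (<⇒≉ 0<xz (sym (trans (*-congʳ (sym p)) (zeroˡ z))))
  ... | tri> _ _ p = ⊥-elim (<⇒≉ (<-respʳ-≈ (trans (+-congˡ (sym (-‿distribˡ-* x z))) (-‿inverseʳ (x * z)))
                       (0<+ 0<xz (*-positive (negative⇒ p) 0<z))) (≈-refl))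

-- Positive roots as integral vectors in the basis of simple roots

module RootData {k ℓ₁ ℓ₂ v ℓv} {K : OrderedField k ℓ₁ ℓ₂} {E : EuclideanSpace K v ℓv}
                (Φ : RootSystem E) (Δ : SimpleSystem Φ) where

  open IntegralVectors
  open PositiveRootSystems
  open import Data.Integer.Base as ℤ using (ℤ; -[1+_]; 0ℤ; 1ℤ; -1ℤ; +≤+) renaming (+_ to pos)
  open import Data.List.Base using (List; []; _∷_; allFin)
  open import Data.List.Membership.Propositional using (lose)
  open import Data.List.Membership.Propositional.Properties using (∈-allFin)
  open import Data.List.Relation.Unary.Any using (Any; here; there)
  open import Relation.Binary.PropositionalEquality as ≡ using (_≡_; _≢_; _≗_; refl; subst)
  private module K = OrderedField K
  open FieldProperties K
  open EuclideanSpace E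
  open LinearProperties K leftModule
  open RootSystem Φ
  open SimpleSystem Δ
  open FromInteger K.ring

  A : Fin rank → Fin rank → ℤ
  A i j = cartan (simple i) (simple j)

  open Form A

  S : Fin rank → Carrierᴹ
  S = root ∘ simple

  vec : Vector rank → Carrierᴹ
  vec x = linComb (fromℤ ∘ x) S

  vec-injective : ∀ {x y} → vec x ≈ᴹ vec y → x ≗ y
  vec-injective p i = fromℤ-injective (coordinates-unique independent p i)

  vec-⊕ : ∀ x y → vec (x ⊕ y) ≈ᴹ vec x +ᴹ vec y
  vec-⊕ x y = ≈ᴹ-trans (linComb-cong S λ i → fromℤ-+ (x i) (y i)) (linComb-+ (fromℤ ∘ x) (fromℤ ∘ y) S)

  vec-* : ∀ c x → vec (λ i → c ℤ.* x i) ≈ᴹ fromℤ c *ₗ vec x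
  vec-* c x = ≈ᴹ-trans (linComb-cong S λ i → fromℤ-* c (x i)) (linComb-* (fromℤ c) (fromℤ ∘ x) S)

  vec-e : ∀ i → vec (e i) ≈ᴹ S i
  vec-e i = ≈ᴹ-trans (linComb-cong S same) (linComb-δ i S)
    where
    same : ∀ j → fromℤ (e i j) K.≈ δ i j
    same j with i ≟ j
    ... | yes _ = fromℤ-1
    ... | no _  = K.refl

  vec-zero : vec (λ _ → 0ℤ) ≈ᴹ 0ᴹ
  vec-zero = linComb-zero S λ _ → K.refl

  coeff-≗ : ∀ {γ x} → root γ ≈ᴹ vec x → coeff γ ≗ x
  coeff-≗ {γ} p = vec-injective (≈ᴹ-trans (≈ᴹ-sym (expansion γ)) p)

  root≈vec : ∀ {γ x} → coeff γ ≗ x → root γ ≈ᴹ vec x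
  root≈vec {γ} p = ≈ᴹ-trans (expansion γ) (linComb-cong S λ i → K.reflexive (≡.cong fromℤ (p i)))

  coeff-injective : ∀ {γ γ′} → coeff γ ≗ coeff γ′ → γ ≡ γ′
  coeff-injective p = injective (≈ᴹ-trans (root≈vec p) (≈ᴹ-sym (expansion _)))

  coeff-simple : ∀ i → coeff (simple i) ≗ e i
  coeff-simple i = coeff-≗ (≈ᴹ-sym (vec-e i))

  ⟨0,⟩ : ∀ z → ⟨ 0ᴹ , z ⟩ K.≈ K.0#
  ⟨0,⟩ z = K.trans (⟨⟩-cong (≈ᴹ-sym (*ₗ-zeroˡ 0ᴹ)) ≈ᴹ-refl) (K.trans (⟨⟩-homogeneous K.0# 0ᴹ z) (K.zeroˡ _))

  ⟨linComb,⟩ : ∀ {n} (c : Fin n → K.Carrier) (w : Fin n → Carrierᴹ) z →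
               ⟨ linComb c w , z ⟩ K.≈ sumᴷ (λ i → c i K.* ⟨ w i , z ⟩)
  ⟨linComb,⟩ {zero}  c w z = ⟨0,⟩ z
  ⟨linComb,⟩ {suc n} c w z =
      K.trans (⟨⟩-additive _ _ z)
      (K.+-cong (⟨⟩-homogeneous (c zero) (w zero) z) (⟨linComb,⟩ (c ∘ suc) (w ∘ suc) z))

  d : Fin rank → K.Carrier
  d i = ⟨ S i , S i ⟩

  d-positive : ∀ i → K.0# K.< d i
  d-positive i = ⟨⟩-positive (S i) (nonzero (simple i))

  d≉0 : ∀ i → ¬ (d i K.≈ K.0#)
  d≉0 i p = <⇒≉ (d-positive i) (K.sym p)

  two : K.Carrier
  two = fromℤ (pos 2)

  -- The crystallographic identity, extended linearly from simple roots. It is the bridge between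
  -- the integral form and the Euclidean one.
  pairing : ∀ x i → fromℤ (x ∙ i) K.* d i K.≈ two K.* ⟨ vec x , S i ⟩
  pairing x i = begin
    fromℤ (x ∙ i) K.* d i
        ≡⟨ ≡.cong (λ z → fromℤ z K.* d i) (∙-def x i) ⟩
    fromℤ (sum (λ l → x l ℤ.* A l i)) K.* d i
        ≈⟨ K.*-congʳ (fromℤ-sum (λ l → x l ℤ.* A l i)) ⟩
    sumᴷ (λ l → fromℤ (x l ℤ.* A l i)) K.* d i
        ≈⟨ *-distribʳ-sumᴷ (d i) (λ l → fromℤ (x l ℤ.* A l i)) ⟩
    sumᴷ (λ l → fromℤ (x l ℤ.* A l i) K.* d i)                          ≈⟨ sumᴷ-cong {rank} term ⟩
    sumᴷ (λ l → two K.* (fromℤ (x l) K.* ⟨ S l , S i ⟩))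
        ≈⟨ *-distribˡ-sumᴷ two (λ l → fromℤ (x l) K.* ⟨ S l , S i ⟩) ⟨
    two K.* sumᴷ (λ l → fromℤ (x l) K.* ⟨ S l , S i ⟩)
        ≈⟨ K.*-congˡ (⟨linComb,⟩ (fromℤ ∘ x) S (S i)) ⟨
    two K.* ⟨ vec x , S i ⟩                                             ∎
    where
    open import Relation.Binary.Reasoning.Setoid K.setoid
    term : ∀ l → fromℤ (x l ℤ.* A l i) K.* d i K.≈ two K.* (fromℤ (x l) K.* ⟨ S l , S i ⟩)
    term l = begin
      fromℤ (x l ℤ.* A l i) K.* d i                      ≈⟨ K.*-congʳ (fromℤ-* (x l) (A l i)) ⟩
      fromℤ (x l) K.* fromℤ (A l i) K.* d i              ≈⟨ K.*-assoc _ _ _ ⟩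
      fromℤ (x l) K.* (fromℤ (A l i) K.* d i)            ≈⟨ K.*-congˡ (crystallographic (simple l) (simple i)) ⟩
      fromℤ (x l) K.* (two K.* ⟨ S l , S i ⟩)            ≈⟨ K.*-assoc _ _ _ ⟨
      fromℤ (x l) K.* two K.* ⟨ S l , S i ⟩              ≈⟨ K.*-congʳ (K.*-comm _ _) ⟩
      two K.* fromℤ (x l) K.* ⟨ S l , S i ⟩              ≈⟨ K.*-assoc _ _ _ ⟩
      two K.* (fromℤ (x l) K.* ⟨ S l , S i ⟩)            ∎

  cartan≡∙ : ∀ γ i → cartan γ (simple i) ≡ coeff γ ∙ i
  cartan≡∙ γ i = fromℤ-injective (*-cancelʳ (d≉0 i) (K.trans (crystallographic γ (simple i))
    (K.trans (K.*-congˡ (⟨⟩-cong (expansion γ) ≈ᴹ-refl)) (K.sym (pairing (coeff γ) i)))))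

  reflect : ∀ γ i → ∃[ γ′ ] coeff γ′ ≗ coeff γ ⊖ (λ l → coeff γ ∙ i ℤ.* e i l)
  reflect γ i with reflection (simple i) γ
  ... | γ′ , p = γ′ , coeff-≗ (≈ᴹ-trans p (≈ᴹ-trans step (linComb-cong S same)))
    where
    c = coeff γ ∙ i
    x = λ l → ℤ.- c ℤ.* e i l
    same : ∀ l → fromℤ ((coeff γ ⊕ x) l) K.≈ fromℤ ((coeff γ ⊖ (λ l → c ℤ.* e i l)) l)
    same l = K.reflexive (≡.cong (λ z → fromℤ (coeff γ l ℤ.+ z)) (≡.sym (ℤ.neg-distribˡ-* c (e i l))))
    step : root γ +ᴹ -ᴹ (fromℤ (cartan γ (simple i)) *ₗ S i) ≈ᴹ vec (coeff γ ⊕ x)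
    step = ≈ᴹ-sym (≈ᴹ-trans (vec-⊕ (coeff γ) x) (+ᴹ-cong (≈ᴹ-sym (expansion γ))
      (≈ᴹ-trans (vec-* (ℤ.- c) (e i))
          (≈ᴹ-trans (*ₗ-cong (fromℤ-neg c) (vec-e i)) (≈ᴹ-trans (-ᴹ-*ₗ (fromℤ c) (S i))
        (-ᴹ‿cong (*ₗ-congʳ (K.reflexive (≡.cong fromℤ (≡.sym (cartan≡∙ γ i)))))))))))

  A-diag : ∀ i → A i i ≡ 2ℤ
  A-diag i = fromℤ-injective (*-cancelʳ (d≉0 i) (crystallographic (simple i) (simple i)))

  A-swap : ∀ i j → fromℤ (A i j) K.* d j K.≈ fromℤ (A j i) K.* d i
  A-swap i j = K.trans (crystallographic (simple i) (simple j)) (K.trans (K.*-congˡ (⟨⟩-sym (S i) (S j)))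
    (K.sym (crystallographic (simple j) (simple i))))

  A-zero : ∀ {i j} → A i j ≡ 0ℤ → A j i ≡ 0ℤ
  A-zero {i} {j} p = fromℤ-zero (*-cancelʳ (d≉0 i) (K.trans (K.sym (A-swap i j))
    (K.trans (K.*-congʳ (K.reflexive (≡.cong fromℤ p))) (K.trans (K.zeroˡ (d j)) (K.sym (K.zeroˡ (d i)))))))

  -- The reflection of simple root `i` in simple root `j` has coefficient 1 at `i` and `- A i j` at
  -- `j`, and the two cannot have opposite signs.
  A-nonpositive : ∀ {i j} → i ≢ j → A i j ℤ.≤ 0ℤ
  A-nonpositive {i} {j} i≢j with reflect (simple i) j
  ... | γ , p with sameSign γ
  ... | inj₂ ≤0 = ⊥-elim (1≰0
      (subst (ℤ._≤ 0ℤ) (≡.trans (p i) (≡.cong₂ (λ a b → a ℤ.- coeff (simple i) ∙ j ℤ.* b)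
                    (≡.trans (coeff-simple i i) (e-same i)) (e-diff (i≢j ∘ ≡.sym))) ⟨≡⟩ eq
                        (coeff (simple i) ∙ j)) (≤0 i)))
    where
    infixl 4 _⟨≡⟩_
    _⟨≡⟩_ = ≡.trans {A = ℤ}
    eq : ∀ c → 1ℤ ℤ.- c ℤ.* 0ℤ ≡ 1ℤ
    eq = solve-∀
  ... | inj₁ ≥0 = lin₁ (subst (0ℤ ℤ.≤_) (≡.trans (p j) (≡.cong₂ (λ a b → a ℤ.- coeff (simple i) ∙ j ℤ.* b)
                    (≡.trans (coeff-simple i j) (e-diff i≢j)) (e-same j))) (≥0 j))
                    (≡.trans (eq (A i j)) (≡.cong (λ c → 0ℤ ℤ.- c ℤ.* 1ℤ ℤ.- 0ℤ) (cartan≡∙ (simple i) j)))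
    where
    eq : ∀ c → 0ℤ ℤ.- c ≡ 0ℤ ℤ.- c ℤ.* 1ℤ ℤ.- 0ℤ
    eq = solve-∀

  module _ (laced : SimplyLaced) where

    A-off : ∀ {i j} → i ≢ j → A i j ≡ 0ℤ × A j i ≡ 0ℤ ⊎ A i j ≡ -1ℤ × A j i ≡ -1ℤ
    A-off {i} {j} i≢j = cases (A i j) (A j i) refl refl (A-nonpositive i≢j) (A-nonpositive (i≢j ∘ ≡.sym))
        (laced i j i≢j)
      where
      cases : ∀ a b → A i j ≡ a → A j i ≡ b → a ℤ.≤ 0ℤ → b ℤ.≤ 0ℤ → A i j ℤ.* A j i ℤ.≤ 1ℤ →
              A i j ≡ 0ℤ × A j i ≡ 0ℤ ⊎ A i j ≡ -1ℤ × A j i ≡ -1ℤ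
      cases (pos zero) b p q _ _ _ = inj₁ (p , A-zero p)
      cases (pos (suc _)) b p q (+≤+ ()) _ _
      cases -[1+ m ] (pos zero) p q _ _ _ = inj₁ (A-zero q , q)
      cases -[1+ m ] (pos (suc _)) p q _ (+≤+ ()) _
      cases -[1+ m ] -[1+ n ] p q _ _ le with subst (ℤ._≤ 1ℤ) (≡.cong₂ ℤ._*_ p q) le
      cases -[1+ zero ] -[1+ zero ]  p q _ _ le | _ = inj₂ (p , q)
      cases -[1+ zero ] -[1+ suc n ] p q _ _ le | +≤+ (s≤s ())
      cases -[1+ suc m ] -[1+ n ]    p q _ _ le | +≤+ (s≤s le′) = ⊥-elim (absurd n le′)
        where
        absurd : ∀ n → ¬ (n ℕ.+ suc (n ℕ.+ m ℕ.* suc n) ℕ.≤ 0)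
        absurd zero    ()
        absurd (suc n) ()

    A-sym : ∀ i j → A i j ≡ A j i
    A-sym i j with i ≟ j
    ... | yes refl = refl
    ... | no i≢j with A-off i≢j
    ... | inj₁ (p , q) = ≡.trans p (≡.sym q)
    ... | inj₂ (p , q) = ≡.trans p (≡.sym q)

    open Symmetric A-sym

    -- If `A i j` and `A j i` were both -1, `A-swap` would identify the two squared lengths.
    d-equal : ∀ {i j} → ¬ (d i K.≈ d j) → A i j ≡ 0ℤ
    d-equal {i} {j} di≉dj with i ≟ j
    ... | yes refl = ⊥-elim (di≉dj K.refl)
    ... | no i≢j with A-off i≢j
    ... | inj₁ (p , _) = p
    ... | inj₂ (p , q) = ⊥-elim
        (di≉dj (K.sym (*-cancelʳ minus-one≉0 (K.trans (K.*-comm _ _) (K.trans swap (K.*-comm _ _))))))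
      where
      minus-one = fromℤ -1ℤ
      minus-one≉0 : ¬ (minus-one K.≈ K.0#)
      minus-one≉0 z = case fromℤ-zero { -1ℤ} z of λ ()
      swap : minus-one K.* d j K.≈ minus-one K.* d i
      swap = subst (λ a → fromℤ a K.* d j K.≈ minus-one K.* d i) p
          (subst (λ a → fromℤ (A i j) K.* d j K.≈ fromℤ a K.* d i) q (A-swap i j))

    Definite : Vector rank → Set
    Definite x = (∀ i → x i ≡ 0ℤ) ⊎ 1ℤ ℤ.≤ ⟪ x , x ⟫

    -- On vectors supported by simple roots of one squared length `D`, the form of `A` is
    -- proportional to the Euclidean one: `2 ⟨ vec x , vec x ⟩` is `⟪ x , x ⟫` times `D`.
    -- Integrality turns positive into at least 1.
    definite-class : ∀ {D} → K.0# K.< D → ∀ x → (∀ i → x i ≡ 0ℤ ⊎ d i K.≈ D) → Definite x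
    definite-class {D} 0<D x supp with all? (λ i → x i ℤ.≟ 0ℤ)
    ... | yes x≡0 = inj₁ x≡0
    ... | no x≢0 = inj₂ (fromℤ-positive (*-cancelʳ-positive 0<D (<-respʳ-≈ norm
                       (K.*-positive (0<1+n 1) (⟨⟩-positive (vec x) λ p → x≢0
                           (vec-injective (≈ᴹ-trans p (≈ᴹ-sym vec-zero))))))))
      where
      open import Relation.Binary.Reasoning.Setoid K.setoid
      term : ∀ i → two K.* (fromℤ (x i) K.* ⟨ S i , vec x ⟩) K.≈ fromℤ (x ∙ i ℤ.* x i) K.* D
      term i = begin
        two K.* (fromℤ (x i) K.* ⟨ S i , vec x ⟩)      ≈⟨ K.*-assoc _ _ _ ⟨
        two K.* fromℤ (x i) K.* ⟨ S i , vec x ⟩        ≈⟨ K.*-cong (K.*-comm _ _) (⟨⟩-sym (S i) (vec x)) ⟩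
        fromℤ (x i) K.* two K.* ⟨ vec x , S i ⟩        ≈⟨ K.*-assoc _ _ _ ⟩
        fromℤ (x i) K.* (two K.* ⟨ vec x , S i ⟩)      ≈⟨ K.*-congˡ (pairing x i) ⟨
        fromℤ (x i) K.* (fromℤ (x ∙ i) K.* d i)        ≈⟨ K.*-assoc _ _ _ ⟨
        fromℤ (x i) K.* fromℤ (x ∙ i) K.* d i          ≈⟨ K.*-congʳ (K.*-comm _ _) ⟩
        fromℤ (x ∙ i) K.* fromℤ (x i) K.* d i          ≈⟨ K.*-congʳ (fromℤ-* (x ∙ i) (x i)) ⟨
        fromℤ (x ∙ i ℤ.* x i) K.* d i                  ≈⟨ replace (supp i) ⟩
        fromℤ (x ∙ i ℤ.* x i) K.* D                    ∎
        where
        replace : x i ≡ 0ℤ ⊎ d i K.≈ D → fromℤ (x ∙ i ℤ.* x i) K.* d i K.≈ fromℤ (x ∙ i ℤ.* x i) K.* D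
        replace (inj₂ p) = K.*-congˡ p
        replace (inj₁ p) = K.trans (vanish (d i)) (K.sym (vanish D))
          where
          vanish : ∀ z → fromℤ (x ∙ i ℤ.* x i) K.* z K.≈ K.0#
          vanish z = K.trans (K.*-congʳ
              (K.reflexive (≡.cong fromℤ (≡.trans (≡.cong (x ∙ i ℤ.*_) p) (ℤ.*-zeroʳ (x ∙ i)))))) (K.zeroˡ z)
      norm : two K.* ⟨ vec x , vec x ⟩ K.≈ fromℤ ⟪ x , x ⟫ K.* D
      norm = begin
        two K.* ⟨ vec x , vec x ⟩                              ≈⟨ K.*-congˡ (⟨linComb,⟩ (fromℤ ∘ x) S (vec x)) ⟩
        two K.* sumᴷ (λ i → fromℤ (x i) K.* ⟨ S i , vec x ⟩)
            ≈⟨ *-distribˡ-sumᴷ two (λ i → fromℤ (x i) K.* ⟨ S i , vec x ⟩) ⟩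
        sumᴷ (λ i → two K.* (fromℤ (x i) K.* ⟨ S i , vec x ⟩)) ≈⟨ sumᴷ-cong {rank} term ⟩
        sumᴷ (λ i → fromℤ (x ∙ i ℤ.* x i) K.* D)
            ≈⟨ *-distribʳ-sumᴷ D (λ i → fromℤ (x ∙ i ℤ.* x i)) ⟨
        sumᴷ (λ i → fromℤ (x ∙ i ℤ.* x i)) K.* D               ≈⟨ K.*-congʳ (fromℤ-sum (λ i → x ∙ i ℤ.* x i)) ⟨
        fromℤ (sum (λ i → x ∙ i ℤ.* x i)) K.* D                ≡⟨ ≡.cong (λ z → fromℤ z K.* D) (⟪⟫-def x x) ⟨
        fromℤ ⟪ x , x ⟫ K.* D                                  ∎

    -- The components of the Dynkin diagram may carry different root lengths, so the
    -- form of A is compared with ⟨_,_⟩ one length at a time.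
    definite-classes : ∀ (L : List (Fin rank)) x → (∀ i → x i ≡ 0ℤ ⊎ Any (λ l → d l K.≈ d i) L) → Definite x
    definite-classes [] x supp = inj₁ λ i → case supp i of λ { (inj₁ p) → p ; (inj₂ ()) }
    definite-classes (l ∷ L) x supp = combine (definite-class (d-positive l) y y-supp)
        (definite-classes L z z-supp)
      where
      y z : Vector rank
      y i with d l ≟ᴷ d i
      ... | yes _ = x i
      ... | no _  = 0ℤ
      z = x ⊖ y
      y-supp : ∀ i → y i ≡ 0ℤ ⊎ d i K.≈ d l
      y-supp i with d l ≟ᴷ d i
      ... | yes p = inj₂ (K.sym p)
      ... | no _  = inj₁ refl
      z-zero : ∀ i → z i ≡ 0ℤ ⊎ ¬ (d l K.≈ d i)
      z-zero i with d l ≟ᴷ d i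
      ... | yes p = inj₁ (ℤ.+-inverseʳ (x i))
      ... | no ¬p = inj₂ ¬p
      z-supp : ∀ i → z i ≡ 0ℤ ⊎ Any (λ l → d l K.≈ d i) L
      z-supp i with z-zero i
      ... | inj₁ p = inj₁ p
      ... | inj₂ ¬p with supp i
      ... | inj₂ (here p)  = ⊥-elim (¬p p)
      ... | inj₂ (there p) = inj₂ p
      ... | inj₁ p = inj₁ zi
        where
        zi : z i ≡ 0ℤ
        zi with d l ≟ᴷ d i
        ... | yes q = ⊥-elim (¬p q)
        ... | no _  = ≡.cong (ℤ._- 0ℤ) p
      -- The simple roots supporting `y` have the length of `l` and those supporting `z` do not, so
      -- by `d-equal` no two of them are joined.
      orthogonal : ⟪ y , z ⟫ ≡ 0ℤ
      orthogonal = ≡.trans (⟪⟫-def y z) (sum-zero term)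
        where
        term : ∀ i → y ∙ i ℤ.* z i ≡ 0ℤ
        term i with z-zero i
        ... | inj₁ p = ≡.trans (≡.cong (y ∙ i ℤ.*_) p) (ℤ.*-zeroʳ (y ∙ i))
        ... | inj₂ ¬p = ≡.cong (ℤ._* z i) (≡.trans (∙-def y i) (sum-zero λ m → entry m (y-supp m)))
          where
          entry : ∀ m → y m ≡ 0ℤ ⊎ d m K.≈ d l → y m ℤ.* A m i ≡ 0ℤ
          entry m (inj₁ q) = ≡.cong (ℤ._* A m i) q
          entry m (inj₂ q) = ≡.trans (≡.cong (y m ℤ.*_) (d-equal λ q′ → ¬p (K.trans (K.sym q) q′)))
              (ℤ.*-zeroʳ (y m))
      x≗y⊕z : x ≗ y ⊕ z
      x≗y⊕z i = eq (x i) (y i)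
        where
        eq : ∀ a b → a ≡ b ℤ.+ (a ℤ.- b)
        eq = solve-∀
      norm : ⟪ x , x ⟫ ≡ ⟪ y , y ⟫ ℤ.+ ⟪ z , z ⟫
      norm = ≡.trans (⟪⟫-cong x≗y⊕z x≗y⊕z) (≡.trans (norm-⊕ y z)
        (≡.trans (≡.cong (λ b → ⟪ y , y ⟫ ℤ.+ (b ℤ.+ b) ℤ.+ ⟪ z , z ⟫) orthogonal)
            (≡.cong (ℤ._+ ⟪ z , z ⟫) (ℤ.+-identityʳ ⟪ y , y ⟫))))
      norm-zero : ∀ {u} → (∀ i → u i ≡ 0ℤ) → 0ℤ ≡ ⟪ u , u ⟫
      norm-zero {u} h = ≡.sym (≡.trans (⟪⟫-def u u) (sum-zero λ i → ≡.trans (≡.cong (u ∙ i ℤ.*_) (h i))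
          (ℤ.*-zeroʳ (u ∙ i))))
      combine : Definite y → Definite z → Definite x
      combine (inj₁ y≡0) (inj₁ z≡0) = inj₁ λ i → ≡.trans (x≗y⊕z i) (≡.cong₂ ℤ._+_ (y≡0 i) (z≡0 i))
      combine (inj₁ y≡0) (inj₂ 1≤z) =
          inj₂ (subst (1ℤ ℤ.≤_) (≡.sym norm) (ℤ.+-mono-≤ (ℤ.≤-reflexive (norm-zero y≡0)) 1≤z))
      combine (inj₂ 1≤y) (inj₁ z≡0) =
          inj₂ (subst (1ℤ ℤ.≤_) (≡.sym norm) (ℤ.+-mono-≤ 1≤y (ℤ.≤-reflexive (norm-zero z≡0))))
      combine (inj₂ 1≤y) (inj₂ 1≤z) =
          inj₂ (subst (1ℤ ℤ.≤_) (≡.sym norm) (ℤ.≤-trans (+≤+ (s≤s z≤n)) (ℤ.+-mono-≤ 1≤y 1≤z)))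

    definite : ∀ x → Definite x
    definite x = definite-classes (allFin rank) x λ i → inj₂ (lose (∈-allFin i) K.refl)

    posdef : ∀ x → ⟪ x , x ⟫ ℤ.≤ 0ℤ → ∀ i → x i ≡ 0ℤ
    posdef x le with definite x
    ... | inj₁ p = p
    ... | inj₂ p = ⊥-elim (1≰0 (ℤ.≤-trans p le))

    ⟪,*e⟫ : ∀ x c i → ⟪ x , (λ l → c ℤ.* e i l) ⟫ ≡ x ∙ i ℤ.* c
    ⟪,*e⟫ x c i = ≡.trans (⟪⟫-def x (λ l → c ℤ.* e i l))
      (≡.trans (sum-cong-≗ λ l → ≡.sym (ℤ.*-assoc (x ∙ l) c (e i l))) (sum-e (λ l → x ∙ l ℤ.* c) i))

    reflect-norm : ∀ x i → let x′ = x ⊖ (λ l → x ∙ i ℤ.* e i l) in ⟪ x′ , x′ ⟫ ≡ ⟪ x , x ⟫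
    reflect-norm x i = ≡.trans (norm-⊖ x y) (≡.trans
      (≡.cong₂ (λ b n → ⟪ x , x ⟫ ℤ.- (b ℤ.+ b) ℤ.+ n) (⟪,*e⟫ x c i)
          (≡.trans (⟪,*e⟫ y c i) (≡.cong (ℤ._* c) y∙i)))
      (eq ⟪ x , x ⟫ c))
      where
      c = x ∙ i
      y = λ l → c ℤ.* e i l
      y∙i : y ∙ i ≡ 2ℤ ℤ.* c
      y∙i = ≡.trans (≡.sym (⟪⟫-e y i)) (≡.trans (⟪⟫-sym y (e i)) (≡.trans (⟪,*e⟫ (e i) c i)
        (≡.cong (ℤ._* c) (≡.trans (e∙ i i) (A-diag i)))))
      eq : ∀ n c → n ℤ.- (c ℤ.* c ℤ.+ c ℤ.* c) ℤ.+ pos 2 ℤ.* c ℤ.* c ≡ n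
      eq = solve-∀

    Root : Vector rank → Set
    Root x = (∃[ γ ] coeff γ ≗ x) × (∀ i → 0ℤ ℤ.≤ x i)

    coeff-nonzero : ∀ γ → ¬ (∀ i → coeff γ i ≡ 0ℤ)
    coeff-nonzero γ h = nonzero γ (≈ᴹ-trans (root≈vec h) vec-zero)

    -- Reducedness leaves only the simple root and its negative, and nonnegativity excludes the
    -- latter.
    multiple-of-simple : ∀ γ i → (∀ l → 0ℤ ℤ.≤ coeff γ l) → (∀ l → i ≢ l → coeff γ l ≡ 0ℤ) → coeff γ ≗ e i
    multiple-of-simple γ i ≥0 h = positive (reduced (simple i) γ (fromℤ m) γ≈)
      where
      m = coeff γ i
      γ≗ : coeff γ ≗ λ l → m ℤ.* e i l
      γ≗ l with i ≟ l
      ... | yes refl = ≡.sym (ℤ.*-identityʳ m)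
      ... | no i≢l   = ≡.trans (h l i≢l) (≡.sym (ℤ.*-zeroʳ m))
      γ≈ : root γ ≈ᴹ fromℤ m *ₗ S i
      γ≈ = ≈ᴹ-trans (root≈vec γ≗) (≈ᴹ-trans (vec-* m (e i)) (*ₗ-congˡ (vec-e i)))
      positive : root γ ≈ᴹ S i ⊎ root γ ≈ᴹ -ᴹ S i → coeff γ ≗ e i
      positive (inj₁ p) = coeff-≗ (≈ᴹ-trans p (≈ᴹ-sym (vec-e i)))
      positive (inj₂ p) = case subst (0ℤ ℤ.≤_) (≡.trans (coeff-≗ {γ} {λ l → -1ℤ ℤ.* e i l} γ≈-e i)
          (≡.cong (-1ℤ ℤ.*_) (e-same i))) (≥0 i) of λ ()
        where
        γ≈-e : root γ ≈ᴹ vec (λ l → -1ℤ ℤ.* e i l)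
        γ≈-e = ≈ᴹ-trans p (≈ᴹ-sym (≈ᴹ-trans (vec-* -1ℤ (e i)) (≈ᴹ-trans (*ₗ-cong (K.-‿cong fromℤ-1) (vec-e i))
          (≈ᴹ-trans (-ᴹ-*ₗ K.1# (S i)) (-ᴹ‿cong (*ₗ-identityˡ (S i)))))))

    norm-simple : ∀ i → ⟪ e i , e i ⟫ ≡ 2ℤ
    norm-simple i = ≡.trans (⟪⟫-e (e i) i) (≡.trans (e∙ i i) (A-diag i))

    private
      off-diagonal : ∀ (x : Vector rank) c i {l} → i ≢ l → (x ⊖ (λ l → c ℤ.* e i l)) l ≡ x l
      off-diagonal x c i {l} i≢l = ≡.trans (≡.cong (λ z → x l ℤ.- c ℤ.* z) (e-diff i≢l)) (eq (x l) c)
        where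
        eq : ∀ a c → a ℤ.- c ℤ.* 0ℤ ≡ a
        eq = solve-∀

    -- Reflecting in a simple root on which γ is positive lowers γ, so γ descends to a simple root.
    coeff-norm : ∀ γ → (∀ i → 0ℤ ℤ.≤ coeff γ i) → ⟪ coeff γ , coeff γ ⟫ ≡ 2ℤ
    coeff-norm γ γ≥0 = go _ γ γ≥0 (ℤ.≤-reflexive (≡.sym (ℤ.0≤i⇒+∣i∣≡i (sum-nonneg γ≥0))))
      where
      go : ∀ n γ → (∀ i → 0ℤ ℤ.≤ coeff γ i) → height (coeff γ) ℤ.≤ pos n → ⟪ coeff γ , coeff γ ⟫ ≡ 2ℤ
      go zero γ γ≥0 ht = ⊥-elim (coeff-nonzero γ (sum≤0⇒zero γ≥0 ht))
      go (suc n) γ γ≥0 ht with definite (coeff γ)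
      ... | inj₁ p = ⊥-elim (coeff-nonzero γ p)
      ... | inj₂ p with ∃-positive-term _ (subst (1ℤ ℤ.≤_) (⟪⟫-def (coeff γ) (coeff γ)) p)
      ... | i , term with reflect γ i
      ... | γ′ , γ′≗ with sameSign γ′
      -- The reflection changes only the coefficient of `i`. If it makes the root negative, all
      -- other coefficients are 0.
      ... | inj₂ γ′≤0 = ≡.trans (⟪⟫-cong γ≗ei γ≗ei) (norm-simple i)
        where
        γ≗ei : coeff γ ≗ e i
        γ≗ei = multiple-of-simple γ i γ≥0 λ l i≢l → ℤ.≤-antisym
          (subst (ℤ._≤ 0ℤ) (≡.trans (γ′≗ l) (off-diagonal (coeff γ) (coeff γ ∙ i) i {l} i≢l)) (γ′≤0 l)) (γ≥0 l)
      ... | inj₁ γ′≥0 = ≡.trans (≡.sym (reflect-norm (coeff γ) i))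
          (≡.trans (≡.sym (⟪⟫-cong γ′≗ γ′≗)) (go n γ′ γ′≥0 ht′))
        where
        c = coeff γ ∙ i
        1≤c : 1ℤ ℤ.≤ c
        1≤c = proj₁ (1≤product (γ≥0 i) term)
        eqₕ : ∀ a c l → a ℤ.- l ℤ.- (a ℤ.- c ℤ.* l) ≡ (c ℤ.- 1ℤ) ℤ.* l ℤ.- 0ℤ
        eqₕ = solve-∀
        γ′≤ : ∀ l → coeff γ′ l ℤ.≤ coeff γ l ℤ.- e i l
        γ′≤ l = subst (ℤ._≤ coeff γ l ℤ.- e i l) (≡.sym (γ′≗ l))
          (lin₁ (0≤x*y (ℤ.i≤j⇒0≤j-i 1≤c) (0≤e i l)) (eqₕ (coeff γ l) c (e i l)))
        eq′ : ∀ h n → n ℤ.- (h ℤ.- 1ℤ) ≡ (1ℤ ℤ.+ n) ℤ.- h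
        eq′ = solve-∀
        ht′ : height (coeff γ′) ℤ.≤ pos n
        ht′ = ℤ.≤-trans (sum-mono γ′≤) (subst (ℤ._≤ pos n) (≡.sym (height-⊖e (coeff γ) i))
            (lin₁ ht (eq′ (height (coeff γ)) (pos n))))

    root-up : ∀ {x i} → Root x → x ∙ i ≡ -1ℤ → Root (x ⊕ e i)
    root-up {x} {i} ((γ , γ≗x) , x≥0) p with reflect γ i
    ... | γ′ , γ′≗ = (γ′ , λ l → ≡.trans (γ′≗ l)
        (≡.trans (≡.cong₂ (λ a c → a ℤ.- c ℤ.* e i l) (γ≗x l) (≡.trans (∙-cong γ≗x i) p)) (eq (x l) (e i l)))) ,
                     λ l → ℤ.+-mono-≤ (x≥0 l) (0≤e i l)
      where
      eq : ∀ a b → a ℤ.- -1ℤ ℤ.* b ≡ a ℤ.+ b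
      eq = solve-∀

    root-down : ∀ {x i} → Root x → x ∙ i ≡ 1ℤ → Root (x ⊖ e i)
    root-down {x} {i} ((γ , γ≗x) , x≥0) p with reflect γ i
    ... | γ′ , γ′≗ = (γ′ , γ′≗x′) , nonneg (sameSign γ′)
      where
      eq : ∀ a b → a ℤ.- 1ℤ ℤ.* b ≡ a ℤ.- b
      eq = solve-∀
      γ′≗x′ : coeff γ′ ≗ x ⊖ e i
      γ′≗x′ l = ≡.trans (γ′≗ l) (≡.trans
          (≡.cong₂ (λ a c → a ℤ.- c ℤ.* e i l) (γ≗x l) (≡.trans (∙-cong γ≗x i) p)) (eq (x l) (e i l)))
      nonneg : (∀ l → 0ℤ ℤ.≤ coeff γ′ l) ⊎ (∀ l → coeff γ′ l ℤ.≤ 0ℤ) → ∀ l → 0ℤ ℤ.≤ (x ⊖ e i) l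
      nonneg (inj₁ ≥0) l = subst (0ℤ ℤ.≤_) (γ′≗x′ l) (≥0 l)
      -- A negative reflected root would force `x ≗ e i`, whose pairing with `i` is 2 and not 1.
      nonneg (inj₂ ≤0) l = case ≡.trans (≡.sym p) (≡.trans (∙-cong x≗ei i) (≡.trans (e∙ i i) (A-diag i))) of
          λ ()
        where
        vanish : ∀ l → i ≢ l → coeff γ l ≡ 0ℤ
        vanish l i≢l = ≡.trans (γ≗x l) (ℤ.≤-antisym (subst (ℤ._≤ 0ℤ) (≡.trans (γ′≗x′ l)
          (≡.trans (≡.cong (λ z → x l ℤ.- z) (e-diff i≢l)) (ℤ.+-identityʳ (x l)))) (≤0 l)) (x≥0 l))
        x≗ei : x ≗ e i
        x≗ei l = ≡.trans (≡.sym (γ≗x l)) (multiple-of-simple γ i (λ l → subst (0ℤ ℤ.≤_) (≡.sym (γ≗x l)) (x≥0 l))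
            vanish l)

    positiveRoots : PositiveRoots rank
    positiveRoots = record
      { A           = A
      ; A-sym       = A-sym
      ; A-diag      = A-diag
      ; A-off       = λ i≢j → case A-off i≢j of λ { (inj₁ (p , _)) → inj₁ p ; (inj₂ (p , _)) → inj₂ p }
      ; posdef      = posdef
      ; Root        = Root
      ; root-resp   = λ { x≗y ((γ , γ≗x) , x≥0) → (γ , λ i → ≡.trans (γ≗x i) (x≗y i)) , λ i → subst (0ℤ ℤ.≤_)
          (x≗y i) (x≥0 i) }
      ; root-nonneg = proj₂
      ; root-norm   = λ { ((γ , γ≗x) , x≥0) → ≡.trans (≡.sym (⟪⟫-cong γ≗x γ≗x))
          (coeff-norm γ λ i → subst (0ℤ ℤ.≤_) (≡.sym (γ≗x i)) (x≥0 i)) }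
      ; root-simple = λ i → (simple i , coeff-simple i) , 0≤e i
      ; root-up     = root-up
      ; root-down   = root-down
      }

-- Order ideals of the root poset as ideals of integral vectors

module StarIdeals {k ℓ₁ ℓ₂ v ℓv} {K : OrderedField k ℓ₁ ℓ₂} {E : EuclideanSpace K v ℓv}
                  (Φ : RootSystem E) (Δ : SimpleSystem Φ) (laced : SimpleSystem.SimplyLaced Δ) where

  open IntegralVectors
  open PositiveRootSystems
  open RootIdeals
  open ArrangementTheory
  open import Data.Integer.Base as ℤ using (ℤ; -[1+_]; 0ℤ; 1ℤ; -1ℤ; +≤+) renaming (+_ to pos)
  open import Data.List.Base using (_∷_)
  open import Relation.Binary.PropositionalEquality as ≡ using (_≡_; _≢_; _≗_; refl; subst)
  private module K = OrderedField K
  open FieldProperties K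
  open EuclideanSpace E
  open LinearProperties K leftModule
  open RootSystem Φ
  open SimpleSystem Δ
  open FromInteger K.ring
  open RootData Φ Δ hiding (A; A-diag; A-off; A-sym; posdef; Root; root-up; root-down)
  open Arrangement leftModule root hiding (Supersolvable)
  open ArrangementProperties K leftModule root

  open PositiveRoots (positiveRoots laced)

  infix 5 _at_by_
  record Member (J : Subset size) (x : Vector rank) : Set where
    constructor _at_by_
    field
      index  : Fin size
      within : index ∈ J
      coeffs : coeff index ≗ x

  support : ∀ γ → (∀ i → 0ℤ ℤ.≤ coeff γ i) → ∃[ i ] 1ℤ ℤ.≤ coeff γ i
  support γ γ≥0 = ∃-positive-term (coeff γ) (root-height {coeff γ} ((γ , λ _ → refl) , γ≥0))

  Φ⁺? : ∀ γ → Dec (∀ i → 0ℤ ℤ.≤ coeff γ i)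
  Φ⁺? γ = all? λ i → 0ℤ ℤ.≤? coeff γ i

  module OrderIdeal {J : Subset size} (ideal : IsOrderIdeal Φ⁺ J) where

    P : Vector rank → Set
    P = Member J

    nonnegative : ∀ {γ} → γ ∈ J → ∀ i → 0ℤ ℤ.≤ coeff γ i
    nonnegative γ∈J = ∈-subset⁻ Φ⁺? (proj₁ ideal γ∈J)

    down-closed : ∀ {γ γ′} → γ ∈ J → (∀ i → 0ℤ ℤ.≤ coeff γ′ i) → γ′ ≼ γ → γ′ ∈ J
    down-closed {γ} {γ′} γ∈J γ′≥0 γ′≼γ with γ′ ≟ γ
    ... | yes refl = γ∈J
    ... | no γ′≢γ  = proj₂ ideal γ∈J (∈-subset⁺ Φ⁺? γ′≥0) (γ′≼γ , γ′≢γ)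

    P⇒Root : ∀ {x} → P x → Root x
    P⇒Root (γ at γ∈J by γ≗x) = (γ , γ≗x) , λ i → subst (0ℤ ℤ.≤_) (γ≗x i) (nonnegative γ∈J i)

    P-ideal : ∀ {x y} → P x → Root y → y ≤ᵛ x → P y
    P-ideal (γ at γ∈J by γ≗x) ((γ′ , γ′≗y) , y≥0) y≤x = γ′ at
      down-closed γ∈J (λ i → subst (0ℤ ℤ.≤_) (≡.sym (γ′≗y i)) (y≥0 i))
        (λ i → ≡.subst₂ ℤ._≤_ (≡.sym (γ′≗y i)) (≡.sym (γ≗x i)) (y≤x i)) by γ′≗y

    P-resp : ∀ {x y} → x ≗ y → P x → P y
    P-resp x≗y (γ at γ∈J by γ≗x) = γ at γ∈J by λ i → ≡.trans (γ≗x i) (x≗y i)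

    P? : ∀ x → Dec (P x)
    P? x = map′ (λ { (γ , γ∈J , γ≗x) → γ at γ∈J by γ≗x }) (λ { (γ at γ∈J by γ≗x) → γ , γ∈J , γ≗x })
                (any? λ γ → (γ ∈? J) ×-dec all? (λ i → coeff γ i ℤ.≟ x i))

    open Ideal (positiveRoots laced) P P-resp P? P⇒Root P-ideal public

    P-coeff : ∀ {γ} → γ ∈ J → P (coeff γ)
    P-coeff γ∈J = _ at γ∈J by λ _ → refl

    P⇒∈ : ∀ {γ x} → P x → coeff γ ≗ x → γ ∈ J
    P⇒∈ (γ′ at γ′∈J by γ′≗x) γ≗x = subst (_∈ J) (coeff-injective λ i → ≡.trans (γ′≗x i) (≡.sym (γ≗x i))) γ′∈J

    simple∈ : ∀ {γ i} → γ ∈ J → 1ℤ ℤ.≤ coeff γ i → simple i ∈ J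
    simple∈ γ∈J γi = P⇒∈ (P-simple (P-coeff γ∈J) γi) (coeff-simple _)

    simple≼ : ∀ {γ i} → γ ∈ J → 1ℤ ℤ.≤ coeff γ i → simple i ≼ γ
    simple≼ {γ} {i} γ∈J γi l = subst (ℤ._≤ coeff γ l) (≡.sym (coeff-simple i l)) (e≤ (nonnegative γ∈J) γi l)

    1≤simple : ∀ i → 1ℤ ℤ.≤ coeff (simple i) i
    1≤simple i = ℤ.≤-reflexive (≡.sym (≡.trans (coeff-simple i i) (e-same i)))

    simple-minimal : ∀ {i} → simple i ∈ J → IsMinimal J (simple i)
    simple-minimal {i} i∈J = i∈J , λ {y} y∈J (y≼i , y≢i) → below y∈J y≼i y≢i (support y (nonnegative y∈J))
      where
      below : ∀ {y} → y ∈ J → y ≼ simple i → y ≢ simple i → ¬ (∃[ l ] 1ℤ ℤ.≤ coeff y l)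
      below {y} y∈J y≼i y≢i (l , yl) with i ≟ l
      ... | yes refl = y≢i (coeff-injective λ m → ℤ.≤-antisym (y≼i m) (simple≼ y∈J yl m))
      ... | no i≢l   = 1≰0 (subst (1ℤ ℤ.≤_) (≡.trans (coeff-simple i l) (e-diff i≢l)) (ℤ.≤-trans yl (y≼i l)))

    minimal-simple : ∀ {x} → IsMinimal J x → ∃[ i ] x ≡ simple i
    minimal-simple {x} (x∈J , minimal) with support x (nonnegative x∈J)
    ... | i , xi with simple i ≟ x
    ... | yes refl = i , refl
    ... | no i≢x   = ⊥-elim (minimal (simple∈ x∈J xi) (simple≼ x∈J xi , i≢x))

    star⇒IsStar : Star → IsStar J
    star⇒IsStar star = a , j , b , c ,
      (adjacent⇒≢ aj , a≢b , a≢c , adjacent⇒≢ bj ∘ ≡.sym , adjacent⇒≢ cj ∘ ≡.sym , b≢c) ,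
      swap (sumIn jab) , swap (sumIn jac) , sumIn jbc
      where
      open Star star
      sumIn : ∀ {p q s} → P (triple p q s) → SumIn J p q s
      sumIn {p} {q} {s} (γ at γ∈J by γ≗) = γ , γ∈J , ≈ᴹ-trans (root≈vec γ≗) (≈ᴹ-trans (vec-⊕ (e p ⊕ e q) (e s))
        (+ᴹ-cong (≈ᴹ-trans (vec-⊕ (e p) (e q)) (+ᴹ-cong (vec-e p) (vec-e q))) (vec-e s)))
      swap : ∀ {p q s} → SumIn J p q s → SumIn J q p s
      swap (γ , γ∈J , γ≈) = γ , γ∈J , ≈ᴹ-trans γ≈ (+ᴹ-congʳ (+ᴹ-comm _ _))

    remove-filter : ∀ {F} → IsOrderFilter J F → IsOrderIdeal Φ⁺ (J ─ F)
    remove-filter {F} (F⊆J , J─F⊆J , closed) = (proj₁ ideal ∘ J─F⊆J) , λ {x} {y} x∈ y∈Φ⁺ y≺x →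
      closed x∈ (proj₂ ideal (J─F⊆J x∈) y∈Φ⁺ y≺x) y≺x

  -- Peeling an ideal that is not a star ideal

  IsStar-mono : ∀ {J J′} → J ⊆ J′ → IsStar J → IsStar J′
  IsStar-mono {J} {J′} J⊆J′ (a₁ , a₂ , a₃ , a₄ , distinct , s₁ , s₂ , s₃) =
    a₁ , a₂ , a₃ , a₄ , distinct , mono s₁ , mono s₂ , mono s₃
    where
    mono : ∀ {i j l} → SumIn J i j l → SumIn J′ i j l
    mono (γ , γ∈J , γ≈) = γ , J⊆J′ γ∈J , γ≈

  IsChain? : ∀ J → Dec (IsChain J)
  IsChain? J = map′ (λ h {x} {y} → h x y) (λ h x y → h)
    (all? λ x → all? λ y → (x ∈? J) →-dec ((y ∈? J) →-dec ((x ≼? y) ⊎-dec (y ≼? x))))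
    where
    _≼?_ : ∀ x y → Dec (x ≼ y)
    x ≼? y = all? λ i → coeff x i ℤ.≤? coeff y i

  -- The block to peel off consists of all roots of `J` above a chain vertex. The rest is a smaller
  -- ideal, and it cannot become a star ideal, since a star in it would be a star in `J`.
  ¬star⇒peelable : ∀ {J} → IsOrderIdeal Φ⁺ J → ¬ IsStar J → ChainPeelable J
  ¬star⇒peelable {J} = go _ (ℕ.≤-refl {∣ J ∣})
    where
    go : ∀ n {J} → ∣ J ∣ ℕ.≤ n → IsOrderIdeal Φ⁺ J → ¬ IsStar J → ChainPeelable J
    go n {J} size≤n ideal ¬star with IsChain? J
    ... | yes isChain = _ , chain isChain
    ... | no ¬chain with any? (_∈? J)
    ... | no none = ⊥-elim (¬chain λ x∈J _ → ⊥-elim (none (_ , x∈J)))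
    ... | yes (x , x∈J) = peelOff (chain-vertex ¬Star {proj₁ (support x (nonnegative x∈J))}
        (P-simple (P-coeff x∈J) (proj₂ (support x (nonnegative x∈J)))))
      where
      open OrderIdeal ideal
      ¬Star : ¬ Star
      ¬Star = ¬star ∘ star⇒IsStar
      peelOff : ChainVertex ¬Star → ChainPeelable J
      peelOff (w , Pw , unique) = rest n size≤n
        where
        w∈J : simple w ∈ J
        w∈J = P⇒∈ Pw (coeff-simple w)
        F? : ∀ γ → Dec (γ ∈ J × 1ℤ ℤ.≤ coeff γ w)
        F? γ = (γ ∈? J) ×-dec (1ℤ ℤ.≤? coeff γ w)
        F = subset F?
        F⁻ : ∀ {γ} → γ ∈ F → γ ∈ J × 1ℤ ℤ.≤ coeff γ w
        F⁻ = ∈-subset⁻ F?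
        w∈F : simple w ∈ F
        w∈F = ∈-subset⁺ F? (w∈J , 1≤simple w)
        isFilter : IsOrderFilter J F
        isFilter = (proj₁ ∘ F⁻) , p─q⊆p J F , λ {x} {y} x∈ y∈J y≺x → x∈p∧x∉q⇒x∈p─q y∈J λ y∈F →
          ∈─⇒∉ {p = J} x∈ (∈-subset⁺ F? (p─q⊆p J F x∈ , ℤ.≤-trans (proj₂ (F⁻ y∈F)) (proj₁ y≺x w)))
        isChain : IsChain F
        isChain x∈F y∈F = unique-covers⇒chain ¬Star Pw unique (P-coeff (proj₁ (F⁻ x∈F)))
            (P-coeff (proj₁ (F⁻ y∈F))) (proj₂ (F⁻ x∈F)) (proj₂ (F⁻ y∈F))
        smaller : ∣ J ─ F ∣ ℕ.< ∣ J ∣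
        smaller = p⊂q⇒∣p∣<∣q∣ (p─q⊆p J F , simple w , w∈J , λ w∈ → ∈─⇒∉ {p = J} w∈ w∈F)
        rest : ∀ n → ∣ J ∣ ℕ.≤ n → ChainPeelable J
        rest zero    J≤n = case ℕ.<-≤-trans smaller J≤n of λ ()
        rest (suc n) J≤n with go n (ℕ.≤-pred (ℕ.<-≤-trans smaller J≤n)) (remove-filter isFilter)
            (¬star ∘ IsStar-mono (p─q⊆p J F))
        ... | Ps , peeling = F ∷ Ps , peel ¬chain isFilter (simple w , simple-minimal w∈J , w∈F) isChain peeling

  -- From chain peelings to supersolvable partitions

  without : Fin rank → Carrierᴹ → Set _
  without v x = ∃[ c ] c v K.≈ K.0# × linComb c S ≈ᴹ x

  -- The span of the simple roots other than `v`. It contains every root that is left once the block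
  -- above `v` is removed, but not `S v`, so the block does raise the rank.
  without-submodule : ∀ v → IsSubmodule (without v)
  without-submodule v = record
    { resp = λ { x≈y (c , z , p) → c , z , ≈ᴹ-trans p x≈y }
    ; zer  = (λ _ → K.0#) , K.refl , linComb-zero S (λ _ → K.refl)
    ; add  = λ { (c , z , p) (d , z′ , q) → (λ i → c i K.+ d i) , K.trans (K.+-cong z z′) (K.+-identityˡ K.0#) ,
                 ≈ᴹ-trans (linComb-+ c d S) (+ᴹ-cong p q) }
    ; mul  = λ { a (c , z , p) → (λ i → a K.* c i) , K.trans (K.*-congˡ z) (K.zeroʳ a) , ≈ᴹ-trans
        (linComb-* a c S) (*ₗ-congˡ p) }
    }

  simple-not-without : ∀ v → ¬ without v (S v)
  simple-not-without v (c , z , p) = K.0≉1 (K.trans (K.sym z) (K.trans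
    (coordinates-unique independent (≈ᴹ-trans p (≈ᴹ-sym (linComb-δ v S))) v) (δ-same v)))

  module _ {J R : Subset size} (ideal : IsOrderIdeal Φ⁺ J)
           (isFilter : IsOrderFilter J R) {v : Fin rank} (v∈J : simple v ∈ J) (v∈R : simple v ∈ R)
           (isChain : IsChain R) where
    open OrderIdeal ideal

    -- Together with `1≤⇒R` this identifies an arbitrary block of a peeling: being a chain it lies
    -- above its minimal element, and being a filter it contains everything in `J` above that
    -- element.
    R⇒1≤ : ∀ {γ} → γ ∈ R → 1ℤ ℤ.≤ coeff γ v
    R⇒1≤ {γ} γ∈R with isChain v∈R γ∈R
    ... | inj₁ v≼γ = ℤ.≤-trans (1≤simple v) (v≼γ v)
    ... | inj₂ γ≼v with γ ≟ simple v
    ... | yes refl = 1≤simple v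
    ... | no γ≢v   = ⊥-elim (proj₂ (simple-minimal v∈J) (proj₁ isFilter γ∈R) (γ≼v , γ≢v))

    1≤⇒R : ∀ {γ} → γ ∈ J → 1ℤ ℤ.≤ coeff γ v → γ ∈ R
    1≤⇒R {γ} γ∈J γv with γ ∈? R
    ... | yes γ∈R = γ∈R
    ... | no γ∉R = ⊥-elim (∈─⇒∉ {p = J} (proj₂ (proj₂ isFilter) (x∈p∧x∉q⇒x∈p─q γ∈J γ∉R) v∈J
                     (simple≼ γ∈J γv , λ { refl → γ∉R v∈R })) v∈R)

    above-chain : ∀ {x y} → P x → P y → 1ℤ ℤ.≤ x v → 1ℤ ℤ.≤ y v → x ≤ᵛ y ⊎ y ≤ᵛ x
    above-chain (β at β∈J by β≗x) (γ at γ∈J by γ≗y) xv yv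
      with isChain (1≤⇒R β∈J (subst (1ℤ ℤ.≤_) (≡.sym (β≗x v)) xv))
          (1≤⇒R γ∈J (subst (1ℤ ℤ.≤_) (≡.sym (γ≗y v)) yv))
    ... | inj₁ β≼γ = inj₁ λ i → ≡.subst₂ ℤ._≤_ (β≗x i) (γ≗y i) (β≼γ i)
    ... | inj₂ γ≼β = inj₂ λ i → ≡.subst₂ ℤ._≤_ (γ≗y i) (β≗x i) (γ≼β i)

    difference : ∀ {β γ} → β ∈ R → γ ∈ R → β ≼ γ →
                 β ≡ γ ⊎ ∃[ δ ] δ ∈ J ─ R × root γ ≈ᴹ root β +ᴹ root δ
    difference {β} {γ} β∈R γ∈R β≼γ with chain-difference above-chain (P-coeff (proj₁ isFilter β∈R))
        (P-coeff (proj₁ isFilter γ∈R)) (R⇒1≤ β∈R) (R⇒1≤ γ∈R) β≼γ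
    ... | inj₁ β≗γ = inj₁ (coeff-injective β≗γ)
    ... | inj₂ (δ at δ∈J by δ≗ , δv≡0) = inj₂ (δ ,
            x∈p∧x∉q⇒x∈p─q δ∈J (λ δ∈R → 1≤⇒≢0 (R⇒1≤ δ∈R) (≡.trans (δ≗ v) δv≡0)) ,
            ≈ᴹ-trans (root≈vec λ i → ≡.trans (eq (coeff β i) (coeff γ i))
                (≡.cong (ℤ._+_ (coeff β i)) (≡.sym (δ≗ i))))
              (≈ᴹ-trans (vec-⊕ (coeff β) (coeff δ)) (+ᴹ-cong (≈ᴹ-sym (expansion β)) (≈ᴹ-sym (expansion δ)))))
      where
      eq : ∀ b g → g ≡ b ℤ.+ (g ℤ.- b)
      eq = solve-∀

    tower-step : ∀ {n} → Tower (J ─ R) n → Tower J (suc n)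
    tower-step {n} tower = storey tower union (λ j∈ → ∈─⇒∉ {p = J} j∈) rank-J flats
      where
      union : (J ─ R) ∪ R ≡ J
      union = ⊆-antisym (λ j∈ → case x∈p∪q⁻ (J ─ R) R j∈ of λ { (inj₁ p) → p─q⊆p J R p
          ; (inj₂ p) → proj₁ isFilter p })
                        (λ {j} j∈J → x∈p∪q⁺ (case j ∈? R of λ { (yes p) → inj₂ p
                            ; (no ¬p) → inj₁ (x∈p∧x∉q⇒x∈p─q j∈J ¬p) }))
      not-in-span : ¬ SpanOf root (J ─ R) (S v)
      not-in-span p = simple-not-without v (SpanOf-minimal root (without-submodule v) member p)
        where
        member : ∀ {j} → j ∈ J ─ R → without v (root j)
        member {j} j∈ = fromℤ ∘ coeff j , K.reflexive (≡.cong fromℤ jv≡0) , ≈ᴹ-sym (expansion j)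
          where
          jv≡0 : coeff j v ≡ 0ℤ
          jv≡0 with 0<⊎≡0 (nonnegative (p─q⊆p J R j∈) v)
          ... | inj₁ q = ⊥-elim (∈─⇒∉ {p = J} j∈ (1≤⇒R (p─q⊆p J R j∈) q))
          ... | inj₂ q = q
      open IsSubmodule (SpanOf-submodule root (J ─ R)) using (zer)
      decompose : ∀ {j} → j ∈ J → ∃[ a ] ∃[ y ] SpanOf root (J ─ R) y × root j ≈ᴹ a *ₗ S v +ᴹ y
      decompose {j} j∈J with j ∈? R
      ... | no j∉R = K.0# , root j , ∈-SpanOf root (x∈p∧x∉q⇒x∈p─q j∈J j∉R) ,
                     ≈ᴹ-sym (≈ᴹ-trans (+ᴹ-congʳ (*ₗ-zeroˡ (S v))) (+ᴹ-identityˡ (root j)))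
      -- The difference to the bottom `v` of the block lies in the rest, so the block adds a single
      -- dimension.
      ... | yes j∈R with difference v∈R j∈R (simple≼ j∈J (R⇒1≤ j∈R))
      ... | inj₁ refl = K.1# , 0ᴹ , zer , ≈ᴹ-sym (≈ᴹ-trans (+ᴹ-identityʳ _) (*ₗ-identityˡ (S v)))
      ... | inj₂ (δ , δ∈ , eq) = K.1# , root δ , ∈-SpanOf root δ∈ , ≈ᴹ-trans eq
          (+ᴹ-congʳ (≈ᴹ-sym (*ₗ-identityˡ (S v))))
      rank-J : HasRank J (suc n)
      rank-J = rank-extend (tower-rank tower) (p─q⊆p J R) v∈J not-in-span decompose
      flats : ∀ F → IsFlat J F → HasRank F 2 → ¬ (F ⊆ R)
      flats F (F⊆J , cl⊆F , _) rank₂ F⊆R with two-distinct rank₂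
      ... | β , γ , β∈F , γ∈F , β≢γ = case isChain (F⊆R β∈F) (F⊆R γ∈F) of λ
              { (inj₁ β≼γ) → contra β∈F γ∈F β≢γ β≼γ ; (inj₂ γ≼β) → contra γ∈F β∈F (β≢γ ∘ ≡.sym) γ≼β }
        where
        contra : ∀ {β γ} → β ∈ F → γ ∈ F → β ≢ γ → β ≼ γ → ⊥
        contra {β} {γ} β∈F γ∈F β≢γ β≼γ with difference (F⊆R β∈F) (F⊆R γ∈F) β≼γ
        ... | inj₁ β≡γ = β≢γ β≡γ
        ... | inj₂ (δ , δ∈ , eq) = ∈─⇒∉ {p = J} δ∈ (F⊆R (cl⊆F (p─q⊆p J R δ∈ ,
                cancelˡ (SpanOf-submodule root F)
                    (IsSubmodule.resp (SpanOf-submodule root F) eq (∈-SpanOf root γ∈F)) (∈-SpanOf root β∈F))))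

  peeling⇒tower : ∀ {J Ps} → IsOrderIdeal Φ⁺ J → ChainPeeling J Ps → ∃[ n ] Tower J n
  peeling⇒tower {J} ideal (chain isChain) with any? (_∈? J)
  ... | no none = 0 , ground λ j∈J → none (_ , j∈J)
  -- The final chain is treated as a block over an empty rest. It is generated by any simple root in
  -- the support of one of its elements.
  ... | yes (x , x∈J) = 1 , tower-step ideal
      ((λ j∈ → j∈) , p─q⊆p J J , λ x∈ _ _ → ⊥-elim (∈─⇒∉ {p = J} x∈ (p─q⊆p J J x∈)))
                              v∈J v∈J isChain (ground λ j∈ → ∈─⇒∉ {p = J} j∈ (p─q⊆p J J j∈))
    where
    open OrderIdeal ideal
    v∈J = simple∈ x∈J (proj₂ (support x (nonnegative x∈J)))
  peeling⇒tower {J} ideal (peel {Pₙ = F} ¬chain isFilter (x , minimal , x∈F) isChain peeling)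
    with OrderIdeal.minimal-simple ideal minimal
  ... | v , refl = let n , tower = peeling⇒tower (OrderIdeal.remove-filter ideal isFilter) peeling
                   in suc n , tower-step ideal isFilter (proj₁ minimal) x∈F isChain tower

  peelable⇒supersolvable : ∀ {J} → IsOrderIdeal Φ⁺ J → ChainPeelable J → Supersolvable J
  peelable⇒supersolvable ideal (_ , peeling) = tower⇒supersolvable (proj₂ (peeling⇒tower ideal peeling))

  -- Supersolvable ideals contain no star

  module _ {J : Subset size} (ideal : IsOrderIdeal Φ⁺ J) where
    open OrderIdeal ideal

    -- Otherwise the four simple roots form a 4-cycle, and their sum has norm 0.
    IsStar⇒star : IsStar J → Star
    IsStar⇒star (a₁ , a₂ , a₃ , a₄ , (d₁₂ , d₁₃ , d₁₄ , d₂₃ , d₂₄ , d₃₄) , s₁₂₃ , s₁₂₄ , s₂₃₄) =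
      cases (shape (member s₁₂₃) d₁₂ d₁₃ d₂₃) (shape (member s₁₂₄) d₁₂ d₁₄ d₂₄)
          (shape (member s₂₃₄) d₂₃ d₂₄ d₃₄)
      where
      member : ∀ {i j l} → SumIn J i j l → P (e i ⊕ e j ⊕ e l)
      member {i} {j} {l} (γ , γ∈J , γ≈) =
          γ at γ∈J by coeff-≗ (≈ᴹ-trans γ≈ (≈ᴹ-sym (≈ᴹ-trans (vec-⊕ (e i ⊕ e j) (e l))
        (+ᴹ-cong (≈ᴹ-trans (vec-⊕ (e i) (e j)) (+ᴹ-cong (vec-e i) (vec-e j))) (vec-e l)))))
      norm₂ : ∀ i j → ⟪ e i ⊕ e j , e i ⊕ e j ⟫ ≡ 2ℤ ℤ.+ (A i j ℤ.+ A i j) ℤ.+ 2ℤ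
      norm₂ i j = ≡.trans (norm-⊕ (e i) (e j)) (≡.cong₂ ℤ._+_ (≡.cong₂ (λ a b → a ℤ.+ (b ℤ.+ b))
        (root-norm (root-simple i)) (≡.trans (⟪⟫-e (e i) j) (e∙ i j))) (root-norm (root-simple j)))
      norm₃ : ∀ i j l → ⟪ e i ⊕ e j ⊕ e l , e i ⊕ e j ⊕ e l ⟫ ≡
              2ℤ ℤ.+ (A i j ℤ.+ A i j) ℤ.+ 2ℤ ℤ.+ (A i l ℤ.+ A j l ℤ.+ (A i l ℤ.+ A j l)) ℤ.+ 2ℤ
      norm₃ i j l = ≡.trans (norm-⊕ (e i ⊕ e j) (e l)) (≡.cong₂ ℤ._+_ (≡.cong₂ (λ a b → a ℤ.+ (b ℤ.+ b))
        (norm₂ i j) (≡.trans (⟪⟫-e (e i ⊕ e j) l) (≡.trans (∙-⊕e (e i) j l) (≡.cong (ℤ._+ A j l) (e∙ i l)))))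
            (root-norm (root-simple l)))
      norm₄ : ∀ i j l m → ⟪ e i ⊕ e j ⊕ e l ⊕ e m , e i ⊕ e j ⊕ e l ⊕ e m ⟫ ≡
              2ℤ ℤ.+ (A i j ℤ.+ A i j) ℤ.+ 2ℤ ℤ.+ (A i l ℤ.+ A j l ℤ.+ (A i l ℤ.+ A j l)) ℤ.+ 2ℤ
                ℤ.+ (A i m ℤ.+ A j m ℤ.+ A l m ℤ.+ (A i m ℤ.+ A j m ℤ.+ A l m)) ℤ.+ 2ℤ
      norm₄ i j l m = ≡.trans (norm-⊕ (e i ⊕ e j ⊕ e l) (e m)) (≡.cong₂ ℤ._+_ (≡.cong₂ (λ a b → a ℤ.+ (b ℤ.+ b))
        (norm₃ i j l) (≡.trans (⟪⟫-e (e i ⊕ e j ⊕ e l) m) (≡.trans (∙-⊕e (e i ⊕ e j) l m)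
          (≡.cong (ℤ._+ A l m) (≡.trans (∙-⊕e (e i) j m) (≡.cong (ℤ._+ A j m) (e∙ i m)))))))
              (root-norm (root-simple m)))
      triple-norm : ∀ i j l {a b c} → P (e i ⊕ e j ⊕ e l) → A i j ≡ a → A i l ≡ b → A j l ≡ c →
                    2ℤ ≡ 2ℤ ℤ.+ (a ℤ.+ a) ℤ.+ 2ℤ ℤ.+ (b ℤ.+ c ℤ.+ (b ℤ.+ c)) ℤ.+ 2ℤ
      triple-norm i j l Pijl refl refl refl = ≡.trans (≡.sym (root-norm (P⇒Root Pijl))) (norm₃ i j l)
      no-cycle : ∀ {a b c d f g} → A a₁ a₂ ≡ a → A a₁ a₃ ≡ b → A a₂ a₃ ≡ c → A a₁ a₄ ≡ d → A a₂ a₄ ≡ f →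
          A a₃ a₄ ≡ g →
                 2ℤ ℤ.+ (a ℤ.+ a) ℤ.+ 2ℤ ℤ.+ (b ℤ.+ c ℤ.+ (b ℤ.+ c)) ℤ.+ 2ℤ ℤ.+
                     (d ℤ.+ f ℤ.+ g ℤ.+ (d ℤ.+ f ℤ.+ g)) ℤ.+ 2ℤ ℤ.≤ 0ℤ → ⊥
      no-cycle refl refl refl refl refl refl le =
          1≤⇒≢0 one (posdef (e a₁ ⊕ e a₂ ⊕ e a₃ ⊕ e a₄) (subst (ℤ._≤ 0ℤ) (≡.sym (norm₄ a₁ a₂ a₃ a₄)) le) a₁)
        where
        one : 1ℤ ℤ.≤ (e a₁ ⊕ e a₂ ⊕ e a₃ ⊕ e a₄) a₁
        one = ℤ.≤-trans (ℤ.≤-trans (ℤ.≤-trans (ℤ.≤-reflexive (≡.sym (e-same a₁))) (≤-⊕e (e a₁) a₂ a₁))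
            (≤-⊕e (e a₁ ⊕ e a₂) a₃ a₁)) (≤-⊕e (e a₁ ⊕ e a₂ ⊕ e a₃) a₄ a₁)
      swap : ∀ {i j l} → P (e i ⊕ e j ⊕ e l) → P (triple j i l)
      swap {i} {j} {l} (γ at γ∈J by γ≗) = γ at γ∈J by λ m →
          ≡.trans (γ≗ m) (≡.cong (ℤ._+ e l m) (ℤ.+-comm (e i m) (e j m)))
      -- Three simple roots whose sum has norm 2 are joined by exactly two edges; the constructors
      -- say which of the three possible edges is absent.
      data Shape (a b c : ℤ) : Set where
        path₁ : a ≡ 0ℤ  → b ≡ -1ℤ → c ≡ -1ℤ → Shape a b c
        path₂ : a ≡ -1ℤ → b ≡ 0ℤ  → c ≡ -1ℤ → Shape a b c
        path₃ : a ≡ -1ℤ → b ≡ -1ℤ → c ≡ 0ℤ  → Shape a b c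
      shape : ∀ {i j l} → P (e i ⊕ e j ⊕ e l) → i ≢ j → i ≢ l → j ≢ l → Shape (A i j) (A i l) (A j l)
      shape {i} {j} {l} Pijl i≢j i≢l j≢l with A-off i≢j | A-off i≢l | A-off j≢l
      ... | inj₁ p | inj₂ q | inj₂ u = path₁ p q u
      ... | inj₂ p | inj₁ q | inj₂ u = path₂ p q u
      ... | inj₂ p | inj₂ q | inj₁ u = path₃ p q u
      ... | inj₁ p | inj₁ q | inj₁ u = case triple-norm i j l Pijl p q u of λ ()
      ... | inj₁ p | inj₁ q | inj₂ u = case triple-norm i j l Pijl p q u of λ ()
      ... | inj₁ p | inj₂ q | inj₁ u = case triple-norm i j l Pijl p q u of λ ()
      ... | inj₂ p | inj₁ q | inj₁ u = case triple-norm i j l Pijl p q u of λ ()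
      ... | inj₂ p | inj₂ q | inj₂ u = case triple-norm i j l Pijl p q u of λ ()
      clash : ∀ {a} {X : Set} → a ≡ 0ℤ → a ≡ -1ℤ → X
      clash p q = case ≡.trans (≡.sym p) q of λ ()
      cases : Shape (A a₁ a₂) (A a₁ a₃) (A a₂ a₃) → Shape (A a₁ a₂) (A a₁ a₄) (A a₂ a₄) →
          Shape (A a₂ a₃) (A a₂ a₄) (A a₃ a₄) → Star
      -- The one consistent choice in which all three paths have the same middle, `a₂`, the simple
      -- root common to the three sums.
      cases (path₂ p₁₂ _ p₂₃) (path₂ _ _ p₂₄) (path₃ _ _ _) = record
        { a≢b = d₁₃ ; a≢c = d₁₄ ; b≢c = d₃₄ ; aj = p₁₂ ; bj = adjacent-sym p₂₃ ; cj = adjacent-sym p₂₄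
        ; jab = swap {a₁} {a₂} {a₃} (member s₁₂₃) ; jac = swap {a₁} {a₂} {a₄} (member s₁₂₄)
            ; jbc = member s₂₃₄ }
      -- The other three consistent choices are the three 4-cycles on these roots: four norms 2 and
      -- four edges contributing -2 each.
      cases (path₁ a b c) (path₁ _ d f) (path₃ _ _ g) = ⊥-elim (no-cycle a b c d f g ℤ.≤-refl)
      cases (path₂ a b c) (path₃ _ d f) (path₂ _ _ g) = ⊥-elim (no-cycle a b c d f g ℤ.≤-refl)
      cases (path₃ a b c) (path₂ _ d f) (path₁ _ _ g) = ⊥-elim (no-cycle a b c d f g ℤ.≤-refl)
      cases (path₁ p _ _) (path₂ q _ _) _ = clash p q
      cases (path₁ p _ _) (path₃ q _ _) _ = clash p q
      cases (path₂ p _ _) (path₁ q _ _) _ = clash q p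
      cases (path₃ p _ _) (path₁ q _ _) _ = clash q p
      cases (path₁ _ _ p) _ (path₁ q _ _) = clash q p
      cases (path₂ _ _ p) _ (path₁ q _ _) = clash q p
      cases (path₃ _ _ p) _ (path₂ q _ _) = clash p q
      cases (path₃ _ _ p) _ (path₃ q _ _) = clash p q
      cases _ (path₁ _ _ p) (path₂ _ q _) = clash q p
      cases _ (path₂ _ _ p) (path₂ _ q _) = clash q p
      cases _ (path₃ _ _ p) (path₁ _ q _) = clash p q
      cases _ (path₃ _ _ p) (path₃ _ q _) = clash p q

    -- The pairing with `x`, extended from integral vectors to coordinates in the field, where the
    -- coefficients of a linear combination live.
    functional : Vector rank → (Fin rank → K.Carrier) → K.Carrier
    functional x c = sumᴷ λ i → fromℤ (x ∙ i) K.* c i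

    functional-fromℤ : ∀ x y → functional x (fromℤ ∘ y) K.≈ fromℤ ⟪ x , y ⟫
    functional-fromℤ x y = K.sym (K.trans (K.reflexive (≡.cong fromℤ (⟪⟫-def x y)))
      (K.trans (fromℤ-sum λ i → x ∙ i ℤ.* y i) (sumᴷ-cong {rank} λ i → fromℤ-* (x ∙ i) (y i))))

    functional-linear : ∀ x s t y z → functional x (λ i → s K.* fromℤ (y i) K.+ t K.* fromℤ (z i)) K.≈
                                      s K.* fromℤ ⟪ x , y ⟫ K.+ t K.* fromℤ ⟪ x , z ⟫
    functional-linear x s t y z = begin
      sumᴷ (λ i → fromℤ (x ∙ i) K.* (s K.* fromℤ (y i) K.+ t K.* fromℤ (z i)))
        ≈⟨ sumᴷ-cong {rank} (λ i → K.trans (K.distribˡ _ _ _) (K.+-cong (rotate (fromℤ (x ∙ i)) s (fromℤ (y i)))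
            (rotate (fromℤ (x ∙ i)) t (fromℤ (z i))))) ⟩
      sumᴷ (λ i → s K.* (fromℤ (x ∙ i) K.* fromℤ (y i)) K.+ t K.* (fromℤ (x ∙ i) K.* fromℤ (z i)))
        ≈⟨ sumᴷ-distrib-+ (λ i → s K.* (fromℤ (x ∙ i) K.* fromℤ (y i)))
            (λ i → t K.* (fromℤ (x ∙ i) K.* fromℤ (z i))) ⟩
      sumᴷ (λ i → s K.* (fromℤ (x ∙ i) K.* fromℤ (y i))) K.+ sumᴷ (λ i → t K.* (fromℤ (x ∙ i) K.* fromℤ (z i)))
        ≈⟨ K.+-cong (*-distribˡ-sumᴷ s (λ i → fromℤ (x ∙ i) K.* fromℤ (y i)))
            (*-distribˡ-sumᴷ t (λ i → fromℤ (x ∙ i) K.* fromℤ (z i))) ⟨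
      s K.* functional x (fromℤ ∘ y) K.+ t K.* functional x (fromℤ ∘ z)
        ≈⟨ K.+-cong (K.*-congˡ (functional-fromℤ x y)) (K.*-congˡ (functional-fromℤ x z)) ⟩
      s K.* fromℤ ⟪ x , y ⟫ K.+ t K.* fromℤ ⟪ x , z ⟫ ∎
      where
      open import Relation.Binary.Reasoning.Setoid K.setoid
      rotate : ∀ a b c → a K.* (b K.* c) K.≈ b K.* (a K.* c)
      rotate a b c = K.trans (K.sym (K.*-assoc a b c)) (K.trans (K.*-congʳ (K.*-comm a b)) (K.*-assoc b a c))

    -- If z = s x + t y with x and y orthogonal, then 2s = ⟪ x , z ⟫ and 2t = ⟪ y , z ⟫ are integers
    -- whose squares add up to 4.
    orthogonal-span : ∀ {β γ} → β ∈ J → γ ∈ J → ⟪ coeff β , coeff γ ⟫ ≡ 0ℤ →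
                      ∀ {j} → j ∈ J → Span (Pair β γ) (root j) → j ≡ β ⊎ j ≡ γ
    orthogonal-span {β} {γ} β∈J γ∈J β⊥γ {j} j∈J (c , p) with root-upper (P⇒Root (P-coeff β∈J))
        (P⇒Root (P-coeff j∈J)) | root-upper (P⇒Root (P-coeff γ∈J)) (P⇒Root (P-coeff j∈J))
    ... | inj₂ β≗j | _         = inj₁ (≡.sym (coeff-injective β≗j))
    ... | inj₁ _   | inj₂ γ≗j  = inj₂ (≡.sym (coeff-injective γ≗j))
    -- As `j` is neither `β` nor `γ`, both products lie between -1 and 1, so their squares add up to
    -- at most 2.
    ... | inj₁ M≤1 | inj₁ N≤1  =
        ⊥-elim (contra (square M≤1 (root-bound (P⇒Root (P-coeff β∈J)) (P⇒Root (P-coeff j∈J))))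
                                               (square N≤1 (root-bound (P⇒Root (P-coeff γ∈J))
                                                   (P⇒Root (P-coeff j∈J)))))
      where
      x = coeff β
      y = coeff γ
      z = coeff j
      s = c zero
      t = c (suc zero)
      M = ⟪ x , z ⟫
      N = ⟪ y , z ⟫
      square : ∀ {m} → m ℤ.≤ 1ℤ → -1ℤ ℤ.≤ m → m ℤ.* m ℤ.≤ 1ℤ
      square {pos 0} _ _ = +≤+ z≤n
      square {pos 1} _ _ = ℤ.≤-refl
      square {pos (suc (suc n))} (+≤+ (s≤s ())) _
      square { -[1+ 0 ]} _ _ = ℤ.≤-refl
      square { -[1+ suc n ]} _ (ℤ.-≤- ())
      coordinates : ∀ i → fromℤ (z i) K.≈ s K.* fromℤ (x i) K.+ t K.* fromℤ (y i)
      coordinates = coordinates-unique independent (≈ᴹ-trans (≈ᴹ-sym (expansion j)) (≈ᴹ-trans (≈ᴹ-sym p)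
        (≈ᴹ-trans (+ᴹ-cong (*ₗ-congˡ (expansion β)) (≈ᴹ-trans (+ᴹ-identityʳ _) (*ₗ-congˡ (expansion γ))))
          (≈ᴹ-sym (≈ᴹ-trans (linComb-+ (λ i → s K.* fromℤ (x i)) (λ i → t K.* fromℤ (y i)) S)
            (+ᴹ-cong (linComb-* s (fromℤ ∘ x) S) (linComb-* t (fromℤ ∘ y) S)))))))
      value : ∀ u → fromℤ ⟪ u , z ⟫ K.≈ s K.* fromℤ ⟪ u , x ⟫ K.+ t K.* fromℤ ⟪ u , y ⟫
      value u = K.trans (K.sym (functional-fromℤ u z))
          (K.trans (sumᴷ-cong {rank} λ i → K.*-congˡ (coordinates i)) (functional-linear u s t x y))
      M≈ : fromℤ M K.≈ s K.* two
      M≈ = K.trans (value x) (K.trans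
          (K.+-cong (K.*-congˡ (K.reflexive (≡.cong fromℤ (root-norm (P⇒Root (P-coeff β∈J))))))
        (K.trans (K.*-congˡ (K.reflexive (≡.cong fromℤ β⊥γ))) (K.zeroʳ t))) (K.+-identityʳ _))
      N≈ : fromℤ N K.≈ t K.* two
      N≈ = K.trans (value y) (K.trans
          (K.+-cong (K.trans (K.*-congˡ (K.reflexive (≡.cong fromℤ (≡.trans (⟪⟫-sym y x) β⊥γ)))) (K.zeroʳ s))
        (K.*-congˡ (K.reflexive (≡.cong fromℤ (root-norm (P⇒Root (P-coeff γ∈J))))))) (K.+-identityˡ _))
      sum-of-squares : M ℤ.* M ℤ.+ N ℤ.* N ≡ pos 4
      sum-of-squares = fromℤ-injective (begin
        fromℤ (M ℤ.* M ℤ.+ N ℤ.* N)                                          ≈⟨ fromℤ-+ (M ℤ.* M) (N ℤ.* N) ⟩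
        fromℤ (M ℤ.* M) K.+ fromℤ (N ℤ.* N)
            ≈⟨ K.+-cong (fromℤ-* M M) (fromℤ-* N N) ⟩
        fromℤ M K.* fromℤ M K.+ fromℤ N K.* fromℤ N
            ≈⟨ K.+-cong (K.*-congʳ M≈) (K.*-congʳ N≈) ⟩
        s K.* two K.* fromℤ M K.+ t K.* two K.* fromℤ N
            ≈⟨ K.+-cong (shuffle s (fromℤ M)) (shuffle t (fromℤ N)) ⟩
        two K.* (s K.* fromℤ M) K.+ two K.* (t K.* fromℤ N)                  ≈⟨ K.distribˡ two _ _ ⟨
        two K.* (s K.* fromℤ M K.+ t K.* fromℤ N)
            ≡⟨ ≡.cong₂ (λ a b → two K.* (s K.* fromℤ a K.+ t K.* fromℤ b)) (⟪⟫-sym x z) (⟪⟫-sym y z) ⟩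
        two K.* (s K.* fromℤ ⟪ z , x ⟫ K.+ t K.* fromℤ ⟪ z , y ⟫)            ≈⟨ K.*-congˡ (value z) ⟨
        two K.* fromℤ ⟪ z , z ⟫
            ≡⟨ ≡.cong (λ a → two K.* fromℤ a) (root-norm (P⇒Root (P-coeff j∈J))) ⟩
        two K.* two                                                          ≈⟨ fromℤ-* 2ℤ 2ℤ ⟨
        fromℤ (pos 4)                                                        ∎)
        where
        open import Relation.Binary.Reasoning.Setoid K.setoid
        shuffle : ∀ a b → a K.* two K.* b K.≈ two K.* (a K.* b)
        shuffle a b = K.trans (K.*-congʳ (K.*-comm a two)) (K.*-assoc two a b)
      contra : M ℤ.* M ℤ.≤ 1ℤ → N ℤ.* N ℤ.≤ 1ℤ → ⊥
      contra p q = case subst (ℤ._≤ 2ℤ) sum-of-squares (ℤ.+-mono-≤ p q) of λ { (+≤+ (s≤s (s≤s ()))) }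

    nonparallel : ∀ {i j} → i ∈ J → j ∈ J → ∀ t → root i ≈ᴹ t *ₗ root j → i ≡ j
    nonparallel {i} {j} i∈J j∈J t p with reduced j i t p
    ... | inj₁ q = injective q
    ... | inj₂ q = ⊥-elim (coeff-nonzero laced i λ l → nonneg-sum-zero (nonnegative i∈J l) (nonnegative j∈J l)
                     (≡.trans (≡.cong (ℤ._+ coeff j l) (coeff-≗ {x = λ l → -1ℤ ℤ.* coeff j l} opposite l))
                         (eq (coeff j l))))
      where
      eq : ∀ a → -1ℤ ℤ.* a ℤ.+ a ≡ 0ℤ
      eq = solve-∀
      opposite : root i ≈ᴹ vec (λ l → -1ℤ ℤ.* coeff j l)
      opposite = ≈ᴹ-trans q (≈ᴹ-sym
          (≈ᴹ-trans (vec-* -1ℤ (coeff j)) (≈ᴹ-trans (*ₗ-cong (K.-‿cong fromℤ-1) (≈ᴹ-sym (expansion j)))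
        (≈ᴹ-trans (-ᴹ-*ₗ K.1# (root j)) (-ᴹ‿cong (*ₗ-identityˡ (root j)))))))

    module _ {n} {Π : Fin n → Subset size} (part : IsPartition J Π) (cond : ∀ i → Condition Π i) where
      open Modular (λ {j} _ → nonzero j) nonparallel part cond
      open IsPartition part

      In : ℕ → Vector rank → Set
      In m = Member (initial m)

      initial⊆ : ∀ {m γ} → γ ∈ initial m → γ ∈ J
      initial⊆ {m} γ∈ = let i , _ , γ∈Π = ∈-subset⁻ (initial? m) γ∈ in within i γ∈Π

      root-⊕ : ∀ {γ δ ε x y} → coeff γ ≗ x → coeff δ ≗ y → coeff ε ≗ x ⊕ y → root ε ≈ᴹ root γ +ᴹ root δ
      root-⊕ {x = x} {y} γ≗x δ≗y ε≗ =
          ≈ᴹ-trans (root≈vec ε≗) (≈ᴹ-trans (vec-⊕ x y)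
          (+ᴹ-cong (≈ᴹ-sym (root≈vec γ≗x)) (≈ᴹ-sym (root≈vec δ≗y))))

      closed-add : ∀ {m x y} → In m x → In m y → P (x ⊕ y) → In m (x ⊕ y)
      closed-add {m} (γ at γ∈ by γ≗x) (δ at δ∈ by δ≗y) (ε at ε∈J by ε≗) = ε at
        initial-closed ε∈J (resp (≈ᴹ-sym (root-⊕ γ≗x δ≗y ε≗)) (add (∈-SpanOf root γ∈) (∈-SpanOf root δ∈))) by ε≗
        where open IsSubmodule (SpanOf-submodule root (initial m))

      closed-sub : ∀ {m x y} → In m (x ⊕ y) → In m x → P y → In m y
      closed-sub {m} (ε at ε∈ by ε≗) (γ at γ∈ by γ≗x) (δ at δ∈J by δ≗y) = δ at
        initial-closed δ∈J (cancelˡ sub (IsSubmodule.resp sub (root-⊕ γ≗x δ≗y ε≗) (∈-SpanOf root ε∈))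
            (∈-SpanOf root γ∈)) by δ≗y
        where sub = SpanOf-submodule root (initial m)

      orthogonal : ∀ {m x y} → In (suc m) x → In (suc m) y → ⟪ x , y ⟫ ≡ 0ℤ → In m x ⊎ In m y
      orthogonal {m} {x} {y} (β at β∈ by β≗x) (γ at γ∈ by γ≗y) x⊥y =
        [ (λ p → inj₁ (β at p by β≗x)) , (λ p → inj₂ (γ at p by γ≗y)) ]′
          (pair-flat-meets β∈ γ∈ β≢γ (orthogonal-span (initial⊆ β∈) (initial⊆ γ∈) β⊥γ))
        where
        β⊥γ : ⟪ coeff β , coeff γ ⟫ ≡ 0ℤ
        β⊥γ = ≡.trans (⟪⟫-cong β≗x γ≗y) x⊥y
        β≢γ : β ≢ γ
        β≢γ refl = case ≡.trans (≡.sym (root-norm (P⇒Root (P-coeff (initial⊆ β∈))))) β⊥γ of λ ()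

      module _ {j : Fin rank} (Pj : P (e j)) where

        Legs : Fin rank → Fin rank → Set
        Legs a b = a ≢ b × Adjacent a j × Adjacent b j × P (triple j a b)

        Legs-sym : ∀ {a b} → Legs a b → Legs b a
        Legs-sym {a} {b} (a≢b , aj , bj , Pjab) =
            a≢b ∘ ≡.sym , bj , aj , P-resp (λ i → eq (e j i) (e a i) (e b i)) Pjab
          where
          eq : ∀ x y z → x ℤ.+ y ℤ.+ z ≡ x ℤ.+ z ℤ.+ y
          eq = solve-∀

        P-edge : ∀ {a b} → Legs a b → P (e j ⊕ e a)
        P-edge {a} {b} (a≢b , aj , bj , Pjab) =
            P-ideal Pjab (raise (root-simple j) (ℤ.≤-reflexive (≡.trans (e∙ j a) (adjacent-sym aj))))
            (≤-⊕e (e j ⊕ e a) b)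

        P-leg : ∀ {a b} → Legs a b → P (e a)
        P-leg {a} legs = P-simple (P-edge legs) (ℤ.+-mono-≤ (0≤e j a) (ℤ.≤-reflexive (≡.sym (e-same a))))

        edge∙ : ∀ {a b} → Legs a b → (e j ⊕ e a) ∙ b ≡ -1ℤ
        edge∙ legs@(_ , _ , _ , Pjab) = cover⇒∙ (P⇒Root (P-edge legs)) (P⇒Root Pjab)

        leg∙ : ∀ {a b} → Legs a b → A a b ≡ 0ℤ
        leg∙ {a} {b} legs@(_ , _ , bj , _) =
            cancel (≡.trans (≡.sym (≡.trans (∙-⊕e (e j) a b)
            (≡.cong (ℤ._+ A a b) (≡.trans (e∙ j b) (adjacent-sym bj))))) (edge∙ legs))
          where
          eq : ∀ x → x ≡ 1ℤ ℤ.+ (-1ℤ ℤ.+ x)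
          eq = solve-∀
          cancel : ∀ {x} → -1ℤ ℤ.+ x ≡ -1ℤ → x ≡ 0ℤ
          cancel {x} p = ≡.trans (eq x) (≡.cong (ℤ._+_ 1ℤ) p)

        legs-orthogonal : ∀ {a b} → Legs a b → ⟪ e a , e b ⟫ ≡ 0ℤ
        legs-orthogonal {a} {b} legs = ≡.trans (⟪⟫-e (e a) b) (≡.trans (e∙ a b) (leg∙ legs))

        edges-orthogonal : ∀ {a b} → Legs a b → ⟪ e j ⊕ e a , e j ⊕ e b ⟫ ≡ 0ℤ
        edges-orthogonal {a} {b} legs@(_ , aj , _) = ≡.trans (⟪⟫-⊕ʳ (e j ⊕ e a) (e j) (e b)) (≡.cong₂ ℤ._+_
          (≡.trans (⟪⟫-e (e j ⊕ e a) j)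
              (≡.trans (∙-⊕e (e j) a j) (≡.cong₂ ℤ._+_ (≡.trans (e∙ j j) (A-diag j)) aj)))
          (≡.trans (⟪⟫-e (e j ⊕ e a) b) (edge∙ legs)))

        triples-orthogonal : ∀ {a b c} → Legs a b → Legs a c → Legs b c → ⟪ triple j a c , triple j b c ⟫ ≡ 0ℤ
        triples-orthogonal {a} {b} {c} ab ac bc = ≡.trans (⟪⟫-⊕ʳ (triple j a c) (e j ⊕ e b) (e c))
            (≡.cong₂ ℤ._+_
          (≡.trans (⟪⟫-⊕ˡ (e j ⊕ e a) (e c) (e j ⊕ e b)) (≡.cong₂ ℤ._+_ (edges-orthogonal ab)
            (≡.trans (⟪⟫-sym (e c) (e j ⊕ e b)) (≡.trans (⟪⟫-e (e j ⊕ e b) c) (edge∙ bc)))))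
          (≡.trans (⟪⟫-e (triple j a c) c)
              (≡.trans (∙-⊕e (e j ⊕ e a) c c) (≡.cong₂ ℤ._+_ (edge∙ ac) (A-diag c)))))

        All : ℕ → Fin rank → Fin rank → Fin rank → Set
        All m a b c = In m (e j) × In m (e a) × In m (e b) × In m (e c)

        -- The edges `j + a` and `j + b` are orthogonal, so one of them is already in stage `m`, and
        -- subtracting its leg gives `j`. Then the same holds for one of `j + a + c` and
        -- `j + b + c`, and subtracting `j + a` or `j + b` gives `c`.
        complete : ∀ {m a b c} → Legs a b → Legs a c → Legs b c → All (suc m) a b c →
                   In m (e a) → In m (e b) → All m a b c
        complete {m} {a} {b} {c} ab ac bc (Ij , Ia , Ib , Ic) Ja Jb = Jj , Ja , Jb , Jc
          where
          swap : ∀ {x y} → In m (x ⊕ y) → In m (y ⊕ x)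
          swap {x} {y} (γ at γ∈ by γ≗) = γ at γ∈ by λ i → ≡.trans (γ≗ i) (ℤ.+-comm (x i) (y i))
          Jj : In m (e j)
          Jj = [ (λ p → closed-sub {x = e a} (swap {e j} {e a} p) Ja Pj)
               , (λ p → closed-sub {x = e b} (swap {e j} {e b} p) Jb Pj)
               ]′ (orthogonal {x = e j ⊕ e a} {y = e j ⊕ e b} (closed-add {x = e j} Ij Ia (P-edge ab))
                   (closed-add {x = e j} Ij Ib (P-edge bc)) (edges-orthogonal ab))
          Pjac : P (triple j a c)
          Pjac = proj₂ (proj₂ (proj₂ ac))
          Pjbc : P (triple j b c)
          Pjbc = proj₂ (proj₂ (proj₂ bc))
          Pc : P (e c)
          Pc = P-leg (Legs-sym ac)
          Jc : In m (e c)
          Jc = [ (λ p → closed-sub {x = e j ⊕ e a} p (closed-add {x = e j} Jj Ja (P-edge ab)) Pc)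
               , (λ p → closed-sub {x = e j ⊕ e b} p (closed-add {x = e j} Jj Jb (P-edge bc)) Pc)
               ]′ (orthogonal {x = triple j a c} {y = triple j b c}
                    (closed-add {x = e j ⊕ e a} (closed-add {x = e j} Ij Ia (P-edge ab)) Ic Pjac)
                    (closed-add {x = e j ⊕ e b} (closed-add {x = e j} Ij Ib (P-edge bc)) Ic Pjbc)
                    (triples-orthogonal ab ac bc))

        -- Of the pairwise orthogonal `a`, `b`, `c` at most one is new at this stage. The two others
        -- play the part of the first two legs in `complete`.
        descend-level : ∀ {m a b c} → Legs a b → Legs a c → Legs b c → All (suc m) a b c → All m a b c
        descend-level {m} {a} {b} {c} ab ac bc (Ij , Ia , Ib , Ic) =
          two-of-three (orthogonal Ia Ib (legs-orthogonal ab)) (orthogonal Ia Ic (legs-orthogonal ac))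
              (orthogonal Ib Ic (legs-orthogonal bc))
          where
          two-of-three : In m (e a) ⊎ In m (e b) → In m (e a) ⊎ In m (e c) → In m (e b) ⊎ In m (e c) →
              All m a b c
          two-of-three (inj₁ Ja) _ (inj₁ Jb) = complete ab ac bc (Ij , Ia , Ib , Ic) Ja Jb
          two-of-three (inj₂ Jb) (inj₁ Ja) _ = complete ab ac bc (Ij , Ia , Ib , Ic) Ja Jb
          two-of-three (inj₁ Ja) _ (inj₂ Jc) = let Jj , Ja , Jc , Jb = complete ac ab (Legs-sym bc) (Ij , Ia , Ic , Ib) Ja Jc in Jj , Ja , Jb , Jc
          two-of-three (inj₂ Jb) (inj₂ Jc) _ = let Jj , Jb , Jc , Ja = complete bc (Legs-sym ab) (Legs-sym ac) (Ij , Ib , Ic , Ia) Jb Jc in Jj , Ja , Jb , Jc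

        no-level : ∀ m {a b c} → Legs a b → Legs a c → Legs b c → ¬ All m a b c
        no-level zero    ab ac bc (_ at γ∈ by _ , _) = initial-zero γ∈
        no-level (suc m) ab ac bc all = no-level m ab ac bc (descend-level ab ac bc all)

      no-star : ¬ Star
      no-star star = no-level Pj n ab (a≢c , aj , cj , jac) bc
        (top Pj , top (P-leg Pj ab) , top (P-leg Pj bc) , top (P-leg Pj (Legs-sym Pj bc)))
        where
        open Star star
        Pj : P (e j)
        Pj = P-simple jab (ℤ.+-mono-≤ (ℤ.+-mono-≤ (ℤ.≤-reflexive (≡.sym (e-same j))) (0≤e a j)) (0≤e b j))
        ab : Legs Pj a b
        ab = a≢b , aj , bj , jab
        bc : Legs Pj b c
        bc = b≢c , bj , cj , jbc
        top : ∀ {x} → P x → In n x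
        top (γ at γ∈J by γ≗x) = let i , γ∈Π = covers γ∈J in γ at ∈-subset⁺ (initial? n) (i , toℕ<n i , γ∈Π) by γ≗x

  supersolvable⇒¬star : ∀ {J} → IsOrderIdeal Φ⁺ J → Supersolvable J → ¬ IsStar J
  supersolvable⇒¬star ideal (n , _ , Π , part , cond) = no-star ideal part cond ∘ IsStar⇒star ideal

theorem6p6 : ∀ {k ℓ₁ ℓ₂ v ℓv} (K : OrderedField k ℓ₁ ℓ₂) (E : EuclideanSpace K v ℓv)
    (Φ : RootSystem E) (Δ : SimpleSystem Φ) → let open SimpleSystem Δ in
    SimplyLaced →
    (I : Subset (RootSystem.size Φ)) → IsOrderIdeal Φ⁺ I →
    (Supersolvable I ⇔ ChainPeelable I) × (ChainPeelable I ⇔ (¬ IsStar I))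
theorem6p6 K E Φ Δ laced I ideal =
  -- The three implications form the cycle (a) ⇒ (c) ⇒ (b) ⇒ (a).
  mk⇔ (¬star⇒peelable ideal ∘ supersolvable⇒¬star ideal) (peelable⇒supersolvable ideal) ,
  mk⇔ (supersolvable⇒¬star ideal ∘ peelable⇒supersolvable ideal) (¬star⇒peelable ideal)
  where open StarIdeals Φ Δ laced
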